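{- Let $K_4-e$ be the graph obtained from the complete graph $K_4$ by removing one edge. The set of all ordered multiplicity lists attained by matrices in $\mathcal{S}_L(K_4-e)$ is exactly $\{(1,1,1,1), (1,1,2), (1,2,1)\}$.
   Context: For a finite simple graph $G$ on $n$ vertices, $\mathcal{S}_L(G)$ denotes the set of $n\times n$ real symmetric matrices $A=[a_{i,j}]$ such that $a_{i,j}<0$ if $\{i,j\}\in E(G)$, $a_{i,j}=0$ if $i\neq j$ and $\{i,j\}\notin E(G)$, and $a_{i,i}=-\sum_{k\neq i}a_{i,k}$ for all $i$. The ordered multiplicity list of $A\in\mathcal{S}_L(G)$ is $(m_1,\ldots,m_q)$, where $\lambda_1<\lambda_2<\cdots<\lambda_q$ are the distinct eigenvalues of $A$ in increasing order and $m_i$ is the multiplicity of $\lambda_i$. -}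

module Defs where

open import Algebra.Bundles.Raw using (RawRing)
import Algebra.Definitions.RawMonoid as RawMonoidDefinitions
open import Data.Bool.Base using (if_then_else_)
open import Data.Fin.Base as Fin using (Fin)
import Data.Fin.Properties as Fin
open import Data.List.Base using (List; length; lookup)
open import Data.Nat.Base as ℕ using (ℕ)
import Data.Nat.Properties as ℕ
open import Data.Product.Base using (_×_; _,_; ∃; ∃-syntax; proj₁)
open import Data.Rational.Base as ℚ using (ℚ; 0ℚ; 1ℚ; ½; ∣_∣)
import Data.Rational.Properties as ℚ
open import Data.Rational.Solver using (module +-*-Solver)
open import Data.Sum.Base using (_⊎_; inj₁; inj₂)
open import Data.Vec.Functional using (Vector)
open import Data.Vec.Functional.Relation.Binary.Pointwise using (Pointwise)
open import Function.Base using (_∘_)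
open import Function.Bundles using (_⇔_)
open import Level using (0ℓ)
open import Relation.Binary.Core using (Rel)
open import Relation.Binary.Definitions using (Decidable; Irreflexive; Symmetric)
open import Relation.Binary.PropositionalEquality
  using (_≡_; _≢_; refl; sym; trans; cong; subst; subst₂)
open import Relation.Nullary using (¬_; does; ¬?; _×-dec_; _⊎-dec_)

-- Real numbers are Cauchy sequences of rationals; equality of reals is the
-- setoid relation _≈_ below, not _≡_.

IsCauchy : (ℕ → ℚ) → Set
IsCauchy s = ∀ ε → 0ℚ ℚ.< ε →
  ∃[ N ] ∀ m n → N ℕ.≤ m → N ℕ.≤ n → ∣ s m ℚ.- s n ∣ ℚ.< ε

record ℝ : Set where
  constructor mkℝ
  field
    seq    : ℕ → ℚ
    cauchy : IsCauchy seq

open ℝ public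

infix 4 _≈_ _<_ _#_
infixl 6 _+_
infixl 7 _*_
infix 8 -_

record _≈_ (x y : ℝ) : Set where
  constructor mk≈
  field
    close : ∀ ε → 0ℚ ℚ.< ε → ∃[ N ] ∀ n → N ℕ.≤ n → ∣ seq x n ℚ.- seq y n ∣ ℚ.< ε

open _≈_ public

record _<_ (x y : ℝ) : Set where
  constructor mk<
  field
    gap       : ℚ
    gap>0     : 0ℚ ℚ.< gap
    from      : ℕ
    separated : ∀ n → from ℕ.≤ n → seq x n ℚ.+ gap ℚ.< seq y n

open _<_ public

-- Apartness, the constructive form of x ≠ y; classically ¬ (x ≈ y).
_#_ : Rel ℝ 0ℓ
x # y = (x < y) ⊎ (y < x)

half>0 : ∀ {ε} → 0ℚ ℚ.< ε → 0ℚ ℚ.< ½ ℚ.* ε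
half>0 {ε} p = ℚ.*-monoʳ-<-pos ½ p

half+half : ∀ ε → ½ ℚ.* ε ℚ.+ ½ ℚ.* ε ≡ ε
half+half = solve 1 (λ e → con ½ :* e :+ con ½ :* e := e) refl
  where open +-*-Solver

∣-∣<+ : ∀ p q {ε} → ∣ p ∣ ℚ.< ½ ℚ.* ε → ∣ q ∣ ℚ.< ½ ℚ.* ε → ∣ p ℚ.+ q ∣ ℚ.< ε
∣-∣<+ p q {ε} p< q< = ℚ.≤-<-trans (ℚ.∣p+q∣≤∣p∣+∣q∣ p q)
  (subst (∣ p ∣ ℚ.+ ∣ q ∣ ℚ.<_) (half+half ε) (ℚ.+-mono-< p< q<))

+-differences : ∀ a b c d → (a ℚ.- c) ℚ.+ (b ℚ.- d) ≡ (a ℚ.+ b) ℚ.- (c ℚ.+ d)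
+-differences = solve 4 (λ a b c d → (a :- c) :+ (b :- d) := (a :+ b) :- (c :+ d)) refl
  where open +-*-Solver

-‿differences : ∀ a b → ℚ.- (a ℚ.- b) ≡ ℚ.- a ℚ.- ℚ.- b
-‿differences = solve 2 (λ a b → :- (a :- b) := :- a :- :- b) refl
  where open +-*-Solver

*-differences : ∀ a b c d → a ℚ.* (b ℚ.- d) ℚ.+ d ℚ.* (a ℚ.- c) ≡ a ℚ.* b ℚ.- c ℚ.* d
*-differences = solve 4 (λ a b c d → a :* (b :- d) :+ d :* (a :- c) := a :* b :- c :* d) refl
  where open +-*-Solver

restore : ∀ a b → (a ℚ.- b) ℚ.+ b ≡ a
restore = solve 2 (λ a b → (a :- b) :+ b := a) refl
  where open +-*-Solver

eventuallyBounded : ∀ x → ∃[ B ] (0ℚ ℚ.< B) × ∃[ N ] ∀ n → N ℕ.≤ n → ∣ seq x n ∣ ℚ.< B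
eventuallyBounded x with cauchy x 1ℚ (ℚ.positive⁻¹ 1ℚ)
... | N , near = 1ℚ ℚ.+ ∣ seq x N ∣
               , ℚ.+-mono-<-≤ (ℚ.positive⁻¹ 1ℚ) (ℚ.0≤∣p∣ (seq x N))
               , N , λ n N≤n → subst (λ p → ∣ p ∣ ℚ.< _) (restore (seq x n) (seq x N))
                   (ℚ.≤-<-trans (ℚ.∣p+q∣≤∣p∣+∣q∣ (seq x n ℚ.- seq x N) (seq x N))
                     (ℚ.+-monoˡ-< ∣ seq x N ∣ (near n N N≤n ℕ.≤-refl)))

tolerance : ∀ {B ε} → 0ℚ ℚ.< B → 0ℚ ℚ.< ε → ∃[ δ ] (0ℚ ℚ.< δ) ×
            (∀ p q → ∣ p ∣ ℚ.< B → ∣ q ∣ ℚ.< δ → ∣ p ℚ.* q ∣ ℚ.< ε)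
tolerance {B} {ε} B>0 ε>0 = δ , ℚ.positive⁻¹ δ {{δ-pos}} , bound
  where
  instance
    B-pos : ℚ.Positive B
    B-pos = ℚ.positive B>0
    B-nonNeg : ℚ.NonNegative B
    B-nonNeg = ℚ.pos⇒nonNeg B
    B-nonZero : ℚ.NonZero B
    B-nonZero = ℚ.pos⇒nonZero B
  δ : ℚ
  δ = (ℚ.1/ B) ℚ.* ε
  δ-pos : ℚ.Positive δ
  δ-pos = ℚ.pos*pos⇒pos (ℚ.1/ B) {{ℚ.1/pos⇒pos B}} ε {{ℚ.positive ε>0}}
  Bδ≡ε : B ℚ.* δ ≡ ε
  Bδ≡ε = trans (sym (ℚ.*-assoc B (ℚ.1/ B) ε))
           (trans (cong (ℚ._* ε) (ℚ.*-inverseʳ B)) (ℚ.*-identityˡ ε))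
  bound : ∀ p q → ∣ p ∣ ℚ.< B → ∣ q ∣ ℚ.< δ → ∣ p ℚ.* q ∣ ℚ.< ε
  bound p q p< q< = subst₂ ℚ._<_ (sym (ℚ.∣p*q∣≡∣p∣*∣q∣ p q)) Bδ≡ε
    (ℚ.≤-<-trans (ℚ.*-monoʳ-≤-nonNeg ∣ q ∣ {{ℚ.∣-∣-nonNeg q}} (ℚ.<⇒≤ p<))
                 (ℚ.*-monoʳ-<-pos B q<))

fromℚ : ℚ → ℝ
fromℚ q = mkℝ (λ _ → q) λ ε ε>0 →
  0 , λ _ _ _ _ → subst (λ p → ∣ p ∣ ℚ.< ε) (sym (ℚ.+-inverseʳ q)) ε>0

0ℝ 1ℝ : ℝ
0ℝ = fromℚ 0ℚ
1ℝ = fromℚ 1ℚ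

-- Only the moduli of convergence are abstract; the sequences compute.
abstract
  +-cauchy : ∀ x y → IsCauchy (λ n → seq x n ℚ.+ seq y n)
  +-cauchy x y ε ε>0 =
    let (N₁ , near₁) = cauchy x (½ ℚ.* ε) (half>0 ε>0)
        (N₂ , near₂) = cauchy y (½ ℚ.* ε) (half>0 ε>0)
    in N₁ ℕ.⊔ N₂ , λ m n N≤m N≤n →
       subst (λ p → ∣ p ∣ ℚ.< ε) (+-differences (seq x m) (seq y m) (seq x n) (seq y n))
         (∣-∣<+ (seq x m ℚ.- seq x n) (seq y m ℚ.- seq y n)
           (near₁ m n (ℕ.m⊔n≤o⇒m≤o N₁ N₂ N≤m) (ℕ.m⊔n≤o⇒m≤o N₁ N₂ N≤n))
           (near₂ m n (ℕ.m⊔n≤o⇒n≤o N₁ N₂ N≤m) (ℕ.m⊔n≤o⇒n≤o N₁ N₂ N≤n)))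

  -‿cauchy : ∀ x → IsCauchy (λ n → ℚ.- seq x n)
  -‿cauchy x ε ε>0 =
    let (N , near) = cauchy x ε ε>0
    in N , λ m n N≤m N≤n →
       subst (ℚ._< ε) (cong ∣_∣ (-‿differences (seq x m) (seq x n)))
         (subst (ℚ._< ε) (sym (ℚ.∣-p∣≡∣p∣ (seq x m ℚ.- seq x n))) (near m n N≤m N≤n))

  *-cauchy : ∀ x y → IsCauchy (λ n → seq x n ℚ.* seq y n)
  *-cauchy x y ε ε>0 =
    let (B , B>0 , M₁ , x<B) = eventuallyBounded x
        (C , C>0 , M₂ , y<C) = eventuallyBounded y
        (δ , δ>0 , small₁)   = tolerance B>0 (half>0 ε>0)
        (η , η>0 , small₂)   = tolerance C>0 (half>0 ε>0)
        (N₁ , near₁)         = cauchy y δ δ>0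
        (N₂ , near₂)         = cauchy x η η>0
        M = M₁ ℕ.⊔ M₂
        N = N₁ ℕ.⊔ N₂
        M≤ : ∀ {k} → M ℕ.⊔ N ℕ.≤ k → M ℕ.≤ k
        M≤ = ℕ.m⊔n≤o⇒m≤o M N
        N≤ : ∀ {k} → M ℕ.⊔ N ℕ.≤ k → N ℕ.≤ k
        N≤ = ℕ.m⊔n≤o⇒n≤o M N
    in M ℕ.⊔ N , λ m n ≤m ≤n →
       subst (λ p → ∣ p ∣ ℚ.< ε) (*-differences (seq x m) (seq y m) (seq x n) (seq y n))
         (∣-∣<+ (seq x m ℚ.* (seq y m ℚ.- seq y n)) (seq y n ℚ.* (seq x m ℚ.- seq x n))
           (small₁ (seq x m) (seq y m ℚ.- seq y n)
             (x<B m (ℕ.m⊔n≤o⇒m≤o M₁ M₂ (M≤ ≤m)))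
             (near₁ m n (ℕ.m⊔n≤o⇒m≤o N₁ N₂ (N≤ ≤m)) (ℕ.m⊔n≤o⇒m≤o N₁ N₂ (N≤ ≤n))))
           (small₂ (seq y n) (seq x m ℚ.- seq x n)
             (y<C n (ℕ.m⊔n≤o⇒n≤o M₁ M₂ (M≤ ≤n)))
             (near₂ m n (ℕ.m⊔n≤o⇒n≤o N₁ N₂ (N≤ ≤m)) (ℕ.m⊔n≤o⇒n≤o N₁ N₂ (N≤ ≤n)))))

_+_ : ℝ → ℝ → ℝ
x + y = mkℝ (λ n → seq x n ℚ.+ seq y n) (+-cauchy x y)

-_ : ℝ → ℝ
- x = mkℝ (λ n → ℚ.- seq x n) (-‿cauchy x)

_*_ : ℝ → ℝ → ℝ
x * y = mkℝ (λ n → seq x n ℚ.* seq y n) (*-cauchy x y)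

ℝ-rawRing : RawRing 0ℓ 0ℓ
ℝ-rawRing = record
  { Carrier = ℝ ; _≈_ = _≈_ ; _+_ = _+_ ; _*_ = _*_ ; -_ = -_ ; 0# = 0ℝ ; 1# = 1ℝ }

open RawMonoidDefinitions (RawRing.+-rawMonoid ℝ-rawRing) public using (sum)

infix 4 _≋_

_≋_ : ∀ {n} → Rel (Vector ℝ n) 0ℓ
_≋_ = Pointwise _≈_

Matrix : ℕ → Set
Matrix n = Fin n → Fin n → ℝ

_*ᵥ_ : ∀ {n} → Matrix n → Vector ℝ n → Vector ℝ n
(A *ᵥ v) i = sum (λ j → A i j * v j)

_∙ᵥ_ : ∀ {n} → ℝ → Vector ℝ n → Vector ℝ n
(c ∙ᵥ v) i = c * v i

combination : ∀ {m n} → Vector ℝ m → Vector (Vector ℝ n) m → Vector ℝ n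
combination c b i = sum (λ k → c k * b k i)

record IsBasis {m n} (V : Vector ℝ n → Set) (b : Vector (Vector ℝ n) m) : Set where
  field
    members     : ∀ k → V (b k)
    independent : ∀ c → combination c b ≋ (λ _ → 0ℝ) → ∀ k → c k ≈ 0ℝ
    spanning    : ∀ v → V v → ∃[ c ] v ≋ combination c b

HasDimension : ∀ {n} → (Vector ℝ n → Set) → ℕ → Set
HasDimension {n} V m = ∃[ b ] IsBasis {m} {n} V b

Eigenspace : ∀ {n} → Matrix n → ℝ → Vector ℝ n → Set
Eigenspace A μ v = A *ᵥ v ≋ μ ∙ᵥ v

IsEigenvalue : ∀ {n} → Matrix n → ℝ → Set
IsEigenvalue A μ = ∃[ v ] (∃[ i ] v i # 0ℝ) × Eigenspace A μ v

-- The matrices considered are symmetric, so algebraic and geometric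
-- multiplicities agree; this is the geometric one.
HasMultiplicity : ∀ {n} → Matrix n → ℝ → ℕ → Set
HasMultiplicity A μ m = HasDimension (Eigenspace A μ) m

record IsOrderedMultiplicityList {n} (A : Matrix n) (ms : List ℕ) : Set where
  field
    eigenvalue   : Fin (length ms) → ℝ
    increasing   : ∀ i j → i Fin.< j → eigenvalue i < eigenvalue j
    spectrum     : ∀ μ → IsEigenvalue A μ ⇔ (∃[ i ] μ ≈ eigenvalue i)
    multiplicity : ∀ i → HasMultiplicity A (eigenvalue i) (lookup ms i)

record Graph (n : ℕ) : Set₁ where
  field
    Adj    : Rel (Fin n) 0ℓ
    adj?   : Decidable Adj
    symm   : Symmetric Adj
    irrefl : Irreflexive _≡_ Adj

open Graph public

complete : ∀ n → Graph n
complete n = record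
  { Adj    = _≢_
  ; adj?   = λ i j → ¬? (i Fin.≟ j)
  ; symm   = λ i≢j → i≢j ∘ sym
  ; irrefl = λ i≡j i≢j → i≢j i≡j
  }

deleteEdge : ∀ {n} → Graph n → Fin n → Fin n → Graph n
deleteEdge {n} G u v = record
  { Adj    = λ i j → Adj G i j × ¬ IsUV i j
  ; adj?   = λ i j → adj? G i j ×-dec
               ¬? (((i Fin.≟ u) ×-dec (j Fin.≟ v)) ⊎-dec ((i Fin.≟ v) ×-dec (j Fin.≟ u)))
  ; symm   = λ (a , ¬uv) → symm G a , ¬uv ∘ swapUV
  ; irrefl = λ i≡j → irrefl G i≡j ∘ proj₁
  }
  where
  IsUV : Rel (Fin n) 0ℓ
  IsUV i j = (i ≡ u × j ≡ v) ⊎ (i ≡ v × j ≡ u)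
  swapUV : ∀ {i j} → IsUV j i → IsUV i j
  swapUV (inj₁ (p , q)) = inj₂ (q , p)
  swapUV (inj₂ (p , q)) = inj₁ (q , p)

offDiagonalRowSum : ∀ {n} → Matrix n → Fin n → ℝ
offDiagonalRowSum A i = sum (λ k → if does (k Fin.≟ i) then 0ℝ else A i k)

record _∈S-L_ {n} (A : Matrix n) (G : Graph n) : Set where
  field
    symmetric : ∀ i j → A i j ≈ A j i
    edge      : ∀ i j → Adj G i j → A i j < 0ℝ
    nonEdge   : ∀ i j → i ≢ j → ¬ Adj G i j → A i j ≈ 0ℝ
    diagonal  : ∀ i → A i i ≈ - offDiagonalRowSum A i

Attains : ∀ {n} → Graph n → List ℕ → Set
Attains G ms = ∃[ A ] A ∈S-L G × IsOrderedMultiplicityList A ms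

{-# OPTIONS --safe #-}

-- Necessity.  If the eigenspaces of A had total dimension below 4, some v ≠ 0 would be
-- orthogonal to all eigenvectors, in particular to ones, so v, A v, A² v, A³ v
-- would be linearly dependent; a real root of the resulting polynomial of degree
-- at most 3 yields an eigenvector in the span of these vectors, orthogonal to itself.
-- Orthogonality of eigenspaces bounds the total dimension by 4 from above.  By
-- the energy form Σ -aᵢⱼ (yᵢ - yⱼ)² the least eigenvalue is 0 and is simple, and a
-- three-dimensional eigenspace would contain some y ≠ 0 orthogonal to ones and
-- supported on v and one common neighbour x of u and v; as u v is the deleted edge,
-- row u of A y = μ y would make the entry of A at u, x vanish.
--
-- All these conclusions are negative, so classical case distinctions are
-- available; only the root of a cubic has to be constructed.  Bisection chooses
-- among four equidistant points, at one of which the cubic has a known sign since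
-- its third difference is a nonzero constant.
--
-- Sufficiency.  The three lists are attained by rational matrices with rational
-- orthogonal eigenbases, checked by computation for each deleted edge.

module Submission where

open import Defs
open import Algebra.Bundles using (CommutativeRing)
import Algebra.Properties.Semiring.Sum as SemiringSum
open import Data.Bool.Base using (if_then_else_)
import Data.Bool.Properties as Bool
open import Data.Fin.Base as Fin using (Fin; zero; suc; punchIn; _↑ˡ_; _↑ʳ_; splitAt)
open import Data.Fin.Permutation.Components using (transpose)
import Data.Fin.Properties as Fin
open import Data.Integer.Base as ℤ using (-[1+_]) renaming (+_ to int)
import Data.Integer.Properties as ℤ
open import Data.List.Base using (List; []; _∷_; length; lookup)
open import Data.List.Membership.Propositional using (_∈_)
open import Data.List.Relation.Unary.Any using (here; there)
open import Data.Nat.Base as ℕ using (ℕ; zero; suc; z≤n; s≤s)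
open import Data.Nat.ListAction using () renaming (sum to total)
import Data.Nat.Properties as ℕ
open import Data.Product.Base using (_×_; _,_; ∃-syntax; proj₁; proj₂)
open import Data.Rational.Base as ℚ using (ℚ; mkℚ; 0ℚ; 1ℚ; ½; ∣_∣)
open import Data.Rational.Literals using (fromℤ)
import Data.Rational.Properties as ℚ
open import Data.Rational.Solver using (module +-*-Solver)
import Data.Rational.Unnormalised.Base as ℚᵘ
import Data.Rational.Unnormalised.Properties as ℚᵘ
open import Data.Sum.Base using (_⊎_; inj₁; inj₂; [_,_]′)
open import Data.Vec.Base as Vec using ([]; _∷_)
open import Data.Vec.Functional as Vector using (Vector; insertAt; removeAt; _++_)
open import Data.Vec.Functional.Properties using (insertAt-lookup; insertAt-punchIn; lookup-++ˡ; lookup-++ʳ)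
open import Function.Base using (_∘_; _$_; id)
open import Function.Bundles using (_⇔_; mk⇔; Equivalence)
open import Level using (0ℓ)
open import Relation.Binary.Definitions using (Tri; tri<; tri≈; tri>)
open import Relation.Binary.PropositionalEquality
  using (_≡_; _≢_; refl; sym; trans; cong; cong₂; subst; subst₂)
open import Relation.Binary.Structures using (IsEquivalence)
open import Relation.Nullary using (¬_; Dec; yes; no; does)
open import Relation.Nullary.Decidable
  using (toWitness; dec-true; dec-false; ¬?; _→-dec_; _×-dec_; _⊎-dec_)
open import Relation.Nullary.Negation using (contradiction)

open +-*-Solver using (solve; _:=_; _:+_; _:*_; _:-_; :-_; con)

-- Orthogonality to `ones` keeps the degree down: a vector with coordinate sum 0 is determined by
-- three coordinates, so four powers of A applied to v are already dependent, and no quartic, which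
-- may lack real roots, has to be solved. Quadratics without real roots are excluded by
-- self-adjointness, and square roots come from the same bisection as roots of cubics.
--
-- The sign of a Cauchy real is undecidable. What remains is that a positive sum of two reals has a
-- positive summand, and that x ≈ 0 follows once 0 < x and 0 < - x are refuted. The second principle
-- makes equality stable under double negation; the bounds on multiplicities concern natural
-- numbers, so both may be proved by contradiction. For the three examples, however, an eigenvalue
-- has to be matched with a definite entry of the list; there the first principle finds the index.

module RealField where

  -- Rational inequalities and the commutative ring of reals

  private variable
    p q ε : ℚ
    x y z : ℝ

  -- Strict inequalities are proved by certificate: a positive difference and a ring identity that
  -- the solver checks.
  ℚ-<-by : ∀ d → 0ℚ ℚ.< d → p ℚ.+ d ≡ q → p ℚ.< q
  ℚ-<-by {p} d d>0 refl = subst (ℚ._< p ℚ.+ d) (ℚ.+-identityʳ p) (ℚ.+-monoʳ-< p d>0)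

  ℚ-gap>0 : p ℚ.< q → 0ℚ ℚ.< q ℚ.- p
  ℚ-gap>0 {p} {q} p<q = subst (ℚ._< q ℚ.- p) (ℚ.+-inverseʳ p) (ℚ.+-monoˡ-< (ℚ.- p) p<q)

  ℚ-pos-+ : 0ℚ ℚ.< p → 0ℚ ℚ.< q → 0ℚ ℚ.< p ℚ.+ q
  ℚ-pos-+ = ℚ.+-mono-<

  ℚ-pos-* : 0ℚ ℚ.< p → 0ℚ ℚ.< q → 0ℚ ℚ.< p ℚ.* q
  ℚ-pos-* {p} {q} p>0 q>0 =
    ℚ.positive⁻¹ (p ℚ.* q) {{ℚ.pos*pos⇒pos p {{ℚ.positive p>0}} q {{ℚ.positive q>0}}}}

  ∣p∣<ε⇒p<ε : ∀ p → ∣ p ∣ ℚ.< ε → p ℚ.< ε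
  ∣p∣<ε⇒p<ε p ∣p∣<ε with ℚ.≤-total 0ℚ p
  ... | inj₁ 0≤p = subst (ℚ._< _) (ℚ.0≤p⇒∣p∣≡p 0≤p) ∣p∣<ε
  ... | inj₂ p≤0 = ℚ.≤-<-trans (ℚ.≤-trans p≤0 (ℚ.0≤∣p∣ p)) ∣p∣<ε

  ∣p∣<ε⇒-p<ε : ∀ p → ∣ p ∣ ℚ.< ε → ℚ.- p ℚ.< ε
  ∣p∣<ε⇒-p<ε p ∣p∣<ε = ∣p∣<ε⇒p<ε (ℚ.- p) (subst (ℚ._< _) (sym (ℚ.∣-p∣≡∣p∣ p)) ∣p∣<ε)

  ∣∣<-intro : ∀ p → p ℚ.< ε → ℚ.- p ℚ.< ε → ∣ p ∣ ℚ.< ε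
  ∣∣<-intro p p<ε -p<ε with ℚ.∣p∣≡p∨∣p∣≡-p p
  ... | inj₁ eq = subst (ℚ._< _) (sym eq) p<ε
  ... | inj₂ eq = subst (ℚ._< _) (sym eq) -p<ε

  -- The operations act termwise, so the rational ring solver proves ring identities between reals.
  pointwise : (∀ n → seq x n ≡ seq y n) → x ≈ y
  close (pointwise {x} {y} eq) ε ε>0 = 0 , λ n _ →
    subst (λ p → ∣ p ∣ ℚ.< ε) (sym (trans (cong (ℚ._- seq y n) (eq n)) (ℚ.+-inverseʳ (seq y n)))) ε>0

  ≈-refl : x ≈ x
  ≈-refl = pointwise λ _ → refl

  ≈-sym : x ≈ y → y ≈ x
  close (≈-sym {x} {y} x≈y) ε ε>0 with close x≈y ε ε>0
  ... | N , near = N , λ n N≤n → subst (ℚ._< ε)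
    (trans (sym (ℚ.∣-p∣≡∣p∣ (seq x n ℚ.- seq y n))) (cong ∣_∣ (swap (seq x n) (seq y n)))) (near n N≤n)
    where
    swap : ∀ a b → ℚ.- (a ℚ.- b) ≡ b ℚ.- a
    swap = solve 2 (λ a b → :- (a :- b) := b :- a) refl

  eventually₂ : ∀ {P Q : ℕ → Set} → (∃[ N ] ∀ n → N ℕ.≤ n → P n) → (∃[ N ] ∀ n → N ℕ.≤ n → Q n) →
                ∃[ N ] ∀ n → N ℕ.≤ n → P n × Q n
  eventually₂ (M , p) (N , q) = M ℕ.⊔ N , λ n ≤n →
    p n (ℕ.m⊔n≤o⇒m≤o M N ≤n) , q n (ℕ.m⊔n≤o⇒n≤o M N ≤n)

  eventually-map : ∀ {P Q : ℕ → Set} → (∀ n → P n → Q n) →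
                   (∃[ N ] ∀ n → N ℕ.≤ n → P n) → ∃[ N ] ∀ n → N ℕ.≤ n → Q n
  eventually-map f (N , p) = N , λ n ≤n → f n (p n ≤n)

  ≈-trans : x ≈ y → y ≈ z → x ≈ z
  close (≈-trans {x} {y} {z} x≈y y≈z) ε ε>0 =
    eventually-map (λ n (p , q) → subst (λ d → ∣ d ∣ ℚ.< ε) (telescope (seq x n) (seq y n) (seq z n))
                                    (∣-∣<+ (seq x n ℚ.- seq y n) (seq y n ℚ.- seq z n) p q))
      (eventually₂ (close x≈y (½ ℚ.* ε) (half>0 ε>0)) (close y≈z (½ ℚ.* ε) (half>0 ε>0)))
    where
    telescope : ∀ a b c → (a ℚ.- b) ℚ.+ (b ℚ.- c) ≡ a ℚ.- c
    telescope = solve 3 (λ a b c → (a :- b) :+ (b :- c) := a :- c) refl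

  ≈-isEquivalence : IsEquivalence _≈_
  ≈-isEquivalence = record { refl = ≈-refl ; sym = ≈-sym ; trans = ≈-trans }

  +-cong : ∀ {x y u v} → x ≈ y → u ≈ v → x + u ≈ y + v
  close (+-cong {x} {y} {u} {v} x≈y u≈v) ε ε>0 =
    eventually-map (λ n (p , q) → subst (λ d → ∣ d ∣ ℚ.< ε)
                                    (+-differences (seq x n) (seq u n) (seq y n) (seq v n))
                                    (∣-∣<+ (seq x n ℚ.- seq y n) (seq u n ℚ.- seq v n) p q))
      (eventually₂ (close x≈y (½ ℚ.* ε) (half>0 ε>0)) (close u≈v (½ ℚ.* ε) (half>0 ε>0)))

  -‿cong : x ≈ y → - x ≈ - y
  close (-‿cong {x} {y} x≈y) ε ε>0 = eventually-map
    (λ n p → subst (ℚ._< ε) (cong ∣_∣ (-‿differences (seq x n) (seq y n)))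
               (subst (ℚ._< ε) (sym (ℚ.∣-p∣≡∣p∣ (seq x n ℚ.- seq y n))) p))
    (close x≈y ε ε>0)

  *-cong : ∀ {x y u v} → x ≈ y → u ≈ v → x * u ≈ y * v
  close (*-cong {x} {y} {u} {v} x≈y u≈v) ε ε>0 =
    let (B , B>0 , x<B)    = eventuallyBounded x
        (C , C>0 , v<C)    = eventuallyBounded v
        (δ , δ>0 , small₁) = tolerance B>0 (half>0 ε>0)
        (η , η>0 , small₂) = tolerance C>0 (half>0 ε>0)
    in eventually-map
         (λ n ((x< , v<) , (p , q)) → subst (λ d → ∣ d ∣ ℚ.< ε)
            (*-differences (seq x n) (seq u n) (seq y n) (seq v n))
            (∣-∣<+ (seq x n ℚ.* (seq u n ℚ.- seq v n)) (seq v n ℚ.* (seq x n ℚ.- seq y n))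
              (small₁ (seq x n) (seq u n ℚ.- seq v n) x< q)
              (small₂ (seq v n) (seq x n ℚ.- seq y n) v< p)))
         (eventually₂ (eventually₂ x<B v<C) (eventually₂ (close x≈y η η>0) (close u≈v δ δ>0)))

  ℝ-commutativeRing : CommutativeRing 0ℓ 0ℓ
  ℝ-commutativeRing = record
    { Carrier = ℝ ; _≈_ = _≈_ ; _+_ = _+_ ; _*_ = _*_ ; -_ = -_ ; 0# = 0ℝ ; 1# = 1ℝ
    ; isCommutativeRing = record
      { isRing = record
        { +-isAbelianGroup = record
          { isGroup = record
            { isMonoid = record
              { isSemigroup = record
                { isMagma = record { isEquivalence = ≈-isEquivalence ; ∙-cong = +-cong }
                ; assoc = λ x y z → pointwise λ n → ℚ.+-assoc (seq x n) (seq y n) (seq z n) }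
              ; identity = (λ x → pointwise λ n → ℚ.+-identityˡ (seq x n))
                         , (λ x → pointwise λ n → ℚ.+-identityʳ (seq x n)) }
            ; inverse = (λ x → pointwise λ n → ℚ.+-inverseˡ (seq x n))
                      , (λ x → pointwise λ n → ℚ.+-inverseʳ (seq x n))
            ; ⁻¹-cong = -‿cong }
          ; comm = λ x y → pointwise λ n → ℚ.+-comm (seq x n) (seq y n) }
        ; *-cong = *-cong
        ; *-assoc = λ x y z → pointwise λ n → ℚ.*-assoc (seq x n) (seq y n) (seq z n)
        ; *-identity = (λ x → pointwise λ n → ℚ.*-identityˡ (seq x n))
                     , (λ x → pointwise λ n → ℚ.*-identityʳ (seq x n))
        ; distrib = (λ x y z → pointwise λ n → ℚ.*-distribˡ-+ (seq x n) (seq y n) (seq z n))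
                  , (λ x y z → pointwise λ n → ℚ.*-distribʳ-+ (seq x n) (seq y n) (seq z n)) }
      ; *-comm = λ x y → pointwise λ n → ℚ.*-comm (seq x n) (seq y n) } }

  open CommutativeRing ℝ-commutativeRing public
    using (_-_; +-identityˡ; +-identityʳ; *-identityˡ; *-identityʳ; +-comm; *-comm; +-assoc; *-assoc;
           zeroˡ; zeroʳ; -‿inverseˡ; -‿inverseʳ; setoid; semiring)

  -- Signs

  pos-intro : ∀ g → 0ℚ ℚ.< g → (∃[ N ] ∀ n → N ℕ.≤ n → g ℚ.< seq x n) → 0ℝ < x
  pos-intro {x} g g>0 (N , g<x) = mk< g g>0 N λ n N≤n → subst (ℚ._< seq x n) (sym (ℚ.+-identityˡ g)) (g<x n N≤n)

  pos-elim : (x>0 : 0ℝ < x) → ∃[ N ] ∀ n → N ℕ.≤ n → gap x>0 ℚ.< seq x n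
  pos-elim {x} (mk< g _ N sep) = N , λ n N≤n → subst (ℚ._< seq x n) (ℚ.+-identityˡ g) (sep n N≤n)

  pos-cong : x ≈ y → 0ℝ < x → 0ℝ < y
  pos-cong {x} {y} x≈y x>0@(mk< g g>0 _ _) = pos-intro (½ ℚ.* g) (half>0 g>0) $
    eventually-map (λ n (g<x , near) → ℚ-<-by _
        (ℚ-pos-+ (ℚ-gap>0 g<x) (ℚ-gap>0 (∣p∣<ε⇒p<ε (seq x n ℚ.- seq y n) near)))
        (rearrange g (seq x n) (seq y n)))
      (eventually₂ (pos-elim x>0) (close x≈y (½ ℚ.* g) (half>0 g>0)))
    where
    rearrange : ∀ g a b → ½ ℚ.* g ℚ.+ ((a ℚ.- g) ℚ.+ (½ ℚ.* g ℚ.- (a ℚ.- b))) ≡ b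
    rearrange = solve 3 (λ g a b → con ½ :* g :+ ((a :- g) :+ (con ½ :* g :- (a :- b))) := b) refl

  pos-+ : 0ℝ < x → 0ℝ < y → 0ℝ < x + y
  pos-+ x>0 y>0 = pos-intro _ (ℚ-pos-+ (gap>0 x>0) (gap>0 y>0)) $
    eventually-map (λ _ (p , q) → ℚ.+-mono-< p q) (eventually₂ (pos-elim x>0) (pos-elim y>0))

  pos-* : 0ℝ < x → 0ℝ < y → 0ℝ < x * y
  pos-* {x} {y} x>0 y>0 = pos-intro _ (ℚ-pos-* (gap>0 x>0) (gap>0 y>0)) $
    eventually-map (λ n (p , q) → ℚ.<-trans
        (ℚ.*-monoˡ-<-pos (gap y>0) {{ℚ.positive (gap>0 y>0)}} p)
        (ℚ.*-monoʳ-<-pos (seq x n) {{ℚ.positive (ℚ.<-trans (gap>0 x>0) p)}} q))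
      (eventually₂ (pos-elim x>0) (pos-elim y>0))

  pos-asym : 0ℝ < x → ¬ (0ℝ < - x)
  pos-asym {x} x>0 -x>0 =
    let (N , both) = eventually₂ (pos-elim x>0) (pos-elim -x>0)
        (p , q) = both N ℕ.≤-refl
    in ℚ.<-irrefl refl (subst (0ℚ ℚ.<_) (ℚ.+-inverseʳ (seq x N))
         (ℚ-pos-+ (ℚ.<-trans (gap>0 x>0) p) (ℚ.<-trans (gap>0 -x>0) q)))

  <⇒pos : x < y → 0ℝ < y - x
  <⇒pos {x} {y} (mk< g g>0 N sep) = pos-intro (½ ℚ.* g) (half>0 g>0) $ N , λ n N≤n → ℚ-<-by _
      (ℚ-pos-+ (ℚ-gap>0 (sep n N≤n)) (half>0 g>0)) (rearrange g (seq x n) (seq y n))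
    where
    rearrange : ∀ g a b → ½ ℚ.* g ℚ.+ ((b ℚ.- (a ℚ.+ g)) ℚ.+ ½ ℚ.* g) ≡ b ℚ.- a
    rearrange = solve 3 (λ g a b → con ½ :* g :+ ((b :- (a :+ g)) :+ con ½ :* g) := b :- a) refl

  pos⇒< : 0ℝ < y - x → x < y
  pos⇒< {y} {x} d>0 = let (N , g<d) = pos-elim d>0 in
    mk< (gap d>0) (gap>0 d>0) N λ n N≤n →
      ℚ-<-by _ (ℚ-gap>0 (g<d n N≤n)) (rearrange (gap d>0) (seq x n) (seq y n))
    where
    rearrange : ∀ g a b → (a ℚ.+ g) ℚ.+ ((b ℚ.- a) ℚ.- g) ≡ b
    rearrange = solve 3 (λ g a b → (a :+ g) :+ ((b :- a) :- g) := b) refl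

  -- The comparison is made on a rational, the term of x at an index after which x varies by less
  -- than g / 4. If that term exceeds g / 2, then x stays above g / 4; otherwise x stays below 3 g /
  -- 4, which leaves more than g / 4 for y.
  pos-⊎ : 0ℝ < x + y → (0ℝ < x) ⊎ (0ℝ < y)
  pos-⊎ {x} {y} s>0@(mk< g g>0 _ _) = let (N , near) = cauchy x k k>0 in split N near (h ℚ.<? seq x N)
    where
    h k : ℚ
    h = ½ ℚ.* g
    k = ½ ℚ.* h
    k>0 : 0ℚ ℚ.< k
    k>0 = half>0 (half>0 g>0)
    split : ∀ N → (∀ m n → N ℕ.≤ m → N ℕ.≤ n → ∣ seq x m ℚ.- seq x n ∣ ℚ.< k) →
            Dec (h ℚ.< seq x N) → (0ℝ < x) ⊎ (0ℝ < y)
    split N near (yes h<x) = inj₁ $ pos-intro _ k>0 $ N , λ n N≤n →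
      ℚ-<-by _ (ℚ-pos-+ (ℚ-gap>0 h<x)
                 (ℚ-gap>0 (∣p∣<ε⇒p<ε (seq x N ℚ.- seq x n) (near N n ℕ.≤-refl N≤n))))
               (rearrange g (seq x N) (seq x n))
      where
      rearrange : ∀ g a b → ½ ℚ.* (½ ℚ.* g) ℚ.+ ((a ℚ.- ½ ℚ.* g) ℚ.+ (½ ℚ.* (½ ℚ.* g) ℚ.- (a ℚ.- b))) ≡ b
      rearrange = solve 3 (λ g a b → let h = con ½ :* g ; k = con ½ :* h in
        k :+ ((a :- h) :+ (k :- (a :- b))) := b) refl
    split N near (no h≮x) = inj₂ $ pos-intro (½ ℚ.* k) (half>0 k>0) $
      eventually-map (λ n (s , near-n) → ℚ-<-by _
        (ℚ-pos-+ (ℚ-pos-+ (ℚ-gap>0 s) (ℚ-gap>0 (∣p∣<ε⇒p<ε (seq x n ℚ.- seq x N) near-n)))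
                 (ℚ-gap>0 (ℚ.≤-<-trans (ℚ.≮⇒≥ h≮x) (ℚ-<-by _ (half>0 k>0) refl))))
        (rearrange g (seq x n) (seq y n) (seq x N)))
      (eventually₂ (pos-elim s>0) (N , λ n N≤n → near n N N≤n ℕ.≤-refl))
      where
      rearrange : ∀ g a b c → let h = ½ ℚ.* g ; k = ½ ℚ.* h ; l = ½ ℚ.* k in
        l ℚ.+ ((((a ℚ.+ b) ℚ.- g) ℚ.+ (k ℚ.- (a ℚ.- c))) ℚ.+ ((h ℚ.+ l) ℚ.- c)) ≡ b
      rearrange = solve 4 (λ g a b c → let h = con ½ :* g ; k = con ½ :* h ; l = con ½ :* k in
        l :+ ((((a :+ b) :- g) :+ (k :- (a :- c))) :+ ((h :+ l) :- c)) := b) refl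

  -- If a term beyond the modulus for ε / 2 had absolute value at least ε, all later terms would
  -- stay more than ε / 4 away from 0 on the same side, against one of the hypotheses.
  tight : ¬ (0ℝ < x) → ¬ (0ℝ < - x) → x ≈ 0ℝ
  close (tight {x} x≯0 x≮0) ε ε>0 with cauchy x (½ ℚ.* ε) (half>0 ε>0)
  ... | N , near = N , λ n N≤n → subst (λ d → ∣ d ∣ ℚ.< ε) (sym (ℚ.+-identityʳ (seq x n)))
                     (∣∣<-intro (seq x n) (below n N≤n (seq x n ℚ.<? ε)) (above n N≤n (ℚ.- seq x n ℚ.<? ε)))
    where
    half-< : ∀ {a b} → ε ℚ.≤ a → a ℚ.- b ℚ.< ½ ℚ.* ε → ½ ℚ.* (½ ℚ.* ε) ℚ.< b
    half-< {a} {b} ε≤a a-b< = ℚ-<-by _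
      (ℚ-pos-+ (ℚ-gap>0 (ℚ.<-≤-trans (ℚ-<-by (½ ℚ.* (½ ℚ.* ε)) (half>0 (half>0 ε>0)) (three-quarters ε)) ε≤a))
               (ℚ-gap>0 a-b<))
      (rearrange ε a b)
      where
      three-quarters : ∀ ε → (ε ℚ.- ½ ℚ.* (½ ℚ.* ε)) ℚ.+ ½ ℚ.* (½ ℚ.* ε) ≡ ε
      three-quarters = solve 1 (λ ε → (ε :- con ½ :* (con ½ :* ε)) :+ con ½ :* (con ½ :* ε) := ε) refl
      rearrange : ∀ ε a b → ½ ℚ.* (½ ℚ.* ε) ℚ.+ ((a ℚ.- (ε ℚ.- ½ ℚ.* (½ ℚ.* ε))) ℚ.+ (½ ℚ.* ε ℚ.- (a ℚ.- b))) ≡ b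
      rearrange = solve 3 (λ ε a b → con ½ :* (con ½ :* ε) :+ ((a :- (ε :- con ½ :* (con ½ :* ε))) :+ (con ½ :* ε :- (a :- b))) := b) refl
    below : ∀ n → N ℕ.≤ n → Dec (seq x n ℚ.< ε) → seq x n ℚ.< ε
    below n N≤n (yes x<ε) = x<ε
    below n N≤n (no x≮ε)  = contradiction (pos-intro _ (half>0 (half>0 ε>0)) $ N , λ m N≤m →
      half-< (ℚ.≮⇒≥ x≮ε) (∣p∣<ε⇒p<ε (seq x n ℚ.- seq x m) (near n m N≤n N≤m))) x≯0
    above : ∀ n → N ℕ.≤ n → Dec (ℚ.- seq x n ℚ.< ε) → ℚ.- seq x n ℚ.< ε
    above n N≤n (yes x<ε) = x<ε
    above n N≤n (no x≮ε)  = contradiction (pos-intro _ (half>0 (half>0 ε>0)) $ N , λ m N≤m →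
      half-< (ℚ.≮⇒≥ x≮ε) (subst (ℚ._< ½ ℚ.* ε) (-‿differences (seq x n) (seq x m))
         (∣p∣<ε⇒-p<ε (seq x n ℚ.- seq x m) (near n m N≤n N≤m)))) x≮0

  -- A negative form of x ≥ 0, so that it can be proved by classical case distinction.
  NonNeg : ℝ → Set
  NonNeg x = ¬ (0ℝ < - x)

  -‿distrib-+ : ∀ x y → - (x + y) ≈ - x + - y
  -‿distrib-+ x y = pointwise λ n → solve 2 (λ x y → :- (x :+ y) := :- x :+ :- y) refl (seq x n) (seq y n)
  -0≈0 : - 0ℝ ≈ 0ℝ
  -0≈0 = pointwise λ _ → refl

  0≮0 : ¬ (0ℝ < 0ℝ)
  0≮0 p = pos-asym p (pos-cong (≈-sym -0≈0) p)

  0<1 : 0ℝ < 1ℝ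
  0<1 = mk< ½ (ℚ.positive⁻¹ ½) 0 λ _ _ → ℚ-<-by ½ (ℚ.positive⁻¹ ½) refl

  nonNeg-cong : x ≈ y → NonNeg x → NonNeg y
  nonNeg-cong x≈y x≥0 = x≥0 ∘ pos-cong (-‿cong (≈-sym x≈y))

  zero⇒nonNeg : x ≈ 0ℝ → NonNeg x
  zero⇒nonNeg x≈0 p = 0≮0 (pos-cong (≈-trans (-‿cong x≈0) -0≈0) p)

  zero⇒≯0 : x ≈ 0ℝ → ¬ (0ℝ < x)
  zero⇒≯0 x≈0 p = 0≮0 (pos-cong x≈0 p)

  -- Trichotomy for negated goals: refuting the two outer cases supplies, by `tight`, the middle
  -- one.
  sign-cases : ∀ {P : Set} → (0ℝ < x → ¬ P) → (x ≈ 0ℝ → ¬ P) → (0ℝ < - x → ¬ P) → ¬ P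
  sign-cases pos null neg p = null (tight (λ x>0 → pos x>0 p) (λ x<0 → neg x<0 p)) p

  nonNeg-+ : NonNeg x → NonNeg y → NonNeg (x + y)
  nonNeg-+ {x} {y} x≥0 y≥0 = [ x≥0 , y≥0 ]′ ∘ pos-⊎ ∘ pos-cong (-‿distrib-+ x y)

  [x+y]-y≈x : ∀ x y → (x + y) + - y ≈ x
  [x+y]-y≈x x y = pointwise λ n → solve 2 (λ x y → (x :+ y) :+ :- y := x) refl (seq x n) (seq y n)

  -- Positivity carries a witness and cannot be obtained by contradiction; it comes from splitting x
  -- = (x + y) - y with `pos-⊎`.
  pos-+-nonNeg : 0ℝ < x → NonNeg y → 0ℝ < x + y
  pos-+-nonNeg {x} {y} x>0 y≥0 =
    [ id , (λ y<0 → contradiction y<0 y≥0) ]′ (pos-⊎ (pos-cong (≈-sym ([x+y]-y≈x x y)) x>0))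

  nonNeg-* : NonNeg x → NonNeg y → NonNeg (x * y)
  nonNeg-* {x} {y} x≥0 y≥0 = sign-cases {x}
    (λ x>0 → sign-cases {y}
      (λ y>0 → pos-asym (pos-* x>0 y>0))
      (λ y≈0 → zero⇒nonNeg (≈-trans (*-cong ≈-refl y≈0) (zeroʳ x)))
      (λ y<0 _ → y≥0 y<0))
    (λ x≈0 → zero⇒nonNeg (≈-trans (*-cong x≈0 ≈-refl) (zeroˡ y)))
    (λ x<0 _ → x≥0 x<0)

  neg*neg : ∀ x y → - x * - y ≈ x * y
  neg*neg x y = pointwise λ n → solve 2 (λ x y → :- x :* :- y := x :* y) refl (seq x n) (seq y n)
  nonNeg-square : ∀ x → NonNeg (x * x)
  nonNeg-square x = sign-cases {x}
    (λ x>0 → pos-asym (pos-* x>0 x>0))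
    (λ x≈0 → zero⇒nonNeg (≈-trans (*-cong x≈0 ≈-refl) (zeroˡ x)))
    (λ x<0 → pos-asym (pos-cong (neg*neg x x) (pos-* x<0 x<0)))

  nonNeg-+≈0 : NonNeg x → NonNeg y → x + y ≈ 0ℝ → x ≈ 0ℝ
  nonNeg-+≈0 x≥0 y≥0 s≈0 = tight (λ x>0 → zero⇒≯0 s≈0 (pos-+-nonNeg x>0 y≥0)) x≥0

  #⇒± : x # 0ℝ → (0ℝ < x) ⊎ (0ℝ < - x)
  #⇒± {x} (inj₁ x<0) = inj₂ (pos-cong (+-identityˡ (- x)) (<⇒pos x<0))
  #⇒± {x} (inj₂ x>0) = inj₁ x>0

  ±⇒# : (0ℝ < x) ⊎ (0ℝ < - x) → x # 0ℝ
  ±⇒# {x} (inj₁ x>0) = inj₂ x>0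
  ±⇒# {x} (inj₂ x<0) = inj₁ (pos⇒< (pos-cong (≈-sym (+-identityˡ (- x))) x<0))

  #-cong : x ≈ y → x # 0ℝ → y # 0ℝ
  #-cong x≈y x#0 = ±⇒# ([ inj₁ ∘ pos-cong x≈y , inj₂ ∘ pos-cong (-‿cong x≈y) ]′ (#⇒± x#0))

  #⇒≉ : x # 0ℝ → ¬ (x ≈ 0ℝ)
  #⇒≉ x#0 x≈0 = [ zero⇒≯0 x≈0 , zero⇒nonNeg x≈0 ]′ (#⇒± x#0)

  ¬#⇒≈ : ¬ (x # 0ℝ) → x ≈ 0ℝ
  ¬#⇒≈ x≁0 = tight (x≁0 ∘ ±⇒# ∘ inj₁) (x≁0 ∘ ±⇒# ∘ inj₂)

  neg-*ˡ : ∀ x y → - x * y ≈ - (x * y)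
  neg-*ˡ x y = pointwise λ n → solve 2 (λ x y → :- x :* y := :- (x :* y)) refl (seq x n) (seq y n)
  neg-*ʳ : ∀ x y → x * - y ≈ - (x * y)
  neg-*ʳ x y = pointwise λ n → solve 2 (λ x y → x :* :- y := :- (x :* y)) refl (seq x n) (seq y n)
  #-* : x # 0ℝ → y # 0ℝ → (x * y) # 0ℝ
  #-* {x} {y} x#0 y#0 = ±⇒# (case (#⇒± x#0) (#⇒± y#0))
    where
    case : (0ℝ < x) ⊎ (0ℝ < - x) → (0ℝ < y) ⊎ (0ℝ < - y) → (0ℝ < x * y) ⊎ (0ℝ < - (x * y))
    case (inj₁ p) (inj₁ q) = inj₁ (pos-* p q)
    case (inj₁ p) (inj₂ q) = inj₂ (pos-cong (neg-*ʳ x y) (pos-* p q))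
    case (inj₂ p) (inj₁ q) = inj₂ (pos-cong (neg-*ˡ x y) (pos-* p q))
    case (inj₂ p) (inj₂ q) = inj₁ (pos-cong (neg*neg x y) (pos-* p q))

  *≈0⇒≈0 : y # 0ℝ → x * y ≈ 0ℝ → x ≈ 0ℝ
  *≈0⇒≈0 y#0 xy≈0 = ¬#⇒≈ λ x#0 → #⇒≉ (#-* x#0 y#0) xy≈0

  square≈0⇒≈0 : x * x ≈ 0ℝ → x ≈ 0ℝ
  square≈0⇒≈0 xx≈0 = ¬#⇒≈ λ x#0 → #⇒≉ (#-* x#0 x#0) xx≈0

  #-+ : (x + y) # 0ℝ → (x # 0ℝ) ⊎ (y # 0ℝ)
  #-+ {x} {y} s#0 = [
    [ inj₁ ∘ ±⇒# ∘ inj₁ , inj₂ ∘ ±⇒# ∘ inj₁ ]′ ∘ pos-⊎ ,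
    [ inj₁ ∘ ±⇒# ∘ inj₂ , inj₂ ∘ ±⇒# ∘ inj₂ ]′ ∘ pos-⊎ ∘ pos-cong (-‿distrib-+ x y) ]′ (#⇒± s#0)

  fromℚ-pos : 0ℚ ℚ.< q → 0ℝ < fromℚ q
  fromℚ-pos {q} q>0 = pos-intro (½ ℚ.* q) (half>0 q>0) $
    0 , λ _ _ → ℚ-<-by (½ ℚ.* q) (half>0 q>0) (half+half q)

  fromℚ-# : q ≢ 0ℚ → fromℚ q # 0ℝ
  fromℚ-# {q} q≢0 with ℚ.<-cmp q 0ℚ
  ... | tri< q<0 _ _ = ±⇒# (inj₂ (pos-cong (pointwise λ _ → refl) (fromℚ-pos {ℚ.- q} (ℚ.neg-antimono-< q<0))))
  ... | tri≈ _ q≡0 _ = contradiction q≡0 q≢0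
  ... | tri> _ _ q>0 = ±⇒# (inj₁ (fromℚ-pos q>0))

  fromℚ-#-cancelˡ : ∀ q → (fromℚ q * y) # 0ℝ → y # 0ℝ
  fromℚ-#-cancelˡ {y} q qy#0 with q ℚ.≟ 0ℚ
  ... | yes refl = contradiction (zeroˡ y) (#⇒≉ qy#0)
  ... | no q≢0   = #-cong {fromℚ (ℚ.1/ q) * (fromℚ q * y)} (pointwise λ n → trans (sym (ℚ.*-assoc (ℚ.1/ q) q (seq y n)))
                     (trans (cong (ℚ._* seq y n) (ℚ.*-inverseˡ q)) (ℚ.*-identityˡ (seq y n))))
                     (#-* (fromℚ-# 1/q≢0) qy#0)
    where
    instance
      q-nonZero : ℚ.NonZero q
      q-nonZero = ℚ.≢-nonZero q≢0
    1/q≢0 : ℚ.1/ q ≢ 0ℚ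
    1/q≢0 eq with trans (sym (ℚ.*-inverseˡ q)) (trans (cong (ℚ._* q) eq) (ℚ.*-zeroˡ q))
    ... | ()

  -- Bounds and inverses

  upperBound : ∀ x → ∃[ B ] (0ℚ ℚ.< B) × (0ℝ < fromℚ B - x)
  upperBound x = let (B , B>0 , x<B) = eventuallyBounded x in
    B ℚ.+ 1ℚ , ℚ-pos-+ B>0 (ℚ.positive⁻¹ 1ℚ) , pos-intro 1ℚ (ℚ.positive⁻¹ 1ℚ)
      (eventually-map (λ n ∣x∣<B → ℚ-<-by _ (ℚ-gap>0 (∣p∣<ε⇒p<ε (seq x n) ∣x∣<B)) (rearrange B (seq x n))) x<B)
    where
    rearrange : ∀ b a → 1ℚ ℚ.+ (b ℚ.- a) ≡ (b ℚ.+ 1ℚ) ℚ.- a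
    rearrange = solve 2 (λ b a → con 1ℚ :+ (b :- a) := (b :+ con 1ℚ) :- a) refl

  -- The terms of x are truncated from below at the gap of 0 < x, so that every
  -- one of them is invertible.
  pos-inverse : 0ℝ < x → ∃[ y ] x * y ≈ 1ℝ
  pos-inverse {x} x>0@(mk< g g>0 _ _) = mkℝ u u-cauchy , record
    { close = λ ε ε>0 → eventually-map
        (λ n (xu≡1 , _) → subst (λ d → ∣ d ∣ ℚ.< ε)
          (sym (trans (cong (ℚ._- 1ℚ) xu≡1) (ℚ.+-inverseʳ 1ℚ))) ε>0)
        regular }
    where
    t : ℕ → ℚ
    t n = seq x n ℚ.⊔ g
    t>0 : ∀ n → 0ℚ ℚ.< t n
    t>0 n = ℚ.<-≤-trans g>0 (ℚ.p≤q⊔p (seq x n) g)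
    instance
      t-nonZero : ∀ {n} → ℚ.NonZero (t n)
      t-nonZero {n} = ℚ.pos⇒nonZero (t n) {{ℚ.positive (t>0 n)}}
      g-nonZero : ℚ.NonZero g
      g-nonZero = ℚ.pos⇒nonZero g {{ℚ.positive g>0}}
    u : ℕ → ℚ
    u n = ℚ.1/ t n
    u>0 : ∀ n → 0ℚ ℚ.< u n
    u>0 n = ℚ.positive⁻¹ (u n) {{ℚ.1/pos⇒pos (t n) {{ℚ.positive (t>0 n)}}}}
    regular : ∃[ N ] ∀ n → N ℕ.≤ n → (seq x n ℚ.* u n ≡ 1ℚ) × (∣ u n ∣ ℚ.< ℚ.1/ g)
    regular = eventually-map (λ n g<x →
        let xu≡1 = trans (cong (ℚ._* u n) (sym (ℚ.p≥q⇒p⊔q≡p (ℚ.<⇒≤ g<x)))) (ℚ.*-inverseʳ (t n)) in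
        xu≡1 , subst (ℚ._< ℚ.1/ g) (sym (ℚ.0≤p⇒∣p∣≡p (ℚ.<⇒≤ (u>0 n))))
          (ℚ.*-cancelˡ-<-nonNeg g {{ℚ.pos⇒nonNeg g {{ℚ.positive g>0}}}}
            (subst (g ℚ.* u n ℚ.<_) (trans xu≡1 (sym (ℚ.*-inverseʳ g)))
              (ℚ.*-monoˡ-<-pos (u n) {{ℚ.positive (u>0 n)}} g<x))))
      (pos-elim x>0)
    1/g>0 : 0ℚ ℚ.< ℚ.1/ g
    1/g>0 = ℚ.positive⁻¹ (ℚ.1/ g) {{ℚ.1/pos⇒pos g {{ℚ.positive g>0}}}}
    difference : ∀ a b v w → a ℚ.* v ≡ 1ℚ → b ℚ.* w ≡ 1ℚ → w ℚ.* (v ℚ.* (b ℚ.- a)) ≡ v ℚ.- w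
    difference a b v w av≡1 bw≡1 = trans (expand a b v w)
      (trans (cong₂ (λ s t → v ℚ.* s ℚ.- w ℚ.* t) bw≡1 av≡1)
        (cong₂ ℚ._-_ (ℚ.*-identityʳ v) (ℚ.*-identityʳ w)))
      where
      expand : ∀ a b v w → w ℚ.* (v ℚ.* (b ℚ.- a)) ≡ v ℚ.* (b ℚ.* w) ℚ.- w ℚ.* (a ℚ.* v)
      expand = solve 4 (λ a b v w → w :* (v :* (b :- a)) := v :* (b :* w) :- w :* (a :* v)) refl
    u-cauchy : IsCauchy u
    u-cauchy ε ε>0 =
      let (η , η>0 , small₁) = tolerance 1/g>0 ε>0
          (δ , δ>0 , small₂) = tolerance 1/g>0 η>0
          (N₁ , near)        = cauchy x δ δ>0
          (N₂ , reg)         = regular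
      in N₁ ℕ.⊔ N₂ , λ m n ≤m ≤n →
         let (xu≡1 , um<) = reg m (ℕ.m⊔n≤o⇒n≤o N₁ N₂ ≤m)
             (xv≡1 , un<) = reg n (ℕ.m⊔n≤o⇒n≤o N₁ N₂ ≤n)
         in subst (λ d → ∣ d ∣ ℚ.< ε) (difference (seq x m) (seq x n) (u m) (u n) xu≡1 xv≡1)
              (small₁ (u n) (u m ℚ.* (seq x n ℚ.- seq x m)) un<
                (small₂ (u m) (seq x n ℚ.- seq x m) um<
                  (near n m (ℕ.m⊔n≤o⇒m≤o N₁ N₂ ≤n) (ℕ.m⊔n≤o⇒m≤o N₁ N₂ ≤m))))

  #-inverse : x # 0ℝ → ∃[ y ] x * y ≈ 1ℝ
  #-inverse {x} x#0 = [ pos-inverse , negate ]′ (#⇒± x#0)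
    where
    negate : 0ℝ < - x → ∃[ y ] x * y ≈ 1ℝ
    negate x<0 = let (y , -xy≈1) = pos-inverse x<0 in
      - y , ≈-trans (≈-trans (neg-*ʳ x y) (≈-sym (neg-*ˡ x y))) -xy≈1

  -- The Archimedean property and estimates for small arguments

  ι : ℕ → ℚ
  ι n = fromℤ (int n)

  ι-suc : ∀ n → ι (suc n) ≡ 1ℚ ℚ.+ ι n
  ι-suc n = ℚ.toℚᵘ-injective (ℚᵘ.≃-trans numerators (ℚᵘ.≃-sym (ℚ.toℚᵘ-homo-+ 1ℚ (ι n))))
    where
    numerators : ℚ.toℚᵘ (ι (suc n)) ℚᵘ.≃ ℚ.toℚᵘ 1ℚ ℚᵘ.+ ℚ.toℚᵘ (ι n)
    numerators = ℚᵘ.*≡* (cong (ℤ._* int 1) (sym (cong (λ i → int 1 ℤ.+ i) (ℤ.*-identityʳ (int n)))))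

  -- The denominator is at least 1, so the absolute value of the numerator is a bound.
  ≤ι : ∀ q → q ℚ.≤ ι (ℤ.∣ ℚ.↥ q ∣)
  ≤ι (mkℚ (int k) d _)    = ℚ.*≤* (ℤ.*-monoˡ-≤-nonNeg (int k) {int 1} {int (suc d)} (ℤ.+≤+ (s≤s z≤n)))
  ≤ι (mkℚ -[1+ k ] d _) = ℚ.*≤* ℤ.-≤+

  ι-archimedean : ∀ q {ε} → 0ℚ ℚ.< ε → ∃[ n ] q ℚ.< ι (suc n) ℚ.* ε
  ι-archimedean q {ε} ε>0 = n , subst₂ ℚ._<_ q/ε*ε≡q refl
      (ℚ.*-monoˡ-<-pos ε (ℚ-<-by {r} 1ℚ (ℚ.positive⁻¹ 1ℚ) refl <-≤ bound))
    where
    instance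
      ε-pos : ℚ.Positive ε
      ε-pos = ℚ.positive ε>0
      ε-nonZero : ℚ.NonZero ε
      ε-nonZero = ℚ.pos⇒nonZero ε
    r : ℚ
    r = q ℚ.* ℚ.1/ ε
    n : ℕ
    n = ℤ.∣ ℚ.↥ r ∣
    _<-≤_ : ∀ {a b c} → a ℚ.< b → b ℚ.≤ c → a ℚ.< c
    _<-≤_ = ℚ.<-≤-trans
    bound : r ℚ.+ 1ℚ ℚ.≤ ι (suc n)
    bound = subst₂ ℚ._≤_ (ℚ.+-comm 1ℚ r) (sym (ι-suc n)) (ℚ.+-monoʳ-≤ 1ℚ (≤ι r))
    q/ε*ε≡q : r ℚ.* ε ≡ q
    q/ε*ε≡q = trans (ℚ.*-assoc q (ℚ.1/ ε) ε) (trans (cong (q ℚ.*_) (ℚ.*-inverseˡ ε)) (ℚ.*-identityʳ q))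

  ℚ-≤-by : ∀ d → 0ℚ ℚ.≤ d → p ℚ.+ d ≡ q → p ℚ.≤ q
  ℚ-≤-by {p} d d≥0 refl = subst (ℚ._≤ p ℚ.+ d) (ℚ.+-identityʳ p) (ℚ.+-monoʳ-≤ p d≥0)

  ℚ-gap≥0 : p ℚ.≤ q → 0ℚ ℚ.≤ q ℚ.- p
  ℚ-gap≥0 {p} {q} p≤q = subst (ℚ._≤ q ℚ.- p) (ℚ.+-inverseʳ p) (ℚ.+-monoˡ-≤ (ℚ.- p) p≤q)

  ℚ-nonNeg-* : 0ℚ ℚ.≤ p → 0ℚ ℚ.≤ q → 0ℚ ℚ.≤ p ℚ.* q
  ℚ-nonNeg-* {p} {q} p≥0 q≥0 =
    ℚ.nonNegative⁻¹ (p ℚ.* q) {{ℚ.nonNeg*nonNeg⇒nonNeg p {{ℚ.nonNegative p≥0}} q {{ℚ.nonNegative q≥0}}}}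

  eventually≥0⇒nonNeg : ∀ {x} n → (∀ m → n ℕ.≤ m → 0ℚ ℚ.≤ seq x m) → NonNeg x
  eventually≥0⇒nonNeg {x} n x≥0 -x>0 = let (N , g<-x) = pos-elim -x>0 ; m = n ℕ.⊔ N in
    ℚ.<-irrefl refl (subst (0ℚ ℚ.<_) (ℚ.+-inverseʳ (seq x m))
      (ℚ.+-mono-≤-< (x≥0 m (ℕ.m≤m⊔n n N)) (ℚ.<-trans (gap>0 -x>0) (g<-x m (ℕ.m≤n⊔m n N)))))

  nonNeg-fromℚ : 0ℚ ℚ.≤ q → NonNeg (fromℚ q)
  nonNeg-fromℚ {q} q≥0 = eventually≥0⇒nonNeg 0 λ _ _ → q≥0

  upperBound₂ : ∀ x y → ∃[ K ] (1ℚ ℚ.≤ K) × NonNeg (fromℚ K - x) × NonNeg (fromℚ K - y)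
  upperBound₂ x y =
    let (B , B>0 , x<B) = upperBound x
        (C , C>0 , y<C) = upperBound y
        C+1>0 = ℚ-pos-+ C>0 (ℚ.positive⁻¹ 1ℚ)
        B+1>0 = ℚ-pos-+ B>0 (ℚ.positive⁻¹ 1ℚ)
    in B ℚ.+ (C ℚ.+ 1ℚ)
     , ℚ-≤-by (B ℚ.+ C) (ℚ.<⇒≤ (ℚ-pos-+ B>0 C>0)) (rearrange₁ B C)
     , nonNeg-cong (pointwise λ n → rearrange₂ B C (seq x n)) (nonNeg-+ (pos-asym x<B) (nonNeg-fromℚ (ℚ.<⇒≤ C+1>0)))
     , nonNeg-cong (pointwise λ n → rearrange₃ B C (seq y n)) (nonNeg-+ (pos-asym y<C) (nonNeg-fromℚ (ℚ.<⇒≤ B+1>0)))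
    where
    rearrange₁ : ∀ b c → 1ℚ ℚ.+ (b ℚ.+ c) ≡ b ℚ.+ (c ℚ.+ 1ℚ)
    rearrange₁ = solve 2 (λ b c → con 1ℚ :+ (b :+ c) := b :+ (c :+ con 1ℚ)) refl
    rearrange₂ : ∀ b c x → (b ℚ.- x) ℚ.+ (c ℚ.+ 1ℚ) ≡ (b ℚ.+ (c ℚ.+ 1ℚ)) ℚ.- x
    rearrange₂ = solve 3 (λ b c x → (b :- x) :+ (c :+ con 1ℚ) := (b :+ (c :+ con 1ℚ)) :- x) refl
    rearrange₃ : ∀ b c y → (c ℚ.- y) ℚ.+ (b ℚ.+ 1ℚ) ≡ (b ℚ.+ (c ℚ.+ 1ℚ)) ℚ.- y
    rearrange₃ = solve 3 (λ b c y → (c :- y) :+ (b :+ con 1ℚ) := (b :+ (c :+ con 1ℚ)) :- y) refl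

  -- With K ≥ α, β, 1, every power of h ≤ δ ≤ 1 is at most h, so the value is at
  -- most 3 K δ; δ = g / (3 K + g) makes this at most g.
  cubic-small : ∀ α β {g} → 0ℚ ℚ.< g → ∃[ δ ] (0ℚ ℚ.< δ) ×
    (∀ h → NonNeg h → NonNeg (fromℚ δ - h) → NonNeg (fromℚ g - (h * α + (h * h) * β + (h * h) * h)))
  cubic-small α β {g} g>0 = bound (upperBound₂ α β)
    where
    bound : (∃[ K ] (1ℚ ℚ.≤ K) × NonNeg (fromℚ K - α) × NonNeg (fromℚ K - β)) → _
    bound (K , K≥1 , α≤K , β≤K) = δ , δ>0 , λ h h≥0 h≤δ →
      let 1-h≥0 = nonNeg-cong {y = 1ℝ - h} (pointwise λ n → 1-h (seq h n))
                    (nonNeg-+ (nonNeg-fromℚ (ℚ-nonNeg-* (ℚ-nonNeg-* {ι 3} (ℚ.≤ᵇ⇒≤ _) K≥0) (ℚ.<⇒≤ I>0))) h≤δ)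
      in nonNeg-cong (pointwise λ n → decomposition (seq h n) (seq α n) (seq β n))
        (nonNeg-+ (nonNeg-+ (nonNeg-+ (nonNeg-+ (nonNeg-+ (nonNeg-+
          (nonNeg-fromℚ (ℚ-nonNeg-* (ℚ-nonNeg-* (ℚ.<⇒≤ g>0) (ℚ.<⇒≤ g>0)) (ℚ.<⇒≤ I>0)))
          (nonNeg-* (nonNeg-fromℚ (ℚ-nonNeg-* {ι 3} (ℚ.≤ᵇ⇒≤ _) K≥0)) h≤δ))
          (nonNeg-* h≥0 α≤K))
          (nonNeg-* (nonNeg-square h) β≤K))
          (nonNeg-* (nonNeg-* h≥0 (nonNeg-fromℚ K≥0)) 1-h≥0))
          (nonNeg-* h≥0 (nonNeg-fromℚ (ℚ-gap≥0 K≥1))))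
          (nonNeg-* (nonNeg-* h≥0 1-h≥0) (nonNeg-+ (pos-asym 0<1) h≥0)))
      where
      K≥0 : 0ℚ ℚ.≤ K
      K≥0 = ℚ.≤-trans (ℚ.≤ᵇ⇒≤ {0ℚ} {1ℚ} _) K≥1
      D : ℚ
      D = ι 3 ℚ.* K ℚ.+ g
      D>0 : 0ℚ ℚ.< D
      D>0 = ℚ.+-mono-≤-< (ℚ-nonNeg-* {ι 3} (ℚ.≤ᵇ⇒≤ _) K≥0) g>0
      instance
        D-pos : ℚ.Positive D
        D-pos = ℚ.positive D>0
        D-nonZero : ℚ.NonZero D
        D-nonZero = ℚ.pos⇒nonZero D
      I δ : ℚ
      I = ℚ.1/ D
      δ = g ℚ.* I
      I>0 : 0ℚ ℚ.< I
      I>0 = ℚ.positive⁻¹ I {{ℚ.1/pos⇒pos D}}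
      δ>0 : 0ℚ ℚ.< δ
      δ>0 = ℚ-pos-* g>0 I>0
      1-h : ∀ h → (ι 3 ℚ.* K) ℚ.* I ℚ.+ (δ ℚ.- h) ≡ 1ℚ ℚ.- h
      1-h h = trans (rearrange K g I h) (cong (ℚ._- h) (ℚ.*-inverseʳ D))
        where
        rearrange : ∀ K g I h → (ι 3 ℚ.* K) ℚ.* I ℚ.+ (g ℚ.* I ℚ.- h) ≡ (ι 3 ℚ.* K ℚ.+ g) ℚ.* I ℚ.- h
        rearrange = solve 4 (λ K g I h → (con (ι 3) :* K) :* I :+ (g :* I :- h) := (con (ι 3) :* K :+ g) :* I :- h) refl
      -- Since (3 K + g) I = 1, the number g equals g² I + 3 K δ. The first two summands thus give g
      -- - 3 K h, and the others account for the passage from 3 K h to h α + h² β + h³; each is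
      -- nonnegative for 0 ≤ h ≤ δ ≤ 1.
      decomposition : ∀ h α β →
        g ℚ.* g ℚ.* I ℚ.+ (ι 3 ℚ.* K) ℚ.* (δ ℚ.- h) ℚ.+ h ℚ.* (K ℚ.- α) ℚ.+ (h ℚ.* h) ℚ.* (K ℚ.- β)
          ℚ.+ (h ℚ.* K) ℚ.* (1ℚ ℚ.- h) ℚ.+ h ℚ.* (K ℚ.- 1ℚ) ℚ.+ (h ℚ.* (1ℚ ℚ.- h)) ℚ.* (1ℚ ℚ.+ h)
        ≡ g ℚ.- (h ℚ.* α ℚ.+ (h ℚ.* h) ℚ.* β ℚ.+ (h ℚ.* h) ℚ.* h)
      decomposition h α β = trans (rearrange K g I h α β)
        (trans (cong (λ t → g ℚ.* t ℚ.- (h ℚ.* α ℚ.+ (h ℚ.* h) ℚ.* β ℚ.+ (h ℚ.* h) ℚ.* h)) (ℚ.*-inverseʳ D))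
          (cong (ℚ._- (h ℚ.* α ℚ.+ (h ℚ.* h) ℚ.* β ℚ.+ (h ℚ.* h) ℚ.* h)) (ℚ.*-identityʳ g)))
        where
        rearrange : ∀ K g I h α β →
          g ℚ.* g ℚ.* I ℚ.+ (ι 3 ℚ.* K) ℚ.* (g ℚ.* I ℚ.- h) ℚ.+ h ℚ.* (K ℚ.- α) ℚ.+ (h ℚ.* h) ℚ.* (K ℚ.- β)
            ℚ.+ (h ℚ.* K) ℚ.* (1ℚ ℚ.- h) ℚ.+ h ℚ.* (K ℚ.- 1ℚ) ℚ.+ (h ℚ.* (1ℚ ℚ.- h)) ℚ.* (1ℚ ℚ.+ h)
          ≡ g ℚ.* ((ι 3 ℚ.* K ℚ.+ g) ℚ.* I) ℚ.- (h ℚ.* α ℚ.+ (h ℚ.* h) ℚ.* β ℚ.+ (h ℚ.* h) ℚ.* h)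
        rearrange = solve 6 (λ K g I h α β →
          g :* g :* I :+ (con (ι 3) :* K) :* (g :* I :- h) :+ h :* (K :- α) :+ (h :* h) :* (K :- β)
            :+ (h :* K) :* (con 1ℚ :- h) :+ h :* (K :- con 1ℚ) :+ (h :* (con 1ℚ :- h)) :* (con 1ℚ :+ h)
          := g :* ((con (ι 3) :* K :+ g) :* I) :- (h :* α :+ (h :* h) :* β :+ (h :* h) :* h)) refl

  pos-separated : 0ℝ < x → ∃[ g ] (0ℚ ℚ.< g) × (0ℝ < x - fromℚ g)
  pos-separated {x} x>0@(mk< g g>0 _ _) = ½ ℚ.* g , half>0 g>0 , pos-intro _ (half>0 g>0)
    (eventually-map (λ n g<x → ℚ-<-by _ (ℚ-gap>0 g<x) (rearrange g (seq x n))) (pos-elim x>0))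
    where
    rearrange : ∀ g a → ½ ℚ.* g ℚ.+ (a ℚ.- g) ≡ a ℚ.- ½ ℚ.* g
    rearrange = solve 2 (λ g a → con ½ :* g :+ (a :- g) := a :- con ½ :* g) refl

  -- Roots of monic cubics

  cubic : ℝ → ℝ → ℝ → ℝ → ℝ
  cubic a b c t = ((t + a) * t + b) * t + c

  pos-third : 0ℝ < y + (y + y) → 0ℝ < y
  pos-third = [ id , [ id , id ]′ ∘ pos-⊎ ]′ ∘ pos-⊎

  module Bisection (a b c : ℝ) where

    P : ℚ → ℝ
    P t = cubic a b c (fromℚ t)

    record Bracket : Set where
      field
        l r : ℚ
        l<r : l ℚ.< r
        P⟨l⟩<0 : 0ℝ < - P l
        P⟨r⟩>0 : 0ℝ < P r

    open Bracket

    width : Bracket → ℚ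
    width B = r B ℚ.- l B

    record Refines (B B′ : Bracket) : Set where
      field
        l-mono  : l B ℚ.≤ l B′
        r-anti  : r B′ ℚ.≤ r B
        shrinks : ι 3 ℚ.* width B′ ℚ.≤ ι 2 ℚ.* width B

    node : ℚ → Bracket → ℚ
    node k B = l B ℚ.+ k ℚ.* width B

    -- Four nodes with step 1/9 spanning the middle third, so that moving either end of the bracket
    -- to any of them leaves at most 2/3 of the width.
    ⅓ ⁴/₉ ⁵/₉ ⅔ : ℚ
    ⅓   = int 1 ℚ./ 3
    ⁴/₉ = int 4 ℚ./ 9
    ⁵/₉ = int 5 ℚ./ 9
    ⅔   = int 2 ℚ./ 3

    -- The third difference of a monic cubic with step h is 6 h³.
    third-difference : ∀ B → let h = int 1 ℚ./ 9 ℚ.* width B ; p = λ k → P (node k B) in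
      fromℚ (ι 6 ℚ.* (h ℚ.* (h ℚ.* h))) ≈
        p ⅔ + ((- p ⁵/₉ + (- p ⁵/₉ + - p ⁵/₉)) + ((p ⁴/₉ + (p ⁴/₉ + p ⁴/₉)) + - p ⅓))
    third-difference B = pointwise λ n → identity (l B) (width B) (seq a n) (seq b n) (seq c n)
      where
      identity : ∀ l w a b c →
        let h = int 1 ℚ./ 9 ℚ.* w ; p = λ k → let t = l ℚ.+ k ℚ.* w in ((t ℚ.+ a) ℚ.* t ℚ.+ b) ℚ.* t ℚ.+ c in
        ι 6 ℚ.* (h ℚ.* (h ℚ.* h)) ≡
          p ⅔ ℚ.+ ((ℚ.- p ⁵/₉ ℚ.+ (ℚ.- p ⁵/₉ ℚ.+ ℚ.- p ⁵/₉)) ℚ.+ ((p ⁴/₉ ℚ.+ (p ⁴/₉ ℚ.+ p ⁴/₉)) ℚ.+ ℚ.- p ⅓))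
      identity = solve 5 (λ l w a b c →
        let h = con (int 1 ℚ./ 9) :* w ; p = λ k → let t = l :+ con k :* w in ((t :+ a) :* t :+ b) :* t :+ c in
        con (ι 6) :* (h :* (h :* h)) :=
          p ⅔ :+ ((:- p ⁵/₉ :+ (:- p ⁵/₉ :+ :- p ⁵/₉)) :+ ((p ⁴/₉ :+ (p ⁴/₉ :+ p ⁴/₉)) :+ :- p ⅓))) refl

    module _ (B : Bracket) where

      width>0 : 0ℚ ℚ.< width B
      width>0 = ℚ-gap>0 (l<r B)

      shrinkRight : ∀ k → 0ℚ ℚ.< k → k ℚ.≤ ⅔ → 0ℝ < P (node k B) → ∃[ B′ ] Refines B B′
      shrinkRight k k>0 k≤⅔ p>0 =
        record { l = l B ; r = node k B ; l<r = ℚ-<-by _ (ℚ-pos-* k>0 width>0) refl ; P⟨l⟩<0 = P⟨l⟩<0 B ; P⟨r⟩>0 = p>0 } ,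
        record
          { l-mono  = ℚ.≤-refl
          ; r-anti  = ℚ-≤-by _ (ℚ-nonNeg-* (ℚ-gap≥0 {q = 1ℚ} (ℚ.≤-trans k≤⅔ (ℚ.≤ᵇ⇒≤ _))) (ℚ.<⇒≤ width>0)) (r-eq (l B) (r B) k)
          ; shrinks = ℚ-≤-by _ (ℚ-nonNeg-* (ℚ-nonNeg-* {ι 3} (ℚ.≤ᵇ⇒≤ _) (ℚ-gap≥0 k≤⅔)) (ℚ.<⇒≤ width>0))
                        (width-eq (l B) (r B) k) }
        where
        r-eq : ∀ l r k → (l ℚ.+ k ℚ.* (r ℚ.- l)) ℚ.+ (1ℚ ℚ.- k) ℚ.* (r ℚ.- l) ≡ r
        r-eq = solve 3 (λ l r k → (l :+ k :* (r :- l)) :+ (con 1ℚ :- k) :* (r :- l) := r) refl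
        width-eq : ∀ l r k → let w = r ℚ.- l in
          ι 3 ℚ.* ((l ℚ.+ k ℚ.* w) ℚ.- l) ℚ.+ (ι 3 ℚ.* (⅔ ℚ.- k)) ℚ.* w ≡ ι 2 ℚ.* w
        width-eq = solve 3 (λ l r k → let w = r :- l in
          con (ι 3) :* ((l :+ k :* w) :- l) :+ (con (ι 3) :* (con ⅔ :- k)) :* w := con (ι 2) :* w) refl

      shrinkLeft : ∀ k → ⅓ ℚ.≤ k → k ℚ.< 1ℚ → 0ℝ < - P (node k B) → ∃[ B′ ] Refines B B′
      shrinkLeft k ⅓≤k k<1 p<0 =
        record { l = node k B ; r = r B ; l<r = ℚ-<-by _ (ℚ-pos-* (ℚ-gap>0 k<1) width>0) (r-eq (l B) (r B) k)
               ; P⟨l⟩<0 = p<0 ; P⟨r⟩>0 = P⟨r⟩>0 B } ,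
        record
          { l-mono  = ℚ-≤-by _ (ℚ-nonNeg-* (ℚ.≤-trans (ℚ.≤ᵇ⇒≤ _) ⅓≤k) (ℚ.<⇒≤ width>0)) refl
          ; r-anti  = ℚ.≤-refl
          ; shrinks = ℚ-≤-by _ (ℚ-nonNeg-* (ℚ-nonNeg-* {ι 3} (ℚ.≤ᵇ⇒≤ _) (ℚ-gap≥0 ⅓≤k)) (ℚ.<⇒≤ width>0))
                        (width-eq (l B) (r B) k) }
        where
        r-eq : ∀ l r k → (l ℚ.+ k ℚ.* (r ℚ.- l)) ℚ.+ (1ℚ ℚ.- k) ℚ.* (r ℚ.- l) ≡ r
        r-eq = solve 3 (λ l r k → (l :+ k :* (r :- l)) :+ (con 1ℚ :- k) :* (r :- l) := r) refl
        width-eq : ∀ l r k → let w = r ℚ.- l in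
          ι 3 ℚ.* (r ℚ.- (l ℚ.+ k ℚ.* w)) ℚ.+ (ι 3 ℚ.* (k ℚ.- ⅓)) ℚ.* w ≡ ι 2 ℚ.* w
        width-eq = solve 3 (λ l r k → let w = r :- l in
          con (ι 3) :* (r :- (l :+ k :* w)) :+ (con (ι 3) :* (k :- con ⅓)) :* w := con (ι 2) :* w) refl

      refine : ∃[ B′ ] Refines B B′
      refine =
        -- The positive summand of the third difference decides the side: a positive value at 2/3 or
        -- 4/9 makes a right end, a negative value at 5/9 or 1/3 a left end.
        [ shrinkRight ⅔ (ℚ.positive⁻¹ ⅔) ℚ.≤-refl
        , [ shrinkLeft ⁵/₉ (ℚ.≤ᵇ⇒≤ _) (ℚ-<-by ⁴/₉ (ℚ.positive⁻¹ ⁴/₉) refl) ∘ pos-third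
          , [ shrinkRight ⁴/₉ (ℚ.positive⁻¹ ⁴/₉) (ℚ.≤ᵇ⇒≤ _) ∘ pos-third
            , shrinkLeft ⅓ ℚ.≤-refl (ℚ-<-by ⅔ (ℚ.positive⁻¹ ⅔) refl) ]′ ∘ pos-⊎ ]′ ∘ pos-⊎ ]′
        (pos-⊎ (pos-cong (third-difference B) (fromℚ-pos (ℚ-pos-* (ℚ.positive⁻¹ (ι 6)) (ℚ-pos-* h>0 (ℚ-pos-* h>0 h>0))))))
        where
        h>0 : 0ℚ ℚ.< int 1 ℚ./ 9 ℚ.* width B
        h>0 = ℚ-pos-* (ℚ.positive⁻¹ (int 1 ℚ./ 9)) width>0

    -- P′(t) and P″(t) / 2, the Taylor coefficients of the cubic at t.
    slope curvature : ℝ → ℝ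
    slope t     = fromℚ (ι 3) * (t * t) + fromℚ (ι 2) * (a * t) + b
    curvature t = fromℚ (ι 3) * t + a

    module Root (B₀ : Bracket) where

      B : ℕ → Bracket
      B zero    = B₀
      B (suc n) = proj₁ (refine (B n))

      open Refines

      l-mono-≤ : ∀ {m n} → m ℕ.≤ n → l (B m) ℚ.≤ l (B n)
      l-mono-≤ = go ∘ ℕ.≤⇒≤′
        where
        go : ∀ {m n} → m ℕ.≤′ n → l (B m) ℚ.≤ l (B n)
        go ℕ.≤′-refl = ℚ.≤-refl
        go (ℕ.≤′-step {n} m≤n) = ℚ.≤-trans (go m≤n) (l-mono (proj₂ (refine (B n))))

      r-anti-≤ : ∀ {m n} → m ℕ.≤ n → r (B n) ℚ.≤ r (B m)
      r-anti-≤ = go ∘ ℕ.≤⇒≤′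
        where
        go : ∀ {m n} → m ℕ.≤′ n → r (B n) ℚ.≤ r (B m)
        go ℕ.≤′-refl = ℚ.≤-refl
        go (ℕ.≤′-step {n} m≤n) = ℚ.≤-trans (r-anti (proj₂ (refine (B n)))) (go m≤n)

      -- The geometric decay (2/3)ⁿ is weakened to 2 / (n + 2), which avoids powers and suits the
      -- Archimedean property; the induction rests on (2/3)(n + 3) ≤ n + 2.
      width-bound : ∀ n → ι (2 ℕ.+ n) ℚ.* width (B n) ℚ.≤ ι 2 ℚ.* width B₀
      width-bound zero    = ℚ.≤-refl
      width-bound (suc n) = ℚ.≤-trans
        (ℚ-≤-by _ (ℚ-nonNeg-* {⅓} (ℚ.≤ᵇ⇒≤ _) (ℚ.+-mono-≤
                    (ℚ-nonNeg-* (ι≥0 (3 ℕ.+ n)) (ℚ-gap≥0 (shrinks (proj₂ (refine (B n))))))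
                    (ℚ-nonNeg-* (ι≥0 n) (ℚ.<⇒≤ (width>0 (B n))))))
          (trans (cong (λ i → i ℚ.* w′ ℚ.+ ⅓ ℚ.* (i ℚ.* (ι 2 ℚ.* w ℚ.- ι 3 ℚ.* w′) ℚ.+ ι n ℚ.* w)) ι3+n≡)
            (trans (rearrange (ι n) w w′) (cong (ℚ._* w) (sym ι2+n≡)))))
        (width-bound n)
        where
        w w′ : ℚ
        w  = width (B n)
        w′ = width (B (suc n))
        ι≥0 : ∀ n → 0ℚ ℚ.≤ ι n
        ι≥0 n = ℚ.nonNegative⁻¹ (ι n)
        ι2+n≡ : ι (2 ℕ.+ n) ≡ ι 2 ℚ.+ ι n
        ι2+n≡ = trans (ι-suc (suc n)) (trans (cong (1ℚ ℚ.+_) (ι-suc n)) (sym (ℚ.+-assoc 1ℚ 1ℚ (ι n))))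
        ι3+n≡ : ι (3 ℕ.+ n) ≡ ι 3 ℚ.+ ι n
        ι3+n≡ = trans (ι-suc (2 ℕ.+ n)) (trans (cong (1ℚ ℚ.+_) ι2+n≡) (sym (ℚ.+-assoc 1ℚ (ι 2) (ι n))))
        rearrange : ∀ n w w′ → (ι 3 ℚ.+ n) ℚ.* w′ ℚ.+
          ⅓ ℚ.* ((ι 3 ℚ.+ n) ℚ.* (ι 2 ℚ.* w ℚ.- ι 3 ℚ.* w′) ℚ.+ n ℚ.* w) ≡ (ι 2 ℚ.+ n) ℚ.* w
        rearrange = solve 3 (λ n w w′ → (con (ι 3) :+ n) :* w′ :+
          con ⅓ :* ((con (ι 3) :+ n) :* (con (ι 2) :* w :- con (ι 3) :* w′) :+ n :* w) := (con (ι 2) :+ n) :* w) refl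

      width-small : ∀ ε → 0ℚ ℚ.< ε → ∃[ n ] width (B n) ℚ.< ε
      width-small ε ε>0 = let (n , 2w₀<) = ι-archimedean (ι 2 ℚ.* width B₀) ε>0 in
        n , ℚ.*-cancelˡ-<-nonNeg (ι (2 ℕ.+ n)) (ℚ.≤-<-trans (width-bound n) (ℚ.<-trans 2w₀<
          (ℚ-<-by ε ε>0 (trans (rearrange (ι (suc n)) ε) (cong (ℚ._* ε) (sym (ι-suc (suc n))))))))
        where
        rearrange : ∀ n ε → n ℚ.* ε ℚ.+ ε ≡ (1ℚ ℚ.+ n) ℚ.* ε
        rearrange = solve 2 (λ n ε → n :* ε :+ ε := (con 1ℚ :+ n) :* ε) refl

      l-cauchy : IsCauchy (λ n → l (B n))
      l-cauchy ε ε>0 = let (k , w<ε) = width-small ε ε>0 in k , λ m n k≤m k≤n →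
        ∣∣<-intro (l (B m) ℚ.- l (B n)) (near k≤m k≤n w<ε)
          (subst (ℚ._< ε) (swap (l (B n)) (l (B m))) (near k≤n k≤m w<ε))
        where
        swap : ∀ a b → a ℚ.- b ≡ ℚ.- (b ℚ.- a)
        swap = solve 2 (λ a b → a :- b := :- (b :- a)) refl
        rearrange : ∀ ε a b c d → (a ℚ.- b) ℚ.+ ((d ℚ.- a) ℚ.+ (b ℚ.- c) ℚ.+ (ε ℚ.- (d ℚ.- c))) ≡ ε
        rearrange = solve 5 (λ ε a b c d → (a :- b) :+ ((d :- a) :+ (b :- c) :+ (ε :- (d :- c))) := ε) refl
        near : ∀ {k m n} → k ℕ.≤ m → k ℕ.≤ n → width (B k) ℚ.< ε → l (B m) ℚ.- l (B n) ℚ.< ε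
        near {k} {m} {n} k≤m k≤n w<ε = ℚ-<-by _
          (ℚ-pos-+ (ℚ.+-mono-<-≤ (ℚ-gap>0 (ℚ.<-≤-trans (l<r (B m)) (r-anti-≤ k≤m))) (ℚ-gap≥0 (l-mono-≤ k≤n)))
                   (ℚ-gap>0 w<ε))
          (rearrange ε (l (B m)) (l (B n)) (l (B k)) (r (B k)))

      ρ : ℝ
      ρ = mkℝ (λ n → l (B n)) l-cauchy

      ρ≥l : ∀ n → NonNeg (ρ - fromℚ (l (B n)))
      ρ≥l n = eventually≥0⇒nonNeg n λ m n≤m → ℚ-gap≥0 (l-mono-≤ n≤m)

      ρ≤r : ∀ n → NonNeg (fromℚ (r (B n)) - ρ)
      ρ≤r n = eventually≥0⇒nonNeg n λ m n≤m → ℚ-gap≥0 (ℚ.≤-trans (ℚ.<⇒≤ (l<r (B m))) (r-anti-≤ n≤m))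

      -- If P(ρ) > g > 0, the Taylor expansion at ρ bounds P(ρ) - P(l) by g for a left end l close
      -- enough to ρ, so P(l) would be positive. Formally, the three sign conditions have a sum that
      -- is identically 0. The next lemma is the mirror image at right ends.
      value≯0 : ¬ (0ℝ < cubic a b c ρ)
      value≯0 p>0 =
        let (g , g>0 , p>g)     = pos-separated p>0
            (δ , δ>0 , small)   = cubic-small (slope ρ) (- curvature ρ) g>0
            (n , w<δ)           = width-small δ δ>0
            h                   = ρ - fromℚ (l (B n))
            h≤δ                 = nonNeg-cong (pointwise λ k → rearrange δ (l (B n)) (r (B n)) (seq ρ k))
                                    (nonNeg-+ (nonNeg-fromℚ (ℚ.<⇒≤ (ℚ-gap>0 w<δ))) (ρ≤r n))
        in zero⇒≯0 (pointwise λ k → vanish g (l (B n)) (seq ρ k) (seq a k) (seq b k) (seq c k))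
             (pos-+-nonNeg (pos-+ p>g (P⟨l⟩<0 (B n))) (small h (ρ≥l n) h≤δ))
        where
        rearrange : ∀ δ l r ρ → (δ ℚ.- (r ℚ.- l)) ℚ.+ (r ℚ.- ρ) ≡ δ ℚ.- (ρ ℚ.- l)
        rearrange = solve 4 (λ δ l r ρ → (δ :- (r :- l)) :+ (r :- ρ) := δ :- (ρ :- l)) refl
        vanish : ∀ g l x a b c → let h = x ℚ.- l ; p = λ t → ((t ℚ.+ a) ℚ.* t ℚ.+ b) ℚ.* t ℚ.+ c in
          ((p x ℚ.- g) ℚ.+ ℚ.- p l) ℚ.+ (g ℚ.- (h ℚ.* (ι 3 ℚ.* (x ℚ.* x) ℚ.+ ι 2 ℚ.* (a ℚ.* x) ℚ.+ b)
            ℚ.+ (h ℚ.* h) ℚ.* (ℚ.- (ι 3 ℚ.* x ℚ.+ a)) ℚ.+ (h ℚ.* h) ℚ.* h)) ≡ 0ℚ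
        vanish = solve 6 (λ g l x a b c → let h = x :- l ; p = λ t → ((t :+ a) :* t :+ b) :* t :+ c in
          ((p x :- g) :+ :- p l) :+ (g :- (h :* (con (ι 3) :* (x :* x) :+ con (ι 2) :* (a :* x) :+ b)
            :+ (h :* h) :* (:- (con (ι 3) :* x :+ a)) :+ (h :* h) :* h)) := con 0ℚ) refl

      value≮0 : ¬ (0ℝ < - cubic a b c ρ)
      value≮0 p<0 =
        let (g , g>0 , p<-g)    = pos-separated p<0
            (δ , δ>0 , small)   = cubic-small (slope ρ) (curvature ρ) g>0
            (n , w<δ)           = width-small δ δ>0
            h                   = fromℚ (r (B n)) - ρ
            h≤δ                 = nonNeg-cong (pointwise λ k → rearrange δ (l (B n)) (r (B n)) (seq ρ k))
                                    (nonNeg-+ (nonNeg-fromℚ (ℚ.<⇒≤ (ℚ-gap>0 w<δ))) (ρ≥l n))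
        in zero⇒≯0 (pointwise λ k → vanish g (r (B n)) (seq ρ k) (seq a k) (seq b k) (seq c k))
             (pos-+-nonNeg (pos-+ p<-g (P⟨r⟩>0 (B n))) (small h (ρ≤r n) h≤δ))
        where
        rearrange : ∀ δ l r ρ → (δ ℚ.- (r ℚ.- l)) ℚ.+ (ρ ℚ.- l) ≡ δ ℚ.- (r ℚ.- ρ)
        rearrange = solve 4 (λ δ l r ρ → (δ :- (r :- l)) :+ (ρ :- l) := δ :- (r :- ρ)) refl
        vanish : ∀ g r x a b c → let h = r ℚ.- x ; p = λ t → ((t ℚ.+ a) ℚ.* t ℚ.+ b) ℚ.* t ℚ.+ c in
          ((ℚ.- p x ℚ.- g) ℚ.+ p r) ℚ.+ (g ℚ.- (h ℚ.* (ι 3 ℚ.* (x ℚ.* x) ℚ.+ ι 2 ℚ.* (a ℚ.* x) ℚ.+ b)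
            ℚ.+ (h ℚ.* h) ℚ.* (ι 3 ℚ.* x ℚ.+ a) ℚ.+ (h ℚ.* h) ℚ.* h)) ≡ 0ℚ
        vanish = solve 6 (λ g r x a b c → let h = r :- x ; p = λ t → ((t :+ a) :* t :+ b) :* t :+ c in
          ((:- p x :- g) :+ p r) :+ (g :- (h :* (con (ι 3) :* (x :* x) :+ con (ι 2) :* (a :* x) :+ b)
            :+ (h :* h) :* (con (ι 3) :* x :+ a) :+ (h :* h) :* h)) := con 0ℚ) refl

    bracket-root : ∀ B₀ → ∃[ ρ ] (cubic a b c ρ ≈ 0ℝ) × NonNeg (ρ - fromℚ (l B₀))
    bracket-root B₀ = ρ , tight value≯0 value≮0 , ρ≥l 0
      where open Root B₀

  abstract
    -- The lower bound on ρ is kept for the square root, where it rules out the root -1 of the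
    -- auxiliary cubic.
    cubic-root-between : ∀ a b c l r → l ℚ.< r → 0ℝ < - cubic a b c (fromℚ l) → 0ℝ < cubic a b c (fromℚ r) →
      ∃[ ρ ] (cubic a b c ρ ≈ 0ℝ) × NonNeg (ρ - fromℚ l)
    cubic-root-between a b c l r l<r P⟨l⟩<0 P⟨r⟩>0 =
      bracket-root record { l = l ; r = r ; l<r = l<r ; P⟨l⟩<0 = P⟨l⟩<0 ; P⟨r⟩>0 = P⟨r⟩>0 }
      where open Bisection a b c

  absBound : ∀ x → ∃[ K ] (0ℚ ℚ.≤ K) × NonNeg (fromℚ K - x) × NonNeg (fromℚ K + x)
  absBound x = let (K , K≥1 , x≤K , -x≤K) = upperBound₂ x (- x) in
    K , ℚ.≤-trans (ℚ.≤ᵇ⇒≤ {0ℚ} {1ℚ} _) K≥1 , x≤K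
      , nonNeg-cong (pointwise λ n → rearrange K (seq x n)) -x≤K
    where
    rearrange : ∀ k x → k ℚ.- ℚ.- x ≡ k ℚ.+ x
    rearrange = solve 2 (λ k x → k :- :- x := k :+ x) refl

  -- For t = 1 + K one has t³ - K (t² + t + 1) = 1.
  cubic-pos : ∀ a b c → ∃[ K ] (0ℚ ℚ.≤ K) ×
    (0ℝ < cubic a b c (fromℚ (1ℚ ℚ.+ K))) × (0ℝ < - cubic a b c (fromℚ (ℚ.- (1ℚ ℚ.+ K))))
  cubic-pos a b c =
    let (A , A≥0 , a≤A , -a≤A) = absBound a
        (B , B≥0 , b≤B , -b≤B) = absBound b
        (C , C≥0 , c≤C , -c≤C) = absBound c
        K = A ℚ.+ (B ℚ.+ C)
        t = fromℚ (1ℚ ℚ.+ K)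
        K≥0 = ℚ.+-mono-≤ A≥0 (ℚ.+-mono-≤ B≥0 C≥0)
        t≥0 = nonNeg-fromℚ {1ℚ ℚ.+ K} (ℚ.+-mono-≤ (ℚ.≤ᵇ⇒≤ {0ℚ} {1ℚ} _) K≥0)
        B+C≥0 = nonNeg-fromℚ (ℚ.+-mono-≤ B≥0 C≥0)
        A+C≥0 = nonNeg-fromℚ (ℚ.+-mono-≤ A≥0 C≥0)
        A+B≥0 = nonNeg-fromℚ (ℚ.+-mono-≤ A≥0 B≥0)
    in K , K≥0
     , pos-cong (pointwise λ n → at-1+K A B C (seq a n) (seq b n) (seq c n))
         (pos-+-nonNeg 0<1 (nonNeg-+ (nonNeg-+
           (nonNeg-* (nonNeg-+ -a≤A B+C≥0) (nonNeg-* t≥0 t≥0))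
           (nonNeg-* (nonNeg-+ -b≤B A+C≥0) t≥0))
           (nonNeg-+ -c≤C A+B≥0)))
     , pos-cong (pointwise λ n → at-[1+K] A B C (seq a n) (seq b n) (seq c n))
         (pos-+-nonNeg 0<1 (nonNeg-+ (nonNeg-+
           (nonNeg-* (nonNeg-+ a≤A B+C≥0) (nonNeg-* t≥0 t≥0))
           (nonNeg-* (nonNeg-+ -b≤B A+C≥0) t≥0))
           (nonNeg-+ c≤C A+B≥0)))
    where
    at-1+K : ∀ A B C a b c → let K = A ℚ.+ (B ℚ.+ C) ; t = 1ℚ ℚ.+ K in
      1ℚ ℚ.+ (((A ℚ.+ a) ℚ.+ (B ℚ.+ C)) ℚ.* (t ℚ.* t) ℚ.+ ((B ℚ.+ b) ℚ.+ (A ℚ.+ C)) ℚ.* t ℚ.+ ((C ℚ.+ c) ℚ.+ (A ℚ.+ B)))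
      ≡ ((t ℚ.+ a) ℚ.* t ℚ.+ b) ℚ.* t ℚ.+ c
    at-1+K = solve 6 (λ A B C a b c → let K = A :+ (B :+ C) ; t = con 1ℚ :+ K in
      con 1ℚ :+ (((A :+ a) :+ (B :+ C)) :* (t :* t) :+ ((B :+ b) :+ (A :+ C)) :* t :+ ((C :+ c) :+ (A :+ B)))
      := ((t :+ a) :* t :+ b) :* t :+ c) refl
    at-[1+K] : ∀ A B C a b c → let K = A ℚ.+ (B ℚ.+ C) ; t = 1ℚ ℚ.+ K ; s = ℚ.- t in
      1ℚ ℚ.+ (((A ℚ.- a) ℚ.+ (B ℚ.+ C)) ℚ.* (t ℚ.* t) ℚ.+ ((B ℚ.+ b) ℚ.+ (A ℚ.+ C)) ℚ.* t ℚ.+ ((C ℚ.- c) ℚ.+ (A ℚ.+ B)))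
      ≡ ℚ.- (((s ℚ.+ a) ℚ.* s ℚ.+ b) ℚ.* s ℚ.+ c)
    at-[1+K] = solve 6 (λ A B C a b c → let K = A :+ (B :+ C) ; t = con 1ℚ :+ K ; s = :- t in
      con 1ℚ :+ (((A :- a) :+ (B :+ C)) :* (t :* t) :+ ((B :+ b) :+ (A :+ C)) :* t :+ ((C :- c) :+ (A :+ B)))
      := :- (((s :+ a) :* s :+ b) :* s :+ c)) refl

  cubic-root : ∀ a b c → ∃[ ρ ] cubic a b c ρ ≈ 0ℝ
  cubic-root a b c =
    let (K , K≥0 , P>0 , P<0) = cubic-pos a b c
        1+K>0 = ℚ.+-mono-<-≤ (ℚ.positive⁻¹ 1ℚ) K≥0
        (ρ , root , _) = cubic-root-between a b c (ℚ.- (1ℚ ℚ.+ K)) (1ℚ ℚ.+ K)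
          (ℚ.<-trans (ℚ.neg-antimono-< 1+K>0) 1+K>0) P<0 P>0
    in ρ , root

  -- (t + 1)(t² - D) is negative at 0 and positive far out, and t + 1 has no root
  -- in between.
  square-root : ∀ {D} → 0ℝ < D → ∃[ s ] s * s ≈ D
  square-root {D} D>0 =
    let (K , K≥0 , P>0 , _) = cubic-pos 1ℝ (- D) (- D)
        (s , root , s≥0) = cubic-root-between 1ℝ (- D) (- D) 0ℚ (1ℚ ℚ.+ K) (ℚ.+-mono-<-≤ (ℚ.positive⁻¹ 1ℚ) K≥0)
          (pos-cong (pointwise λ n → at-0 (seq D n)) D>0) P>0
        s+1>0 = pos-cong {y = s + 1ℝ} (pointwise λ n → add-1 (seq s n)) (pos-+-nonNeg 0<1 s≥0)
        s²-D≈0 = *≈0⇒≈0 {x = s * s - D} (inj₂ s+1>0) (≈-trans (pointwise λ n → factor (seq D n) (seq s n)) root)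
    in s , ≈-trans (pointwise λ n → restore-D (seq D n) (seq s n))
             (≈-trans (+-cong s²-D≈0 (≈-refl {D})) (+-identityˡ D))
    where
    at-0 : ∀ d → d ≡ ℚ.- (((0ℚ ℚ.+ 1ℚ) ℚ.* 0ℚ ℚ.+ ℚ.- d) ℚ.* 0ℚ ℚ.+ ℚ.- d)
    at-0 = solve 1 (λ d → d := :- (((con 0ℚ :+ con 1ℚ) :* con 0ℚ :+ :- d) :* con 0ℚ :+ :- d)) refl
    add-1 : ∀ s → 1ℚ ℚ.+ (s ℚ.- 0ℚ) ≡ s ℚ.+ 1ℚ
    add-1 = solve 1 (λ s → con 1ℚ :+ (s :- con 0ℚ) := s :+ con 1ℚ) refl
    factor : ∀ d s → (s ℚ.* s ℚ.- d) ℚ.* (s ℚ.+ 1ℚ) ≡ ((s ℚ.+ 1ℚ) ℚ.* s ℚ.+ ℚ.- d) ℚ.* s ℚ.+ ℚ.- d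
    factor = solve 2 (λ d s → (s :* s :- d) :* (s :+ con 1ℚ) := ((s :+ con 1ℚ) :* s :+ :- d) :* s :+ :- d) refl
    restore-D : ∀ d s → s ℚ.* s ≡ (s ℚ.* s ℚ.- d) ℚ.+ d
    restore-D = solve 2 (λ d s → s :* s := (s :* s :- d) :+ d) refl

open RealField

-- Finite sums

private variable
  m n : ℕ

module ∑ = SemiringSum semiring

*-congˡ : ∀ {x y z} → y ≈ z → x * y ≈ x * z
*-congˡ = *-cong ≈-refl

*-congʳ : ∀ {x y z} → y ≈ z → y * x ≈ z * x
*-congʳ y≈z = *-cong y≈z ≈-refl

*-leftSwap : ∀ a c x → a * (c * x) ≈ c * (a * x)
*-leftSwap a c x = pointwise λ n → solve 3 (λ a c x → a :* (c :* x) := c :* (a :* x)) refl (seq a n) (seq c n) (seq x n)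

≡⇒≈ : ∀ {x y} → x ≡ y → x ≈ y
≡⇒≈ refl = ≈-refl

sum-cong : {f g : Vector ℝ n} → (∀ i → f i ≈ g i) → sum f ≈ sum g
sum-cong f≈g = ∑.sum-cong-≋ f≈g

sum-zero : {f : Vector ℝ n} → (∀ i → f i ≈ 0ℝ) → sum f ≈ 0ℝ
sum-zero {n} f≈0 = ≈-trans (sum-cong f≈0) (∑.sum-replicate-zero n)

sum-+ : (f g : Vector ℝ n) → sum (λ i → f i + g i) ≈ sum f + sum g
sum-+ f g = ∑.∑-distrib-+ f g

sum-*ˡ : ∀ c (f : Vector ℝ n) → sum (λ i → c * f i) ≈ c * sum f
sum-*ˡ c f = ≈-sym (∑.*-distribˡ-sum c f)

sum-*ʳ : ∀ c (f : Vector ℝ n) → sum (λ i → f i * c) ≈ sum f * c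
sum-*ʳ c f = ≈-sym (∑.*-distribʳ-sum c f)

sum-swap : (f : Fin m → Fin n → ℝ) → sum (λ i → sum (f i)) ≈ sum (λ j → sum (λ i → f i j))
sum-swap f = ∑.∑-comm f

sum-remove : ∀ i (f : Vector ℝ (suc n)) → sum f ≈ f i + sum (removeAt f i)
sum-remove i f = ∑.sum-remove {i = i} f

sum-single : ∀ i (f : Vector ℝ n) → (∀ j → j ≢ i → f j ≈ 0ℝ) → sum f ≈ f i
sum-single {suc n} i f f≈0 = ≈-trans (sum-remove i f)
  (≈-trans (+-cong ≈-refl (sum-zero λ j → f≈0 (punchIn i j) (Fin.punchInᵢ≢i i j))) (+-identityʳ (f i)))

sum-nonNeg : {f : Vector ℝ n} → (∀ i → NonNeg (f i)) → NonNeg (sum f)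
sum-nonNeg {zero}  f≥0 = zero⇒nonNeg ≈-refl
sum-nonNeg {suc n} f≥0 = nonNeg-+ (f≥0 zero) (sum-nonNeg (f≥0 ∘ suc))

sum-nonNeg≈0 : {f : Vector ℝ n} → (∀ i → NonNeg (f i)) → sum f ≈ 0ℝ → ∀ i → f i ≈ 0ℝ
sum-nonNeg≈0 {suc n} {f} f≥0 s≈0 zero    = nonNeg-+≈0 (f≥0 zero) (sum-nonNeg (f≥0 ∘ suc)) s≈0
sum-nonNeg≈0 {suc n} {f} f≥0 s≈0 (suc i) = sum-nonNeg≈0 (f≥0 ∘ suc)
  (nonNeg-+≈0 (sum-nonNeg (f≥0 ∘ suc)) (f≥0 zero) (≈-trans (+-comm (sum (f ∘ suc)) (f zero)) s≈0)) i

sum-pos : {f : Vector ℝ n} → (∀ i → NonNeg (f i)) → ∀ i → 0ℝ < f i → 0ℝ < sum f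
sum-pos {suc n} {f} f≥0 i fi>0 = pos-cong (≈-sym (sum-remove i f))
  (pos-+-nonNeg fi>0 (sum-nonNeg (λ j → f≥0 (punchIn i j))))

-- Linear algebra

Nonzero : Vector ℝ n → Set
Nonzero v = ∃[ i ] v i # 0ℝ

¬nonzero⇒≋0 : {v : Vector ℝ n} → ¬ Nonzero v → ∀ i → v i ≈ 0ℝ
¬nonzero⇒≋0 v≁0 i = ¬#⇒≈ λ vi#0 → v≁0 (i , vi#0)

infix 7 _·_

_·_ : Vector ℝ n → Vector ℝ n → ℝ
x · y = sum (λ i → x i * y i)

·-comm : (x y : Vector ℝ n) → x · y ≈ y · x
·-comm x y = sum-cong λ i → *-comm (x i) (y i)

·-cong : {x x′ y y′ : Vector ℝ n} → x ≋ x′ → y ≋ y′ → x · y ≈ x′ · y′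
·-cong x≋x′ y≋y′ = sum-cong λ i → *-cong (x≋x′ i) (y≋y′ i)

·-nonNeg : (x : Vector ℝ n) → NonNeg (x · x)
·-nonNeg x = sum-nonNeg λ i → nonNeg-square (x i)

square-pos : ∀ {x} → x # 0ℝ → 0ℝ < x * x
square-pos {x} x#0 = [ (λ p → pos-* p p) , (λ p → pos-cong (neg*neg x x) (pos-* p p)) ]′ (#⇒± x#0)

·-pos : {x : Vector ℝ n} → Nonzero x → 0ℝ < x · x
·-pos {x = x} (i , xi#0) = sum-pos (λ j → nonNeg-square (x j)) i (square-pos xi#0)

·≈0⇒≋0 : (x : Vector ℝ n) → x · x ≈ 0ℝ → ∀ i → x i ≈ 0ℝ
·≈0⇒≋0 x xx≈0 i = square≈0⇒≈0 (sum-nonNeg≈0 (λ j → nonNeg-square (x j)) xx≈0 i)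

combination-· : ∀ c (b : Fin m → Vector ℝ n) x → combination c b · x ≈ sum (λ k → c k * (b k · x))
combination-· c b x = begin
  sum (λ i → sum (λ k → c k * b k i) * x i)    ≈⟨ sum-cong (λ i → ≈-sym (sum-*ʳ (x i) (λ k → c k * b k i))) ⟩
  sum (λ i → sum (λ k → c k * b k i * x i))    ≈⟨ sum-swap (λ i k → c k * b k i * x i) ⟩
  sum (λ k → sum (λ i → c k * b k i * x i))    ≈⟨ sum-cong (λ k → sum-cong (λ i → *-assoc (c k) (b k i) (x i))) ⟩
  sum (λ k → sum (λ i → c k * (b k i * x i)))  ≈⟨ sum-cong (λ k → sum-*ˡ (c k) (λ i → b k i * x i)) ⟩
  sum (λ k → c k * (b k · x))                  ∎
  where open import Relation.Binary.Reasoning.Setoid setoid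

-- Gaussian elimination; the pivots are found only up to double negation.
dependence : ∀ (M : Fin m → Vector ℝ n) → n ℕ.< m →
  ¬ ¬ (∃[ c ] Nonzero c × combination c M ≋ (λ _ → 0ℝ))
dependence {suc m} {zero} M _ ¬dep = ¬dep ((λ _ → 1ℝ) , (zero , inj₂ 0<1) , λ ())
dependence {suc m} {suc n} M (s≤s n<m) ¬dep =
  -- The goal is absurdity, so the first column may be taken to vanish: by `pivot`, an entry apart
  -- from 0 would already yield a dependence. A relation among the remaining columns then suffices.
  dependence (λ i j → M i (suc j)) (ℕ.≤-trans n<m (ℕ.n≤1+n m)) λ (c , c#0 , rel) →
    ¬dep (c , c#0 , λ where
      zero    → sum-zero λ i → ≈-trans (*-congˡ (¬#⇒≈ (pivot i))) (zeroʳ (c i))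
      (suc j) → rel j)
  where
  open import Relation.Binary.Reasoning.Setoid setoid
  pivot : ∀ i → ¬ (M i zero # 0ℝ)
  pivot i p#0 = dependence R n<m λ (c′ , (k , c′k#0) , rel′) →
    let x = - sum (λ k → c′ k * M (punchIn i k) zero)
        c = insertAt (λ k → p * c′ k) i x
        expand : ∀ j → combination c M j ≈ x * M i j + sum (λ k → p * c′ k * M (punchIn i k) j)
        expand j = ≈-trans (sum-remove i (λ k → c k * M k j)) (+-cong
          (*-congʳ (≡⇒≈ (insertAt-lookup (λ k → p * c′ k) i x)))
          (sum-cong λ k → *-congʳ (≡⇒≈ (insertAt-punchIn (λ k → p * c′ k) i x k))))
    in ¬dep (c , (punchIn i k , #-cong (≡⇒≈ (sym (insertAt-punchIn (λ k → p * c′ k) i x k))) (#-* p#0 c′k#0)) , λ where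
      zero → begin
        combination c M zero                                       ≈⟨ expand zero ⟩
        x * p + sum (λ k → p * c′ k * M (punchIn i k) zero)        ≈⟨ +-cong ≈-refl (sum-cong λ k → *-assoc p (c′ k) (M (punchIn i k) zero)) ⟩
        x * p + sum (λ k → p * (c′ k * M (punchIn i k) zero))      ≈⟨ +-cong ≈-refl (sum-*ˡ p (λ k → c′ k * M (punchIn i k) zero)) ⟩
        x * p + p * sum (λ k → c′ k * M (punchIn i k) zero)        ≈⟨ cancel (sum λ k → c′ k * M (punchIn i k) zero) p ⟩
        0ℝ ∎
      (suc j) → begin
        combination c M (suc j)
          ≈⟨ expand (suc j) ⟩
        x * M i (suc j) + sum (λ k → p * c′ k * M (punchIn i k) (suc j))
          ≈⟨ +-cong (push (sum λ k → c′ k * M (punchIn i k) zero) (M i (suc j))) ≈-refl ⟩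
        sum (λ k → c′ k * M (punchIn i k) zero) * - M i (suc j) + sum (λ k → p * c′ k * M (punchIn i k) (suc j))
          ≈⟨ +-cong (≈-sym (sum-*ʳ (- M i (suc j)) (λ k → c′ k * M (punchIn i k) zero))) ≈-refl ⟩
        sum (λ k → c′ k * M (punchIn i k) zero * - M i (suc j)) + sum (λ k → p * c′ k * M (punchIn i k) (suc j))
          ≈⟨ ≈-sym (sum-+ (λ k → c′ k * M (punchIn i k) zero * - M i (suc j)) (λ k → p * c′ k * M (punchIn i k) (suc j))) ⟩
        sum (λ k → c′ k * M (punchIn i k) zero * - M i (suc j) + p * c′ k * M (punchIn i k) (suc j))
          ≈⟨ sum-cong (λ k → regroup (c′ k) (M (punchIn i k) zero) (M i (suc j)) p (M (punchIn i k) (suc j))) ⟩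
        sum (λ k → c′ k * R k j)
          ≈⟨ rel′ j ⟩
        0ℝ ∎)
    where
    p : ℝ
    p = M i zero
    -- Elimination without division: row k times the pivot p, minus its first entry times the pivot
    -- row. A relation c′ among these rows lifts to p c′ off the pivot row, and the coefficient x of
    -- the pivot row is chosen to cancel the first column.
    R : Fin m → Vector ℝ n
    R k j = p * M (punchIn i k) (suc j) + - (M (punchIn i k) zero * M i (suc j))
    cancel : ∀ s p → - s * p + p * s ≈ 0ℝ
    cancel s p = pointwise λ n → solve 2 (λ s p → :- s :* p :+ p :* s := con 0ℚ) refl (seq s n) (seq p n)
    push : ∀ s y → - s * y ≈ s * - y
    push s y = pointwise λ n → solve 2 (λ s y → :- s :* y := s :* :- y) refl (seq s n) (seq y n)
    regroup : ∀ c a b p d → c * a * - b + p * c * d ≈ c * (p * d + - (a * b))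
    regroup c a b p d = pointwise λ n → solve 5
      (λ c a b p d → c :* a :* :- b :+ p :* c :* d := c :* (p :* d :+ :- (a :* b))) refl
      (seq c n) (seq a n) (seq b n) (seq p n) (seq d n)

null-+ : ∀ {x y} → x ≈ 0ℝ → y ≈ 0ℝ → x + y ≈ 0ℝ
null-+ x≈0 y≈0 = ≈-trans (+-cong x≈0 y≈0) (+-identityˡ 0ℝ)

null-* : ∀ c {x} → x ≈ 0ℝ → c * x ≈ 0ℝ
null-* c x≈0 = ≈-trans (*-congˡ x≈0) (zeroʳ c)

-- Serves to prove equalities that follow from hypotheses: e is a combination of differences known
-- to vanish, and x ≈ y + e is a ring identity for the solver.
≈-modulo : ∀ {x y e} → x ≈ y + e → e ≈ 0ℝ → x ≈ y
≈-modulo {y = y} x≈y+e e≈0 = ≈-trans x≈y+e (≈-trans (+-cong ≈-refl e≈0) (+-identityʳ y))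

≈⇒-≈0 : ∀ {x y} → x ≈ y → x - y ≈ 0ℝ
≈⇒-≈0 {x} {y} x≈y = ≈-trans (+-cong x≈y ≈-refl) (-‿inverseʳ y)

-≈0⇒≈ : ∀ {x y} → x - y ≈ 0ℝ → x ≈ y
-≈0⇒≈ {x} {y} = ≈-modulo (pointwise λ n → solve 2 (λ x y → x := y :+ (x :- y)) refl (seq x n) (seq y n))

infixl 6 _⊕_

_⊕_ : Vector ℝ n → Vector ℝ n → Vector ℝ n
(x ⊕ y) i = x i + y i

*ᵥ-⊕ : ∀ (A : Matrix n) x y → A *ᵥ (x ⊕ y) ≋ A *ᵥ x ⊕ A *ᵥ y
*ᵥ-⊕ A x y i = ≈-trans
  (sum-cong λ j → pointwise λ n → ℚ.*-distribˡ-+ (seq (A i j) n) (seq (x j) n) (seq (y j) n))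
  (sum-+ (λ j → A i j * x j) (λ j → A i j * y j))

*ᵥ-∙ : ∀ (A : Matrix n) c x → A *ᵥ (c ∙ᵥ x) ≋ c ∙ᵥ (A *ᵥ x)
*ᵥ-∙ A c x i = ≈-trans (sum-cong λ j → *-leftSwap (A i j) c (x j)) (sum-*ˡ c (λ j → A i j * x j))

SelfAdjoint : Matrix n → Set
SelfAdjoint A = ∀ x y → (A *ᵥ x) · y ≈ x · (A *ᵥ y)

symmetric⇒selfAdjoint : (A : Matrix n) → (∀ i j → A i j ≈ A j i) → SelfAdjoint A
symmetric⇒selfAdjoint A A-sym x y = begin
  sum (λ i → sum (λ j → A i j * x j) * y i)    ≈⟨ sum-cong (λ i → ≈-sym (sum-*ʳ (y i) (λ j → A i j * x j))) ⟩
  sum (λ i → sum (λ j → A i j * x j * y i))    ≈⟨ sum-swap (λ i j → A i j * x j * y i) ⟩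
  sum (λ j → sum (λ i → A i j * x j * y i))    ≈⟨ sum-cong (λ j → sum-cong λ i → ≈-trans (*-congʳ (*-congʳ (A-sym i j))) (swap (A j i) (x j) (y i))) ⟩
  sum (λ j → sum (λ i → x j * (A j i * y i)))  ≈⟨ sum-cong (λ j → sum-*ˡ (x j) (λ i → A j i * y i)) ⟩
  sum (λ j → x j * (A *ᵥ y) j)                 ∎
  where
  open import Relation.Binary.Reasoning.Setoid setoid
  swap : ∀ a x y → a * x * y ≈ x * (a * y)
  swap a x y = pointwise λ n → solve 3 (λ a x y → a :* x :* y := x :* (a :* y)) refl (seq a n) (seq x n) (seq y n)

-- Invariant subspaces without eigenvectors

record InvariantSubspace (A : Matrix n) (S : Vector ℝ n → Set) : Set where
  field
    closed-⊕ : ∀ {x y} → S x → S y → S (x ⊕ y)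
    closed-∙ : ∀ c {x} → S x → S (c ∙ᵥ x)
    closed-A : ∀ {x} → S x → S (A *ᵥ x)

-- Polynomial relations between v, A v, A² v, … in an invariant subspace without
-- eigenvectors force v to vanish: a root of the polynomial splits off a linear
-- factor, and a quadratic with negative discriminant contradicts ⟨u,u⟩ ≥ 0.
module NoEigenvectors (A : Matrix n) (A-adj : SelfAdjoint A) {S : Vector ℝ n → Set}
  (S-inv : InvariantSubspace A S)
  (none : ¬ (∃[ μ ] ∃[ w ] Nonzero w × S w × Eigenspace A μ w)) where

  open InvariantSubspace S-inv

  eigen⇒≋0 : ∀ μ {w} → S w → Eigenspace A μ w → ∀ i → w i ≈ 0ℝ
  eigen⇒≋0 μ {w} w∈S eigen = ¬nonzero⇒≋0 λ w#0 → none (μ , w , w#0 , w∈S , eigen)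

  A² A³ : Vector ℝ n → Vector ℝ n
  A² v = A *ᵥ (A *ᵥ v)
  A³ v = A *ᵥ (A² v)

  *ᵥ-⊕-∙ : ∀ x c y i → (A *ᵥ (x ⊕ c ∙ᵥ y)) i ≈ (A *ᵥ x) i + c * (A *ᵥ y) i
  *ᵥ-⊕-∙ x c y i = ≈-trans (*ᵥ-⊕ A x (c ∙ᵥ y) i) (+-cong ≈-refl (*ᵥ-∙ A c y i))

  module Quadratic {v : Vector ℝ n} (v∈S : S v) (b c : ℝ)
    (relation : ∀ i → A² v i + (b * (A *ᵥ v) i + c * v i) ≈ 0ℝ) where

    -- With β = b / 2 the relation says (A + β)² v = D v, where D is a quarter of the discriminant;
    -- below, u = (A + β) v.
    β D : ℝ
    β = fromℚ ½ * b
    D = β * β - c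

    u : Vector ℝ n
    u = A *ᵥ v ⊕ β ∙ᵥ v

    u∈S : S u
    u∈S = closed-⊕ (closed-A v∈S) (closed-∙ β v∈S)

    complete-square : ∀ i → (A *ᵥ u) i + β * u i ≈ D * v i
    complete-square i = ≈-trans (+-cong (*ᵥ-⊕-∙ (A *ᵥ v) β v i) ≈-refl)
      (≈-modulo (identity b c (v i) ((A *ᵥ v) i) (A² v i)) (relation i))
      where
      identity : ∀ b c v₀ v₁ v₂ → let β = fromℚ ½ * b in
        (v₂ + β * v₁) + β * (v₁ + β * v₀) ≈ (β * β - c) * v₀ + (v₂ + (b * v₁ + c * v₀))
      identity b c v₀ v₁ v₂ = pointwise λ n → solve 5 (λ b c v₀ v₁ v₂ → let β = con ½ :* b in
        (v₂ :+ β :* v₁) :+ β :* (v₁ :+ β :* v₀) := (β :* β :- c) :* v₀ :+ (v₂ :+ (b :* v₁ :+ c :* v₀))) refl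
        (seq b n) (seq c n) (seq v₀ n) (seq v₁ n) (seq v₂ n)

    -- For s² = D the operator factors as (A + β - s)(A + β + s). Hence w = (A + β + s) v satisfies
    -- A w = (s - β) w and vanishes, which in turn makes v an eigenvector candidate for - s - β.
    D>0⇒≋0 : 0ℝ < D → ∀ i → v i ≈ 0ℝ
    D>0⇒≋0 D>0 = split (square-root D>0)
      where
      split : (∃[ s ] s * s ≈ D) → ∀ i → v i ≈ 0ℝ
      split (s , s²≈D) = eigen⇒≋0 (- s - β) v∈S λ i →
          ≈-modulo (identity₂ s β (v i) ((A *ᵥ v) i)) (w≋0 i)
        where
        w : Vector ℝ n
        w = u ⊕ s ∙ᵥ v
        identity₁ : ∀ s β d v₀ v₁ u₁ → let u = v₁ + β * v₀ in
          u₁ + s * v₁ ≈ (s - β) * (u + s * v₀) + ((u₁ + β * u - d * v₀) + (- v₀) * (s * s - d))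
        identity₁ s β d v₀ v₁ u₁ = pointwise λ n → solve 6 (λ s β d v₀ v₁ u₁ → let u = v₁ :+ β :* v₀ in
          u₁ :+ s :* v₁ := (s :- β) :* (u :+ s :* v₀) :+ ((u₁ :+ β :* u :- d :* v₀) :+ (:- v₀) :* (s :* s :- d))) refl
          (seq s n) (seq β n) (seq d n) (seq v₀ n) (seq v₁ n) (seq u₁ n)
        identity₂ : ∀ s β v₀ v₁ → v₁ ≈ (- s - β) * v₀ + ((v₁ + β * v₀) + s * v₀)
        identity₂ s β v₀ v₁ = pointwise λ n → solve 4 (λ s β v₀ v₁ →
          v₁ := (:- s :- β) :* v₀ :+ ((v₁ :+ β :* v₀) :+ s :* v₀)) refl (seq s n) (seq β n) (seq v₀ n) (seq v₁ n)
        w≋0 : ∀ i → w i ≈ 0ℝ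
        w≋0 = eigen⇒≋0 (s - β) (closed-⊕ u∈S (closed-∙ s v∈S)) λ i →
          ≈-trans (*ᵥ-⊕-∙ u s v i)
            (≈-modulo (identity₁ s β D (v i) ((A *ᵥ v) i) ((A *ᵥ u) i))
              (null-+ (≈⇒-≈0 (complete-square i)) (null-* (- v i) (≈⇒-≈0 s²≈D))))

    D≈0⇒≋0 : D ≈ 0ℝ → ∀ i → v i ≈ 0ℝ
    D≈0⇒≋0 D≈0 = eigen⇒≋0 (- β) v∈S λ i → ≈-modulo (identity β ((A *ᵥ v) i) (v i)) (u≋0 i)
      where
      identity : ∀ β x y → x ≈ - β * y + (x + β * y)
      identity β x y = pointwise λ n → solve 3 (λ β x y → x := :- β :* y :+ (x :+ β :* y)) refl (seq β n) (seq x n) (seq y n)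
      u≋0 : ∀ i → u i ≈ 0ℝ
      u≋0 = eigen⇒≋0 (- β) u∈S λ i → ≈-modulo (identity β ((A *ᵥ u) i) (u i))
        (≈-trans (complete-square i) (≈-trans (*-congʳ D≈0) (zeroˡ (v i))))

    -- A + β is self-adjoint, so ⟨u,u⟩ = ⟨v,(A + β)² v⟩.
    u·u≈D[v·v] : u · u ≈ D * (v · v)
    u·u≈D[v·v] = begin
      u · u                                        ≈⟨ sum-cong (λ i → distrib ((A *ᵥ v) i) β (v i) (u i)) ⟩
      sum (λ i → (A *ᵥ v) i * u i + v i * (β * u i)) ≈⟨ sum-+ (λ i → (A *ᵥ v) i * u i) (λ i → v i * (β * u i)) ⟩
      (A *ᵥ v) · u + v · (β ∙ᵥ u)                  ≈⟨ +-cong (A-adj v u) ≈-refl ⟩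
      v · (A *ᵥ u) + v · (β ∙ᵥ u)                  ≈⟨ ≈-sym (sum-+ (λ i → v i * (A *ᵥ u) i) (λ i → v i * (β * u i))) ⟩
      sum (λ i → v i * (A *ᵥ u) i + v i * (β * u i)) ≈⟨ sum-cong (λ i → collect (v i) ((A *ᵥ u) i) (β * u i)) ⟩
      sum (λ i → v i * ((A *ᵥ u) i + β * u i))     ≈⟨ sum-cong (λ i → *-congˡ (complete-square i)) ⟩
      sum (λ i → v i * (D * v i))                  ≈⟨ sum-cong (λ i → *-leftSwap (v i) D (v i)) ⟩
      sum (λ i → D * (v i * v i))                  ≈⟨ sum-*ˡ D (λ i → v i * v i) ⟩
      D * (v · v)                                  ∎
      where
      open import Relation.Binary.Reasoning.Setoid setoid
      distrib : ∀ x β y u → (x + β * y) * u ≈ x * u + y * (β * u)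
      distrib x β y u = pointwise λ n → solve 4 (λ x β y u → (x :+ β :* y) :* u := x :* u :+ y :* (β :* u)) refl
        (seq x n) (seq β n) (seq y n) (seq u n)
      collect : ∀ x y z → x * y + x * z ≈ x * (y + z)
      collect x y z = pointwise λ n → solve 3 (λ x y z → x :* y :+ x :* z := x :* (y :+ z)) refl (seq x n) (seq y n) (seq z n)

    D<0⇒≋0 : 0ℝ < - D → ∀ i → v i ≈ 0ℝ
    D<0⇒≋0 D<0 = ¬nonzero⇒≋0 λ v#0 → ·-nonNeg u
      (pos-cong (≈-trans (neg-*ˡ D (v · v)) (-‿cong (≈-sym u·u≈D[v·v]))) (pos-* D<0 (·-pos v#0)))

    quadratic⇒≋0 : ∀ i → v i ≈ 0ℝ
    quadratic⇒≋0 = ¬nonzero⇒≋0 λ (i , vi#0) → #⇒≉ vi#0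
      (D≈0⇒≋0 (tight (λ D>0 → #⇒≉ vi#0 (D>0⇒≋0 D>0 i)) (λ D<0 → #⇒≉ vi#0 (D<0⇒≋0 D<0 i))) i)

  open Quadratic using (quadratic⇒≋0)

  -- The quotient of the cubic by t - ρ is t² + (ρ + a) t + ((ρ + a) ρ + b), by Horner's scheme.
  -- Applied to v it gives w with A w = ρ w, so w vanishes, and this is a quadratic relation for v.
  cubic⇒≋0 : ∀ {v} → S v → ∀ a b c →
    (∀ i → A³ v i + (a * A² v i + (b * (A *ᵥ v) i + c * v i)) ≈ 0ℝ) → ∀ i → v i ≈ 0ℝ
  cubic⇒≋0 {v} v∈S a b c relation = split (cubic-root a b c)
    where
    split : (∃[ ρ ] cubic a b c ρ ≈ 0ℝ) → ∀ i → v i ≈ 0ℝ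
    split (ρ , root) = quadratic⇒≋0 v∈S (ρ + a) ((ρ + a) * ρ + b) λ i →
        ≈-trans (≈-sym (+-assoc (A² v i) _ _)) (w≋0 i)
      where
      w : Vector ℝ n
      w = (A² v ⊕ (ρ + a) ∙ᵥ (A *ᵥ v)) ⊕ ((ρ + a) * ρ + b) ∙ᵥ v
      identity : ∀ a b c ρ v₀ v₁ v₂ v₃ →
        (v₃ + (ρ + a) * v₂) + ((ρ + a) * ρ + b) * v₁ ≈
          ρ * ((v₂ + (ρ + a) * v₁) + ((ρ + a) * ρ + b) * v₀)
            + ((v₃ + (a * v₂ + (b * v₁ + c * v₀))) + (- v₀) * (((ρ + a) * ρ + b) * ρ + c))
      identity a b c ρ v₀ v₁ v₂ v₃ = pointwise λ n → solve 8 (λ a b c ρ v₀ v₁ v₂ v₃ →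
        (v₃ :+ (ρ :+ a) :* v₂) :+ ((ρ :+ a) :* ρ :+ b) :* v₁ :=
          ρ :* ((v₂ :+ (ρ :+ a) :* v₁) :+ ((ρ :+ a) :* ρ :+ b) :* v₀)
            :+ ((v₃ :+ (a :* v₂ :+ (b :* v₁ :+ c :* v₀))) :+ (:- v₀) :* (((ρ :+ a) :* ρ :+ b) :* ρ :+ c))) refl
        (seq a n) (seq b n) (seq c n) (seq ρ n) (seq v₀ n) (seq v₁ n) (seq v₂ n) (seq v₃ n)
      w≋0 : ∀ i → w i ≈ 0ℝ
      w≋0 = eigen⇒≋0 ρ (closed-⊕ (closed-⊕ (closed-A (closed-A v∈S)) (closed-∙ (ρ + a) (closed-A v∈S)))
                                 (closed-∙ ((ρ + a) * ρ + b) v∈S)) λ i →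
        ≈-trans (*ᵥ-⊕-∙ (A² v ⊕ (ρ + a) ∙ᵥ (A *ᵥ v)) ((ρ + a) * ρ + b) v i)
          (≈-trans (+-cong (*ᵥ-⊕-∙ (A² v) (ρ + a) (A *ᵥ v) i) ≈-refl)
            (≈-modulo (identity a b c ρ (v i) ((A *ᵥ v) i) (A² v i) (A³ v i))
              (null-+ (relation i) (null-* (- v i) root))))

ones : Vector ℝ n
ones _ = 1ℝ

module Dimension₄ (A : Matrix 4) (A-adj : SelfAdjoint A) {S : Vector ℝ 4 → Set}
  (S-inv : InvariantSubspace A S) (S⊥ones : ∀ {x} → S x → x · ones ≈ 0ℝ)
  (none : ¬ (∃[ μ ] ∃[ w ] Nonzero w × S w × Eigenspace A μ w)) where

  open InvariantSubspace S-inv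
  open NoEigenvectors A A-adj S-inv none

  module _ {v : Vector ℝ 4} (v∈S : S v) where

    powers : Fin 4 → Vector ℝ 4
    powers zero                   = v
    powers (suc zero)             = A *ᵥ v
    powers (suc (suc zero))       = A² v
    powers (suc (suc (suc zero))) = A³ v

    powers∈S : ∀ k → S (powers k)
    powers∈S zero                   = v∈S
    powers∈S (suc zero)             = closed-A v∈S
    powers∈S (suc (suc zero))       = closed-A (closed-A v∈S)
    powers∈S (suc (suc (suc zero))) = closed-A (closed-A (closed-A v∈S))

    -- A relation in the last three coordinates extends to the first one, as the
    -- coordinates of every member of S add up to 0.
    relation-extends : ∀ c → (∀ j → combination c powers (suc j) ≈ 0ℝ) → ∀ i → combination c powers i ≈ 0ℝ
    relation-extends c rel (suc j) = rel j
    relation-extends c rel zero    = begin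
      y zero                                         ≈⟨ ≈-sym (*-identityʳ (y zero)) ⟩
      y zero * 1ℝ                                    ≈⟨ ≈-sym (+-identityʳ (y zero * 1ℝ)) ⟩
      y zero * 1ℝ + 0ℝ                               ≈⟨ +-cong ≈-refl (≈-sym (sum-zero λ j → ≈-trans (*-congʳ (rel j)) (zeroˡ 1ℝ))) ⟩
      y · ones                                       ≈⟨ combination-· c powers ones ⟩
      sum (λ k → c k * (powers k · ones))            ≈⟨ sum-zero (λ k → null-* (c k) (S⊥ones (powers∈S k))) ⟩
      0ℝ                                             ∎
      where
      open import Relation.Binary.Reasoning.Setoid setoid
      y : Vector ℝ 4
      y = combination c powers

    module _ (c : Vector ℝ 4) (rel : ∀ i → combination c powers i ≈ 0ℝ) where

      c₀ c₁ c₂ c₃ : ℝ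
      c₀ = c zero
      c₁ = c (suc zero)
      c₂ = c (suc (suc zero))
      c₃ = c (suc (suc (suc zero)))

      -- Dividing by the leading coefficient makes the relation monic, of degree 3 here and of lower
      -- degree in the following lemmas. In degree 1 it is an eigenvector equation, in degree 0 it
      -- says that a multiple of v vanishes.
      leading₃ : c₃ # 0ℝ → ∀ i → v i ≈ 0ℝ
      leading₃ c₃#0 = let (r , c₃r≈1) = #-inverse c₃#0 in
        cubic⇒≋0 v∈S (r * c₂) (r * c₁) (r * c₀) λ i →
          ≈-trans (identity r c₀ c₁ c₂ c₃ (v i) ((A *ᵥ v) i) (A² v i) (A³ v i))
            (null-+ (null-* r (rel i)) (null-* (- A³ v i) (≈⇒-≈0 c₃r≈1)))
        where
        identity : ∀ r c₀ c₁ c₂ c₃ v₀ v₁ v₂ v₃ →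
          v₃ + (r * c₂ * v₂ + (r * c₁ * v₁ + r * c₀ * v₀)) ≈
            r * (c₀ * v₀ + (c₁ * v₁ + (c₂ * v₂ + (c₃ * v₃ + 0ℝ)))) + (- v₃) * (c₃ * r - 1ℝ)
        identity r c₀ c₁ c₂ c₃ v₀ v₁ v₂ v₃ = pointwise λ n → solve 9 (λ r c₀ c₁ c₂ c₃ v₀ v₁ v₂ v₃ →
          v₃ :+ (r :* c₂ :* v₂ :+ (r :* c₁ :* v₁ :+ r :* c₀ :* v₀)) :=
            r :* (c₀ :* v₀ :+ (c₁ :* v₁ :+ (c₂ :* v₂ :+ (c₃ :* v₃ :+ con 0ℚ)))) :+ (:- v₃) :* (c₃ :* r :- con 1ℚ)) refl
          (seq r n) (seq c₀ n) (seq c₁ n) (seq c₂ n) (seq c₃ n) (seq v₀ n) (seq v₁ n) (seq v₂ n) (seq v₃ n)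

      leading₂ : c₃ ≈ 0ℝ → c₂ # 0ℝ → ∀ i → v i ≈ 0ℝ
      leading₂ c₃≈0 c₂#0 = let (r , c₂r≈1) = #-inverse c₂#0 in
        Quadratic.quadratic⇒≋0 v∈S (r * c₁) (r * c₀) λ i →
          ≈-trans (identity r c₀ c₁ c₂ c₃ (v i) ((A *ᵥ v) i) (A² v i) (A³ v i))
            (null-+ (null-* r (rel i)) (null-+ (null-* (- A² v i) (≈⇒-≈0 c₂r≈1)) (null-* (- (r * A³ v i)) c₃≈0)))
        where
        identity : ∀ r c₀ c₁ c₂ c₃ v₀ v₁ v₂ v₃ →
          v₂ + (r * c₁ * v₁ + r * c₀ * v₀) ≈
            r * (c₀ * v₀ + (c₁ * v₁ + (c₂ * v₂ + (c₃ * v₃ + 0ℝ)))) + ((- v₂) * (c₂ * r - 1ℝ) + (- (r * v₃)) * c₃)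
        identity r c₀ c₁ c₂ c₃ v₀ v₁ v₂ v₃ = pointwise λ n → solve 9 (λ r c₀ c₁ c₂ c₃ v₀ v₁ v₂ v₃ →
          v₂ :+ (r :* c₁ :* v₁ :+ r :* c₀ :* v₀) :=
            r :* (c₀ :* v₀ :+ (c₁ :* v₁ :+ (c₂ :* v₂ :+ (c₃ :* v₃ :+ con 0ℚ))))
              :+ ((:- v₂) :* (c₂ :* r :- con 1ℚ) :+ (:- (r :* v₃)) :* c₃)) refl
          (seq r n) (seq c₀ n) (seq c₁ n) (seq c₂ n) (seq c₃ n) (seq v₀ n) (seq v₁ n) (seq v₂ n) (seq v₃ n)

      leading₁ : c₃ ≈ 0ℝ → c₂ ≈ 0ℝ → c₁ # 0ℝ → ∀ i → v i ≈ 0ℝ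
      leading₁ c₃≈0 c₂≈0 c₁#0 = let (r , c₁r≈1) = #-inverse c₁#0 in
        eigen⇒≋0 (- (r * c₀)) v∈S λ i →
          ≈-modulo (identity r c₀ c₁ c₂ c₃ (v i) ((A *ᵥ v) i) (A² v i) (A³ v i))
            (null-+ (null-* r (rel i)) (null-+ (null-* (- (A *ᵥ v) i) (≈⇒-≈0 c₁r≈1))
              (null-+ (null-* (- (r * A² v i)) c₂≈0) (null-* (- (r * A³ v i)) c₃≈0))))
        where
        identity : ∀ r c₀ c₁ c₂ c₃ v₀ v₁ v₂ v₃ →
          v₁ ≈ - (r * c₀) * v₀ + (r * (c₀ * v₀ + (c₁ * v₁ + (c₂ * v₂ + (c₃ * v₃ + 0ℝ))))
                 + ((- v₁) * (c₁ * r - 1ℝ) + ((- (r * v₂)) * c₂ + (- (r * v₃)) * c₃)))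
        identity r c₀ c₁ c₂ c₃ v₀ v₁ v₂ v₃ = pointwise λ n → solve 9 (λ r c₀ c₁ c₂ c₃ v₀ v₁ v₂ v₃ →
          v₁ := :- (r :* c₀) :* v₀ :+ (r :* (c₀ :* v₀ :+ (c₁ :* v₁ :+ (c₂ :* v₂ :+ (c₃ :* v₃ :+ con 0ℚ))))
                 :+ ((:- v₁) :* (c₁ :* r :- con 1ℚ) :+ ((:- (r :* v₂)) :* c₂ :+ (:- (r :* v₃)) :* c₃)))) refl
          (seq r n) (seq c₀ n) (seq c₁ n) (seq c₂ n) (seq c₃ n) (seq v₀ n) (seq v₁ n) (seq v₂ n) (seq v₃ n)

      leading₀ : c₃ ≈ 0ℝ → c₂ ≈ 0ℝ → c₁ ≈ 0ℝ → c₀ # 0ℝ → ∀ i → v i ≈ 0ℝ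
      leading₀ c₃≈0 c₂≈0 c₁≈0 c₀#0 i = *≈0⇒≈0 c₀#0
        (≈-trans (identity c₀ c₁ c₂ c₃ (v i) ((A *ᵥ v) i) (A² v i) (A³ v i))
          (null-+ (rel i) (null-+ (null-* (- (A *ᵥ v) i) c₁≈0)
            (null-+ (null-* (- A² v i) c₂≈0) (null-* (- A³ v i) c₃≈0)))))
        where
        identity : ∀ c₀ c₁ c₂ c₃ v₀ v₁ v₂ v₃ →
          v₀ * c₀ ≈ (c₀ * v₀ + (c₁ * v₁ + (c₂ * v₂ + (c₃ * v₃ + 0ℝ)))) + ((- v₁) * c₁ + ((- v₂) * c₂ + (- v₃) * c₃))
        identity c₀ c₁ c₂ c₃ v₀ v₁ v₂ v₃ = pointwise λ n → solve 8 (λ c₀ c₁ c₂ c₃ v₀ v₁ v₂ v₃ →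
          v₀ :* c₀ := (c₀ :* v₀ :+ (c₁ :* v₁ :+ (c₂ :* v₂ :+ (c₃ :* v₃ :+ con 0ℚ))))
                        :+ ((:- v₁) :* c₁ :+ ((:- v₂) :* c₂ :+ (:- v₃) :* c₃))) refl
          (seq c₀ n) (seq c₁ n) (seq c₂ n) (seq c₃ n) (seq v₀ n) (seq v₁ n) (seq v₂ n) (seq v₃ n)

      relation-trivial : Nonzero v → ∀ k → c k ≈ 0ℝ
      relation-trivial (i , vi#0) = λ where
          zero                   → c₀≈0
          (suc zero)             → c₁≈0
          (suc (suc zero))       → c₂≈0
          (suc (suc (suc zero))) → c₃≈0
        where
        c₃≈0 : c₃ ≈ 0ℝ
        c₃≈0 = ¬#⇒≈ λ p → #⇒≉ vi#0 (leading₃ p i)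
        c₂≈0 : c₂ ≈ 0ℝ
        c₂≈0 = ¬#⇒≈ λ p → #⇒≉ vi#0 (leading₂ c₃≈0 p i)
        c₁≈0 : c₁ ≈ 0ℝ
        c₁≈0 = ¬#⇒≈ λ p → #⇒≉ vi#0 (leading₁ c₃≈0 c₂≈0 p i)
        c₀≈0 : c₀ ≈ 0ℝ
        c₀≈0 = ¬#⇒≈ λ p → #⇒≉ vi#0 (leading₀ c₃≈0 c₂≈0 c₁≈0 p i)

    member⇒≋0 : ∀ i → v i ≈ 0ℝ
    member⇒≋0 = ¬nonzero⇒≋0 λ v#0 →
      dependence (λ k j → powers k (suc j)) ℕ.≤-refl λ (c , (k , ck#0) , rel) →
        #⇒≉ ck#0 (relation-trivial c (relation-extends c rel) v#0 k)

-- Eigenspaces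

Eigenspace-cong : ∀ (A : Matrix n) {μ ν v} → μ ≈ ν → Eigenspace A μ v → Eigenspace A ν v
Eigenspace-cong A {v = v} μ≈ν eigen i = ≈-trans (eigen i) (*-congʳ μ≈ν)

combination∈Eigenspace : ∀ (A : Matrix n) {μ} c (b : Fin m → Vector ℝ n) →
  (∀ k → Eigenspace A μ (b k)) → Eigenspace A μ (combination c b)
combination∈Eigenspace A {μ} c b b∈E i = begin
  A i · combination c b               ≈⟨ ·-comm (A i) (combination c b) ⟩
  combination c b · A i               ≈⟨ combination-· c b (A i) ⟩
  sum (λ k → c k * (b k · A i))       ≈⟨ sum-cong (λ k → *-congˡ {c k} (≈-trans (·-comm (b k) (A i)) (b∈E k i))) ⟩
  sum (λ k → c k * (μ * b k i))       ≈⟨ sum-cong (λ k → *-leftSwap (c k) μ (b k i)) ⟩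
  sum (λ k → μ * (c k * b k i))       ≈⟨ sum-*ˡ μ (λ k → c k * b k i) ⟩
  μ * combination c b i               ∎
  where
  open import Relation.Binary.Reasoning.Setoid setoid

·-∙ʳ : ∀ c (x y : Vector ℝ n) → x · (c ∙ᵥ y) ≈ c * (x · y)
·-∙ʳ c x y = ≈-trans (sum-cong λ i → *-leftSwap (x i) c (y i)) (sum-*ˡ c (λ i → x i * y i))

·-∙ˡ : ∀ c (x y : Vector ℝ n) → (c ∙ᵥ x) · y ≈ c * (x · y)
·-∙ˡ c x y = ≈-trans (sum-cong λ i → *-assoc c (x i) (y i)) (sum-*ˡ c (λ i → x i * y i))

·-⊕ˡ : (x y z : Vector ℝ n) → (x ⊕ y) · z ≈ x · z + y · z
·-⊕ˡ x y z = ≈-trans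
  (sum-cong λ i → pointwise λ n → ℚ.*-distribʳ-+ (seq (z i) n) (seq (x i) n) (seq (y i) n))
  (sum-+ (λ i → x i * z i) (λ i → y i * z i))

-- Kept as a product because either factor may be cancelled: μ - ν to obtain orthogonality, x · y to
-- identify two eigenvalues.
eigenvectors-· : ∀ (A : Matrix n) → SelfAdjoint A → ∀ {μ ν x y} →
  Eigenspace A μ x → Eigenspace A ν y → (x · y) * (μ - ν) ≈ 0ℝ
eigenvectors-· A A-adj {μ} {ν} {x} {y} x∈E y∈E = ≈-trans (identity (x · y) μ ν) (≈⇒-≈0 (begin
    μ * (x · y)      ≈⟨ ≈-sym (·-∙ˡ μ x y) ⟩
    (μ ∙ᵥ x) · y     ≈⟨ ·-cong {x = μ ∙ᵥ x} {A *ᵥ x} {y} {y} (λ i → ≈-sym (x∈E i)) (λ _ → ≈-refl) ⟩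
    (A *ᵥ x) · y     ≈⟨ A-adj x y ⟩
    x · (A *ᵥ y)     ≈⟨ ·-cong {x = x} {x} {A *ᵥ y} {ν ∙ᵥ y} (λ _ → ≈-refl) y∈E ⟩
    x · (ν ∙ᵥ y)     ≈⟨ ·-∙ʳ ν x y ⟩
    ν * (x · y)      ∎))
  where
  open import Relation.Binary.Reasoning.Setoid setoid
  identity : ∀ d μ ν → d * (μ - ν) ≈ μ * d - ν * d
  identity d μ ν = pointwise λ n → solve 3 (λ d μ ν → d :* (μ :- ν) := μ :* d :- ν :* d) refl (seq d n) (seq μ n) (seq ν n)

eigenvectors-orthogonal : ∀ (A : Matrix n) → SelfAdjoint A → ∀ {μ ν x y} → (μ - ν) # 0ℝ →
  Eigenspace A μ x → Eigenspace A ν y → x · y ≈ 0ℝ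
eigenvectors-orthogonal A A-adj {x = x} {y} μ#ν x∈E y∈E =
  *≈0⇒≈0 μ#ν (eigenvectors-· A A-adj {x = x} {y} x∈E y∈E)

increasing⇒apart : (f : Vector ℝ n) → (∀ i j → i Fin.< j → f i < f j) → ∀ {i j} → i ≢ j → (f i - f j) # 0ℝ
increasing⇒apart f increasing {i} {j} i≢j = by-case (Fin.<-cmp i j)
  where
  swap : ∀ x y → y - x ≈ - (x - y)
  swap x y = pointwise λ n → solve 2 (λ x y → y :- x := :- (x :- y)) refl (seq x n) (seq y n)
  by-case : Tri (i Fin.< j) (i ≡ j) (j Fin.< i) → (f i - f j) # 0ℝ
  by-case (tri< i<j _ _) = ±⇒# (inj₂ (pos-cong (swap (f i) (f j)) (<⇒pos (increasing i j i<j))))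
  by-case (tri≈ _ i≡j _) = contradiction i≡j i≢j
  by-case (tri> _ _ j<i) = ±⇒# (inj₁ (<⇒pos (increasing j i j<i)))

-- Families indexed by the blocks of a list of sizes

flatten : ∀ {X : Set} (ms : List ℕ) → (∀ i → Fin (lookup ms i) → X) → Vector X (total ms)
flatten []       F = λ ()
flatten (m ∷ ms) F = F zero ++ flatten ms (F ∘ suc)

blocks : ∀ {X : Set} (ms : List ℕ) → Vector X (total ms) → ∀ i → Fin (lookup ms i) → X
blocks (m ∷ ms) c zero    k = c (k ↑ˡ total ms)
blocks (m ∷ ms) c (suc i) k = blocks ms (c ∘ (m ↑ʳ_)) i k

split-all : ∀ m {n} (P : Fin (m ℕ.+ n) → Set) → (∀ k → P (k ↑ˡ n)) → (∀ k → P (m ↑ʳ k)) → ∀ t → P t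
split-all m {n} P left right t = subst P (Fin.join-splitAt m n t) (by-case (splitAt m t))
  where
  by-case : ∀ s → P (Fin.join m n s)
  by-case (inj₁ k) = left k
  by-case (inj₂ k) = right k

flatten-all : ∀ {X : Set} (P : X → Set) ms (F : ∀ i → Fin (lookup ms i) → X) →
              (∀ t → P (flatten ms F t)) → ∀ i k → P (F i k)
flatten-all P (m ∷ ms) F p zero    k =
  subst P (lookup-++ˡ (F zero) (flatten ms (F ∘ suc)) k) (p (k ↑ˡ total ms))
flatten-all P (m ∷ ms) F p (suc i) k = flatten-all P ms (F ∘ suc)
  (λ t → subst P (lookup-++ʳ (F zero) (flatten ms (F ∘ suc)) t) (p (m ↑ʳ t))) i k

blocks-all : ∀ {X : Set} (P : X → Set) ms (c : Vector X (total ms)) →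
             (∀ i k → P (blocks ms c i k)) → ∀ t → P (c t)
blocks-all P (m ∷ ms) c p = split-all m (P ∘ c) (p zero) (blocks-all P ms (c ∘ (m ↑ʳ_)) (p ∘ suc))

sum-split : ∀ m {n} (f : Vector ℝ (m ℕ.+ n)) → sum f ≈ sum (λ k → f (k ↑ˡ n)) + sum (λ k → f (m ↑ʳ k))
sum-split zero    f = ≈-sym (+-identityˡ (sum f))
sum-split (suc m) {n} f = ≈-trans (+-cong ≈-refl (sum-split m (f ∘ suc)))
  (≈-sym (+-assoc (f zero) (sum (λ k → f (suc k ↑ˡ n))) (sum (λ k → f (suc (m ↑ʳ k))))))

combination-flatten : ∀ ms (F : ∀ i → Fin (lookup ms i) → Vector ℝ n) c j →
  combination c (flatten ms F) j ≈ sum (λ i → combination (blocks ms c i) (F i) j)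
combination-flatten []       F c j = ≈-refl
combination-flatten (m ∷ ms) F c j = ≈-trans (sum-split m (λ t → c t * flatten (m ∷ ms) F t j)) (+-cong
  (sum-cong λ k → *-congˡ (≡⇒≈ (cong (λ x → x j) (lookup-++ˡ (F zero) (flatten ms (F ∘ suc)) k))))
  (≈-trans (sum-cong λ t → *-congˡ (≡⇒≈ (cong (λ x → x j) (lookup-++ʳ (F zero) (flatten ms (F ∘ suc)) t))))
    (combination-flatten ms (F ∘ suc) (c ∘ (m ↑ʳ_)) j)))

-- Laplacian matrices

module Laplacian {G : Graph (suc n)} {A : Matrix (suc n)} (A∈ : A ∈S-L G) where

  open _∈S-L_ A∈

  rowSum : ∀ i → sum (A i) ≈ 0ℝ
  rowSum i = begin
    sum (A i)                                    ≈⟨ sum-remove i (A i) ⟩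
    A i i + sum (removeAt (A i) i)               ≈⟨ +-cong (diagonal i) (sum-cong λ k → ≈-sym (≡⇒≈ (off k))) ⟩
    - sum f + sum (removeAt f i)                 ≈⟨ +-cong (-‿cong (≈-trans (sum-remove i f) (≈-trans (+-cong (≡⇒≈ on) ≈-refl) (+-identityˡ _)))) ≈-refl ⟩
    - sum (removeAt f i) + sum (removeAt f i)    ≈⟨ -‿inverseˡ (sum (removeAt f i)) ⟩
    0ℝ                                           ∎
    where
    open import Relation.Binary.Reasoning.Setoid setoid
    f : Vector ℝ (suc _)
    f k = if does (k Fin.≟ i) then 0ℝ else A i k
    on : f i ≡ 0ℝ
    on rewrite dec-true (i Fin.≟ i) refl = refl
    off : ∀ k → f (punchIn i k) ≡ A i (punchIn i k)
    off k rewrite dec-false (punchIn i k Fin.≟ i) (Fin.punchInᵢ≢i i k) = refl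

  self-adjoint : SelfAdjoint A
  self-adjoint = symmetric⇒selfAdjoint A symmetric

  ones∈kernel : Eigenspace A 0ℝ ones
  ones∈kernel i = ≈-trans (sum-cong λ j → *-identityʳ (A i j)) (≈-trans (rowSum i) (≈-sym (zeroˡ 1ℝ)))

  module _ (y : Vector ℝ (suc n)) where

    energy : Fin (suc n) → Fin (suc n) → ℝ
    energy i j = - A i j * ((y i - y j) * (y i - y j))

    energy-nonNeg : ∀ i j → NonNeg (energy i j)
    energy-nonNeg i j = by-case (i Fin.≟ j) (adj? G i j)
      where
      square≥0 : NonNeg ((y i - y j) * (y i - y j))
      square≥0 = nonNeg-square (y i - y j)
      by-case : Dec (i ≡ j) → Dec (Adj G i j) → NonNeg (energy i j)
      -- The diagonal weight - A i i may have the wrong sign, but the squared difference is 0.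
      by-case (yes refl) _ = zero⇒nonNeg (null-* (- A i i) (≈-trans (*-congˡ (-‿inverseʳ (y i))) (zeroʳ _)))
      by-case (no i≢j) (yes adj) = nonNeg-* (pos-asym (pos-cong (+-identityˡ (- A i j)) (<⇒pos (edge i j adj)))) square≥0
      by-case (no i≢j) (no ¬adj) = nonNeg-* (zero⇒nonNeg (≈-trans (-‿cong (nonEdge i j i≢j ¬adj)) -0≈0)) square≥0

    -- After expanding the square, the terms in yᵢ² and yⱼ² carry row and column sums of A, which
    -- vanish. Each edge is counted in both directions, hence twice the quadratic form.
    total-energy : sum (λ i → sum (energy i)) ≈ y · (A *ᵥ y) + y · (A *ᵥ y)
    total-energy = begin
      sum (λ i → sum (energy i))
        ≈⟨ sum-cong (λ i → sum-cong λ j → expand (A i j) (y i) (y j)) ⟩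
      sum (λ i → sum (λ j → (- (y i * y i) * A i j + - (y j * y j) * A i j) + (y i + y i) * (A i j * y j)))
        ≈⟨ sum-cong (λ i → ≈-trans (sum-+ (λ j → - (y i * y i) * A i j + - (y j * y j) * A i j) (λ j → (y i + y i) * (A i j * y j)))
             (+-cong (sum-+ (λ j → - (y i * y i) * A i j) (λ j → - (y j * y j) * A i j)) (sum-*ˡ (y i + y i) (λ j → A i j * y j)))) ⟩
      sum (λ i → (sum (λ j → - (y i * y i) * A i j) + sum (λ j → - (y j * y j) * A i j)) + (y i + y i) * (A *ᵥ y) i)
        ≈⟨ ≈-trans (sum-+ (λ i → sum (λ j → - (y i * y i) * A i j) + sum (λ j → - (y j * y j) * A i j)) (λ i → (y i + y i) * (A *ᵥ y) i))
             (+-cong (sum-+ (λ i → sum (λ j → - (y i * y i) * A i j)) (λ i → sum (λ j → - (y j * y j) * A i j))) ≈-refl) ⟩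
      (sum (λ i → sum (λ j → - (y i * y i) * A i j)) + sum (λ i → sum (λ j → - (y j * y j) * A i j)))
        + sum (λ i → (y i + y i) * (A *ᵥ y) i)
        ≈⟨ +-cong (null-+ rows≈0 columns≈0) (≈-trans (sum-cong λ i → double (y i) ((A *ᵥ y) i)) (sum-+ (λ i → y i * (A *ᵥ y) i) (λ i → y i * (A *ᵥ y) i))) ⟩
      0ℝ + (y · (A *ᵥ y) + y · (A *ᵥ y))
        ≈⟨ +-identityˡ (y · (A *ᵥ y) + y · (A *ᵥ y)) ⟩
      y · (A *ᵥ y) + y · (A *ᵥ y) ∎
      where
      open import Relation.Binary.Reasoning.Setoid setoid
      expand : ∀ a p q → - a * ((p - q) * (p - q)) ≈ (- (p * p) * a + - (q * q) * a) + (p + p) * (a * q)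
      expand a p q = pointwise λ n → solve 3 (λ a p q → :- a :* ((p :- q) :* (p :- q)) :=
        (:- (p :* p) :* a :+ :- (q :* q) :* a) :+ (p :+ p) :* (a :* q)) refl (seq a n) (seq p n) (seq q n)
      double : ∀ p z → (p + p) * z ≈ p * z + p * z
      double p z = pointwise λ n → solve 2 (λ p z → (p :+ p) :* z := p :* z :+ p :* z) refl (seq p n) (seq z n)
      rows≈0 : sum (λ i → sum (λ j → - (y i * y i) * A i j)) ≈ 0ℝ
      rows≈0 = sum-zero λ i → ≈-trans (sum-*ˡ (- (y i * y i)) (A i)) (null-* (- (y i * y i)) (rowSum i))
      columns≈0 : sum (λ i → sum (λ j → - (y j * y j) * A i j)) ≈ 0ℝ
      columns≈0 = ≈-trans (sum-swap (λ i j → - (y j * y j) * A i j)) (sum-zero λ j →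
        ≈-trans (sum-cong λ i → *-congˡ { - (y j * y j)} (symmetric i j))
          (≈-trans (sum-*ˡ (- (y j * y j)) (A j)) (null-* (- (y j * y j)) (rowSum j))))

    eigen-energy : ∀ {μ} → Eigenspace A μ y → sum (λ i → sum (energy i)) ≈ μ * (y · y) + μ * (y · y)
    eigen-energy {μ} y∈E = ≈-trans total-energy (+-cong y·Ay y·Ay)
      where
      y·Ay : y · (A *ᵥ y) ≈ μ * (y · y)
      y·Ay = ≈-trans (·-cong {x = y} {y} {A *ᵥ y} {μ ∙ᵥ y} (λ _ → ≈-refl) y∈E) (·-∙ʳ μ y y)

    nonNeg-eigenvalue : ∀ {μ} → Nonzero y → Eigenspace A μ y → NonNeg μ
    nonNeg-eigenvalue {μ} y#0 y∈E μ<0 = sum-nonNeg (λ i → sum-nonNeg (energy-nonNeg i))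
      (pos-cong (≈-sym (≈-trans (-‿cong (eigen-energy y∈E)) (negate μ (y · y)))) (pos-+ (pos-* μ<0 yy>0) (pos-* μ<0 yy>0)))
      where
      yy>0 : 0ℝ < y · y
      yy>0 = ·-pos y#0
      negate : ∀ μ s → - (μ * s + μ * s) ≈ - μ * s + - μ * s
      negate μ s = pointwise λ n → solve 2 (λ μ s → :- (μ :* s :+ μ :* s) := :- μ :* s :+ :- μ :* s) refl (seq μ n) (seq s n)

    -- The energy of a kernel vector is 0, so each of its nonnegative terms vanishes, and on an edge
    -- the weight is positive.
    kernel-constant : Eigenspace A 0ℝ y → ∀ i j → Adj G i j → y i ≈ y j
    kernel-constant y∈E i j adj = -≈0⇒≈ (square≈0⇒≈0 (*≈0⇒≈0
        (inj₂ (pos-cong (+-identityˡ (- A i j)) (<⇒pos (edge i j adj))))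
        (≈-trans (*-comm ((y i - y j) * (y i - y j)) (- A i j))
          (sum-nonNeg≈0 (energy-nonNeg i) (sum-nonNeg≈0 (λ i → sum-nonNeg (energy-nonNeg i)) total≈0 i) j))))
      where
      total≈0 : sum (λ i → sum (energy i)) ≈ 0ℝ
      total≈0 = ≈-trans (eigen-energy y∈E) (null-+ (zeroˡ (y · y)) (zeroˡ (y · y)))

-- Multiplicities of a Laplacian matrix of order 4

module Spectrum {G : Graph 4} {A : Matrix 4} {ms : List ℕ} (A∈ : A ∈S-L G)
  (list : IsOrderedMultiplicityList A ms) where

  open Laplacian A∈
  open IsOrderedMultiplicityList list renaming (eigenvalue to eig)

  E : Fin (length ms) → Vector ℝ 4 → Set
  E i = Eigenspace A (eig i)

  basis : ∀ i → Fin (lookup ms i) → Vector ℝ 4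
  basis i = proj₁ (multiplicity i)

  module Basis i = IsBasis (proj₂ (multiplicity i))

  eigenvector : ∀ i → ∃[ v ] Nonzero v × E i v
  eigenvector i = Equivalence.from (spectrum (eig i)) (i , ≈-refl)

  locate : ∀ {μ w} → Nonzero w → Eigenspace A μ w → ∃[ i ] μ ≈ eig i
  locate {μ} {w} w#0 w∈E = Equivalence.to (spectrum μ) (w , w#0 , w∈E)

  E⊥ : ∀ i {x} → (∀ k → x · basis i k ≈ 0ℝ) → ∀ {w} → E i w → x · w ≈ 0ℝ
  E⊥ i {x} x⊥ {w} w∈E = let (c , w≋) = Basis.spanning i w w∈E in begin
    x · w                                    ≈⟨ ·-cong {x = x} {x} {w} {combination c (basis i)} (λ _ → ≈-refl) w≋ ⟩
    x · combination c (basis i)              ≈⟨ ·-comm x (combination c (basis i)) ⟩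
    combination c (basis i) · x              ≈⟨ combination-· c (basis i) x ⟩
    sum (λ k → c k * (basis i k · x))        ≈⟨ sum-zero (λ k → null-* (c k) (≈-trans (·-comm (basis i k) x) (x⊥ k))) ⟩
    0ℝ                                       ∎
    where open import Relation.Binary.Reasoning.Setoid setoid

  eig-apart : ∀ {i j} → i ≢ j → (eig i - eig j) # 0ℝ
  eig-apart = increasing⇒apart eig increasing

  E-orthogonal : ∀ {i j x y} → i ≢ j → E i x → E j y → x · y ≈ 0ℝ
  E-orthogonal {i} {j} i≢j = eigenvectors-orthogonal A self-adjoint (eig-apart i≢j)

  -- A listed value has a nonzero eigenvector, which an empty basis cannot span.
  multiplicity≢0 : ∀ i → lookup ms i ≢ 0
  multiplicity≢0 i m≡0 = let (v , (j , vj#0) , v∈E) = eigenvector i ; (c , v≋) = Basis.spanning i v v∈E in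
    #⇒≉ vj#0 (≈-trans (v≋ j) (empty-sum m≡0 (λ k → c k * basis i k j)))
    where
    empty-sum : ∀ {m} → m ≡ 0 → (f : Vector ℝ m) → sum f ≈ 0ℝ
    empty-sum refl f = ≈-refl

  -- The vectors orthogonal to all eigenvectors form an invariant subspace
  -- without eigenvectors.
  total≮4 : ¬ (total ms ℕ.< 4)
  -- The basis vectors are taken as columns: a relation among the four rows, whose length is below
  -- 4, is a vector x orthogonal to all of them.
  total≮4 N<4 = dependence (λ i t → flatten ms basis t i) N<4 λ (x , (i , xi#0) , rel) →
      #⇒≉ xi#0 (member⇒≋0 {x} (flatten-all (λ w → x · w ≈ 0ℝ) ms basis rel) i)
    where
    S : Vector ℝ 4 → Set
    S x = ∀ i k → x · basis i k ≈ 0ℝ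
    S-inv : InvariantSubspace A S
    S-inv = record
      { closed-⊕ = λ {x} {y} x⊥ y⊥ i k → ≈-trans (·-⊕ˡ x y (basis i k)) (null-+ (x⊥ i k) (y⊥ i k))
      ; closed-∙ = λ c {x} x⊥ i k → ≈-trans (·-∙ˡ c x (basis i k)) (null-* c (x⊥ i k))
      ; closed-A = λ {x} x⊥ i k → ≈-trans (self-adjoint x (basis i k))
          (≈-trans (·-cong {x = x} {x} {A *ᵥ basis i k} {eig i ∙ᵥ basis i k} (λ _ → ≈-refl) (Basis.members i k))
            (≈-trans (·-∙ʳ (eig i) x (basis i k)) (null-* (eig i) (x⊥ i k)))) }
    S⊥E : ∀ {x μ w} → S x → Nonzero w → Eigenspace A μ w → x · w ≈ 0ℝ
    S⊥E {x} {μ} {w} x∈S w#0 w∈E = let (i , μ≈) = locate w#0 w∈E in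
      E⊥ i {x} (x∈S i) {w} (Eigenspace-cong A {v = w} μ≈ w∈E)
    open Dimension₄ A self-adjoint S-inv
      (λ {x} x∈S → S⊥E {x} x∈S (zero , inj₂ 0<1) ones∈kernel)
      (λ (μ , w , (i , wi#0) , w∈S , w∈E) → #⇒≉ wi#0 (·≈0⇒≋0 w (S⊥E {w} w∈S (i , wi#0) w∈E) i))

  -- A relation among all basis vectors collects into eigenvectors xᵢ, one for each eigenvalue, with
  -- sum 0. Pairing the sum with xᵢ leaves ⟨xᵢ,xᵢ⟩ = 0, and then the coefficients in each block
  -- vanish by independence.
  total≯4 : ¬ (4 ℕ.< total ms)
  total≯4 N>4 = dependence (flatten ms basis) N>4 λ (c , (t , ct#0) , rel) →
      #⇒≉ ct#0 (blocks-all (_≈ 0ℝ) ms c (λ i → Basis.independent i (blocks ms c i) (component≋0 c rel i)) t)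
    where
    component≋0 : ∀ c → (∀ j → combination c (flatten ms basis) j ≈ 0ℝ) → ∀ i j →
                  combination (blocks ms c i) (basis i) j ≈ 0ℝ
    component≋0 c rel i = ·≈0⇒≋0 (x i) (begin
        x i · x i                                ≈⟨ ≈-sym (sum-single i (λ k → x k · x i) λ k k≢i → E-orthogonal k≢i (x∈E k) (x∈E i)) ⟩
        sum (λ k → x k · x i)                    ≈⟨ sum-swap (λ k j → x k j * x i j) ⟩
        sum (λ j → sum (λ k → x k j * x i j))    ≈⟨ sum-cong (λ j → sum-*ʳ (x i j) (λ k → x k j)) ⟩
        sum (λ j → sum (λ k → x k j) * x i j)    ≈⟨ sum-zero (λ j → ≈-trans (*-congʳ (≈-trans (≈-sym (combination-flatten ms basis c j)) (rel j))) (zeroˡ (x i j))) ⟩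
        0ℝ                                       ∎)
      where
      open import Relation.Binary.Reasoning.Setoid setoid
      x : Fin (length ms) → Vector ℝ 4
      x i = combination (blocks ms c i) (basis i)
      x∈E : ∀ i → E i (x i)
      x∈E i = combination∈Eigenspace A (blocks ms c i) (basis i) (Basis.members i)

  total≡4 : total ms ≡ 4
  total≡4 = ℕ.≤-antisym (ℕ.≮⇒≥ total≯4) (ℕ.≮⇒≥ total≮4)

  -- More than r basis vectors become dependent when restricted to r coordinates; the same relation
  -- on the full vectors gives a nontrivial combination that vanishes at these coordinates.
  vanishing-at : ∀ {r} i (coords : Fin r → Fin 4) → r ℕ.< lookup ms i →
    ¬ (∀ y → E i y → (∀ k → y (coords k) ≈ 0ℝ) → ∀ j → y j ≈ 0ℝ)
  vanishing-at i coords r<m all≋0 = dependence (λ k l → basis i k (coords l)) r<m λ (c , (k , ck#0) , rel) →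
    #⇒≉ ck#0 (Basis.independent i c (all≋0 (combination c (basis i))
      (combination∈Eigenspace A c (basis i) (Basis.members i)) rel) k)

-- Necessary conditions for K₄ minus an edge

OtherVertices : Fin 4 → Fin 4 → Fin 4 → Fin 4 → Set
OtherVertices u v w x = w ≢ u × w ≢ v × x ≢ u × x ≢ v × (∀ i → i ≡ u ⊎ i ≡ v ⊎ i ≡ w ⊎ i ≡ x)

otherVertices? : Dec (∀ u v → u ≢ v → ∃[ w ] ∃[ x ] OtherVertices u v w x)
otherVertices? = Fin.all? λ u → Fin.all? λ v → ¬? (u Fin.≟ v) →-dec Fin.any? λ w → Fin.any? λ x →
  ¬? (w Fin.≟ u) ×-dec ¬? (w Fin.≟ v) ×-dec ¬? (x Fin.≟ u) ×-dec ¬? (x Fin.≟ v) ×-dec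
  Fin.all? λ i → (i Fin.≟ u) ⊎-dec (i Fin.≟ v) ⊎-dec (i Fin.≟ w) ⊎-dec (i Fin.≟ x)

abstract
  otherVertices : ∀ u v → u ≢ v → ∃[ w ] ∃[ x ] OtherVertices u v w x
  otherVertices = toWitness {a? = otherVertices?} _

attainable : List (List ℕ)
attainable = (1 ∷ 1 ∷ 1 ∷ 1 ∷ []) ∷ (1 ∷ 1 ∷ 2 ∷ []) ∷ (1 ∷ 2 ∷ 1 ∷ []) ∷ []

module DeletedEdge (u v : Fin 4) (u≢v : u ≢ v) {A : Matrix 4} {ms : List ℕ}
  (A∈ : A ∈S-L deleteEdge (complete 4) u v) (list : IsOrderedMultiplicityList A ms) where

  G : Graph 4
  G = deleteEdge (complete 4) u v

  open _∈S-L_ A∈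
  open Laplacian A∈
  open Spectrum A∈ list
  open IsOrderedMultiplicityList list renaming (eigenvalue to eig)

  w x : Fin 4
  w = proj₁ (otherVertices u v u≢v)
  x = proj₁ (proj₂ (otherVertices u v u≢v))

  others : OtherVertices u v w x
  others = proj₂ (proj₂ (otherVertices u v u≢v))

  w≢u : w ≢ u
  w≢u = proj₁ others
  w≢v : w ≢ v
  w≢v = proj₁ (proj₂ others)
  x≢u : x ≢ u
  x≢u = proj₁ (proj₂ (proj₂ others))
  x≢v : x ≢ v
  x≢v = proj₁ (proj₂ (proj₂ (proj₂ others)))

  vertex-cases : (P : Fin 4 → Set) → P u → P v → P w → P x → ∀ i → P i
  vertex-cases P pu pv pw px i =
    [ at pu , [ at pv , [ at pw , at px ]′ ]′ ]′ (proj₂ (proj₂ (proj₂ (proj₂ others))) i)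
    where
    at : ∀ {i j} → P j → i ≡ j → P i
    at p refl = p

  adjacent : ∀ {i j} → i ≢ j → j ≢ u → j ≢ v → Adj G i j
  adjacent i≢j j≢u j≢v = i≢j , [ j≢v ∘ proj₂ , j≢u ∘ proj₂ ]′

  Auv≈0 : A u v ≈ 0ℝ
  Auv≈0 = nonEdge u v u≢v λ (_ , ¬uv) → ¬uv (inj₁ (refl , refl))

  -- Kernel vectors are constant along edges; v, not adjacent to u, is reached through w.
  kernel-vanishing : ∀ y → Eigenspace A 0ℝ y → y u ≈ 0ℝ → ∀ i → y i ≈ 0ℝ
  kernel-vanishing y y∈E yu≈0 = vertex-cases (λ i → y i ≈ 0ℝ) yu≈0
      (≈-trans (kernel-constant y y∈E v w (adjacent (w≢v ∘ sym) w≢u w≢v)) yw≈0) yw≈0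
      (≈-trans (≈-sym (kernel-constant y y∈E u x (adjacent (x≢u ∘ sym) x≢u x≢v))) yu≈0)
    where
    yw≈0 : y w ≈ 0ℝ
    yw≈0 = ≈-trans (≈-sym (kernel-constant y y∈E u w (adjacent (w≢u ∘ sym) w≢u w≢v))) yu≈0

  eigenvalues-nonNeg : ∀ i → NonNeg (eig i)
  eigenvalues-nonNeg i = let (y , y#0 , y∈E) = eigenvector i in nonNeg-eigenvalue y y#0 y∈E

  zero-eigenvalue : ∃[ i ] 0ℝ ≈ eig i
  zero-eigenvalue = locate {0ℝ} {ones} (zero , inj₂ 0<1) ones∈kernel

  -- As `ones` lies in the kernel, 0 is among the listed values, so the least of them cannot be
  -- positive; by the energy form it is not negative either.
  least-eigenvalue : ∀ i → (∀ j → i ≢ j → i Fin.< j) → eig i ≈ 0ℝ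
  least-eigenvalue i least = by-case zero-eigenvalue
    where
    by-case : (∃[ j ] 0ℝ ≈ eig j) → eig i ≈ 0ℝ
    by-case (j , 0≈) = tight (positive (i Fin.≟ j)) (eigenvalues-nonNeg i)
      where
      positive : Dec (i ≡ j) → ¬ (0ℝ < eig i)
      positive (yes refl) p = zero⇒≯0 (≈-sym 0≈) p
      positive (no i≢j)   p = zero⇒≯0 (≈-trans (cancel (eig j) (eig i)) (≈-sym 0≈))
        (pos-+ (<⇒pos (increasing i j (least j i≢j))) p)
        where
        cancel : ∀ a b → (a - b) + b ≈ a
        cancel a b = pointwise λ n → solve 2 (λ a b → (a :- b) :+ b := a) refl (seq a n) (seq b n)

  first-simple : ∀ i → (∀ j → i ≢ j → i Fin.< j) → ¬ (1 ℕ.< lookup ms i)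
  first-simple i least 1<m = vanishing-at {1} i (λ _ → u) 1<m λ y y∈E yu≈0 →
    kernel-vanishing y (Eigenspace-cong A {v = y} (least-eigenvalue i least) y∈E) (yu≈0 zero)

  E⊥ones : ∀ i j → (∀ k → i ≢ k → i Fin.< k) → i ≢ j → ∀ y → E j y → y · ones ≈ 0ℝ
  E⊥ones i j least i≢j y y∈E = E-orthogonal (i≢j ∘ sym) y∈E
    (Eigenspace-cong A {v = ones} (≈-sym (least-eigenvalue i least)) ones∈kernel)

  -- In a three-dimensional eigenspace orthogonal to ones some y ≠ 0 vanishes at
  -- u and w; row u of A y = μ y then reads A u x * y x = 0.
  no-triple : ∀ i j → (∀ k → i ≢ k → i Fin.< k) → i ≢ j → ¬ (2 ℕ.< lookup ms j)
  no-triple i j least i≢j 2<m = vanishing-at j coords 2<m λ y y∈E y≈0 → vanishes y y∈E (y≈0 zero) (y≈0 (suc zero))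
    where
    coords : Fin 2 → Fin 4
    coords zero    = u
    coords (suc _) = w
    vanishes : ∀ y → E j y → y u ≈ 0ℝ → y w ≈ 0ℝ → ∀ k → y k ≈ 0ℝ
    vanishes y y∈E yu≈0 yw≈0 = vertex-cases (λ k → y k ≈ 0ℝ) yu≈0 yv≈0 yw≈0 yx≈0
      where
      row-u : ∀ k → k ≢ x → A u k * y k ≈ 0ℝ
      row-u = vertex-cases (λ k → k ≢ x → A u k * y k ≈ 0ℝ)
        (λ _ → null-* (A u u) yu≈0)
        (λ _ → ≈-trans (*-congʳ Auv≈0) (zeroˡ (y v)))
        (λ _ → null-* (A u w) yw≈0)
        (λ x≢x → contradiction refl x≢x)
      yx≈0 : y x ≈ 0ℝ
      yx≈0 = *≈0⇒≈0 (inj₁ (edge u x (adjacent (x≢u ∘ sym) x≢u x≢v)))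
        (≈-trans (*-comm (y x) (A u x)) (≈-trans (≈-sym (sum-single x (λ k → A u k * y k) row-u))
          (≈-trans (y∈E u) (null-* (eig j) yu≈0))))
      off-v : ∀ k → k ≢ v → y k * 1ℝ ≈ 0ℝ
      off-v = vertex-cases (λ k → k ≢ v → y k * 1ℝ ≈ 0ℝ)
        (λ _ → ≈-trans (*-congʳ yu≈0) (zeroˡ 1ℝ))
        (λ v≢v → contradiction refl v≢v)
        (λ _ → ≈-trans (*-congʳ yw≈0) (zeroˡ 1ℝ))
        (λ _ → ≈-trans (*-congʳ yx≈0) (zeroˡ 1ℝ))
      yv≈0 : y v ≈ 0ℝ
      yv≈0 = ≈-trans (≈-sym (*-identityʳ (y v)))
        (≈-trans (≈-sym (sum-single v (λ k → y k * 1ℝ) off-v)) (E⊥ones i j least i≢j y y∈E))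

zero-least : ∀ {n} (j : Fin (suc n)) → zero ≢ j → zero {n} Fin.< j
zero-least zero    0≢0 = contradiction refl 0≢0
zero-least (suc j) _   = s≤s z≤n

-- What follows the simple eigenvalue 0 is a composition of 3 into parts 1 and 2: 1+1+1, 1+2 or 2+1.
sum-3 : ∀ ms → total ms ≡ 3 → (∀ i → lookup ms i ≢ 0) → (∀ i → ¬ (2 ℕ.< lookup ms i)) → (1 ∷ ms) ∈ attainable
sum-3 (0 ∷ _) _ ≢0 _ = contradiction refl (≢0 zero)
sum-3 (1 ∷ 0 ∷ _) _ ≢0 _ = contradiction refl (≢0 (suc zero))
sum-3 (1 ∷ 1 ∷ 0 ∷ _) _ ≢0 _ = contradiction refl (≢0 (suc (suc zero)))
sum-3 (1 ∷ 1 ∷ 1 ∷ []) _ _ _ = here refl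
sum-3 (1 ∷ 1 ∷ 1 ∷ 0 ∷ _) _ ≢0 _ = contradiction refl (≢0 (suc (suc (suc zero))))
sum-3 (1 ∷ 2 ∷ []) _ _ _ = there (here refl)
sum-3 (1 ∷ 2 ∷ 0 ∷ _) _ ≢0 _ = contradiction refl (≢0 (suc (suc zero)))
sum-3 (2 ∷ 0 ∷ _) _ ≢0 _ = contradiction refl (≢0 (suc zero))
sum-3 (2 ∷ 1 ∷ []) _ _ _ = there (there (here refl))
sum-3 (2 ∷ 1 ∷ 0 ∷ _) _ ≢0 _ = contradiction refl (≢0 (suc (suc zero)))
sum-3 (suc (suc (suc m)) ∷ _) _ _ ≯2 = contradiction (s≤s (s≤s (s≤s z≤n))) (≯2 zero)

attained⇒attainable : ∀ u v → u ≢ v → ∀ ms → Attains (deleteEdge (complete 4) u v) ms → ms ∈ attainable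
attained⇒attainable u v u≢v [] (A , A∈ , list) = contradiction (Spectrum.total≡4 A∈ list) λ ()
attained⇒attainable u v u≢v (0 ∷ ms) (A , A∈ , list) = contradiction refl (Spectrum.multiplicity≢0 A∈ list zero)
attained⇒attainable u v u≢v (suc (suc m) ∷ ms) (A , A∈ , list) =
  contradiction (s≤s (s≤s z≤n)) (DeletedEdge.first-simple u v u≢v A∈ list zero zero-least)
attained⇒attainable u v u≢v (1 ∷ ms) (A , A∈ , list) = sum-3 ms (ℕ.suc-injective (Spectrum.total≡4 A∈ list))
  (λ i → Spectrum.multiplicity≢0 A∈ list (suc i))
  (λ i → DeletedEdge.no-triple u v u≢v A∈ list zero (suc i) zero-least λ ())

-- Multiplicity lists from rational diagonalisations

sum-# : (f : Vector ℝ n) → sum f # 0ℝ → ∃[ i ] f i # 0ℝ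
sum-# {zero}  f s#0 = contradiction ≈-refl (#⇒≉ s#0)
sum-# {suc n} f s#0 =
  [ (λ p → zero , p) , (λ p → let (i , q) = sum-# (f ∘ suc) p in suc i , q) ]′ (#-+ s#0)

fromℚ-< : ∀ {p q} → p ℚ.< q → fromℚ p < fromℚ q
fromℚ-< {p} {q} p<q = pos⇒< (pos-cong (pointwise λ _ → refl) (fromℚ-pos {q ℚ.- p} (ℚ-gap>0 p<q)))

∑ℚ : Vector ℚ n → ℚ
∑ℚ = Vector.foldr ℚ._+_ 0ℚ

sum-fromℚ : (f : Vector ℚ n) → sum (λ i → fromℚ (f i)) ≈ fromℚ (∑ℚ f)
sum-fromℚ {zero}  f = ≈-refl
sum-fromℚ {suc n} f = ≈-trans (+-cong ≈-refl (sum-fromℚ (f ∘ suc))) (pointwise λ _ → refl)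

sum-fromℚ-≡ : {f : Vector ℝ n} (g : Vector ℚ n) {q : ℚ} → (∀ i → f i ≈ fromℚ (g i)) → ∑ℚ g ≡ q → sum f ≈ fromℚ q
sum-fromℚ-≡ g f≈g refl = ≈-trans (sum-cong f≈g) (sum-fromℚ g)

δ : Fin n → Fin n → ℚ
δ i j = if does (i Fin.≟ j) then 1ℚ else 0ℚ

δ-diagonal : (i : Fin n) → δ i i ≡ 1ℚ
δ-diagonal i rewrite dec-true (i Fin.≟ i) refl = refl

δ-off : {i j : Fin n} → i ≢ j → δ i j ≡ 0ℚ
δ-off {i = i} {j} i≢j rewrite dec-false (i Fin.≟ j) i≢j = refl

ℚMatrix : ℕ → Set
ℚMatrix n = Fin n → Fin n → ℚ

real : ℚMatrix n → Matrix n
real A i j = fromℚ (A i j)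

-- An orthogonal eigenbasis p, grouped by eigenvalue, with the reciprocals s of
-- the squared norms.
record Diagonalisation (A : ℚMatrix n) (ms : List ℕ) : Set where
  field
    μ : Fin (length ms) → ℚ
    s : ∀ j → Fin (lookup ms j) → ℚ
    p : ∀ j → Fin (lookup ms j) → Fin n → ℚ

  -- Finitely many comparisons of rationals, hence decidable. Orthogonality is demanded only within
  -- a block; across blocks it follows from self-adjointness. The last condition is the resolution
  -- of the identity Σ s p pᵀ = I, which yields both spanning and completeness of the spectrum.
  Valid : Set
  Valid =
    (∀ i j → i Fin.< j → μ i ℚ.< μ j) ×
    (∀ j → ∃[ k ] ∃[ i ] p j k i ≢ 0ℚ) ×
    (∀ j k i → ∑ℚ (λ l → A i l ℚ.* p j k l) ≡ μ j ℚ.* p j k i) ×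
    (∀ j k l → s j k ℚ.* ∑ℚ (λ i → p j l i ℚ.* p j k i) ≡ δ l k) ×
    (∀ i l → ∑ℚ (λ j → ∑ℚ (λ k → s j k ℚ.* p j k i ℚ.* p j k l)) ≡ δ i l)

  valid? : Dec Valid
  valid? =
    (Fin.all? λ i → Fin.all? λ j → (i Fin.<? j) →-dec (μ i ℚ.<? μ j)) ×-dec
    (Fin.all? λ j → Fin.any? λ k → Fin.any? λ i → ¬? (p j k i ℚ.≟ 0ℚ)) ×-dec
    (Fin.all? λ j → Fin.all? λ k → Fin.all? λ i → _ ℚ.≟ _) ×-dec
    (Fin.all? λ j → Fin.all? λ k → Fin.all? λ l → _ ℚ.≟ _) ×-dec
    (Fin.all? λ i → Fin.all? λ l → _ ℚ.≟ _)

module _ {A : ℚMatrix n} {ms : List ℕ} (A-adj : SelfAdjoint (real A))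
  (d : Diagonalisation A ms) (valid : Diagonalisation.Valid d) where

  open Diagonalisation d

  eig : Fin (length ms) → ℝ
  eig j = fromℚ (μ j)

  vec : ∀ j → Fin (lookup ms j) → Vector ℝ n
  vec j k i = fromℚ (p j k i)

  vec∈E : ∀ j k → Eigenspace (real A) (eig j) (vec j k)
  vec∈E j k i = ≈-trans
    (sum-fromℚ-≡ (λ l → A i l ℚ.* p j k l) (λ _ → pointwise λ _ → refl) (proj₁ (proj₂ (proj₂ valid)) j k i))
    (pointwise λ _ → refl)

  norm : ∀ j k l → fromℚ (s j k) * (vec j l · vec j k) ≈ fromℚ (δ l k)
  norm j k l = ≈-trans (*-congˡ (sum-fromℚ-≡ (λ i → p j l i ℚ.* p j k i) (λ _ → pointwise λ _ → refl) refl))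
    (pointwise λ _ → proj₁ (proj₂ (proj₂ (proj₂ valid))) j k l)

  complete-basis : ∀ i l → sum (λ j → sum (λ k → fromℚ (s j k) * vec j k i * vec j k l)) ≈ fromℚ (δ i l)
  complete-basis i l = sum-fromℚ-≡ (λ j → ∑ℚ (λ k → s j k ℚ.* p j k i ℚ.* p j k l))
    (λ j → sum-fromℚ-≡ (λ k → s j k ℚ.* p j k i ℚ.* p j k l) (λ _ → pointwise λ _ → refl) refl)
    (proj₂ (proj₂ (proj₂ (proj₂ valid))) i l)

  coordinate : Vector ℝ n → ∀ j → Fin (lookup ms j) → ℝ
  coordinate v j k = fromℚ (s j k) * (vec j k · v)

  -- The resolution of the identity Σ s p pᵀ = I, applied to v.
  expansion : ∀ v i → v i ≈ sum (λ j → combination (coordinate v j) (vec j) i)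
  expansion v i = ≈-sym (begin
    sum (λ j → sum (λ k → coordinate v j k * vec j k i))
      ≈⟨ sum-cong (λ j → sum-cong λ k → ≈-trans (swap (fromℚ (s j k)) (vec j k · v) (vec j k i))
           (≈-trans (≈-sym (sum-*ˡ (c j k) (λ l → vec j k l * v l)))
             (sum-cong λ l → ≈-sym (*-assoc (c j k) (vec j k l) (v l))))) ⟩
    sum (λ j → sum (λ k → sum (λ l → c j k * vec j k l * v l)))
      ≈⟨ sum-cong (λ j → sum-swap (λ k l → c j k * vec j k l * v l)) ⟩
    sum (λ j → sum (λ l → sum (λ k → c j k * vec j k l * v l)))
      ≈⟨ sum-swap (λ j l → sum (λ k → c j k * vec j k l * v l)) ⟩
    sum (λ l → sum (λ j → sum (λ k → c j k * vec j k l * v l)))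
      ≈⟨ sum-cong (λ l → ≈-trans (sum-cong λ j → sum-*ʳ (v l) (λ k → c j k * vec j k l))
           (≈-trans (sum-*ʳ (v l) (λ j → sum (λ k → c j k * vec j k l))) (*-congʳ (complete-basis i l)))) ⟩
    sum (λ l → fromℚ (δ i l) * v l)
      ≈⟨ sum-single i (λ l → fromℚ (δ i l) * v l) (λ l l≢i → ≈-trans (*-congʳ (≡⇒≈ (cong fromℚ (δ-off (l≢i ∘ sym))))) (zeroˡ (v l))) ⟩
    fromℚ (δ i i) * v i
      ≈⟨ ≈-trans (*-congʳ (≡⇒≈ (cong fromℚ (δ-diagonal i)))) (*-identityˡ (v i)) ⟩
    v i ∎)
    where
    open import Relation.Binary.Reasoning.Setoid setoid
    c : ∀ j k → ℝ
    c j k = fromℚ (s j k) * vec j k i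
    swap : ∀ a x y → a * x * y ≈ a * y * x
    swap a x y = pointwise λ n → solve 3 (λ a x y → a :* x :* y := a :* y :* x) refl (seq a n) (seq x n) (seq y n)

  eig-increasing : ∀ i j → i Fin.< j → eig i < eig j
  eig-increasing i j i<j = fromℚ-< (proj₁ valid i j i<j)

  eig-apart : ∀ {i j} → i ≢ j → (eig i - eig j) # 0ℝ
  eig-apart = increasing⇒apart eig eig-increasing

  eigenbasis : ∀ j → IsBasis (Eigenspace (real A) (eig j)) (vec j)
  eigenbasis j = record
    { members     = vec∈E j
    -- Pairing the relation with `vec j k` and scaling by `s j k` isolates `c k`.
    ; independent = λ c rel k → begin
        c k                                                    ≈⟨ ≈-sym (*-identityʳ (c k)) ⟩
        c k * 1ℝ                                               ≈⟨ *-congˡ {c k} (≡⇒≈ (cong fromℚ (sym (δ-diagonal k)))) ⟩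
        c k * fromℚ (δ k k)                                    ≈⟨ ≈-sym (sum-single k (λ l → c l * fromℚ (δ l k)) λ l l≢k →
                                                                    null-* (c l) (≡⇒≈ (cong fromℚ (δ-off l≢k)))) ⟩
        sum (λ l → c l * fromℚ (δ l k))                        ≈⟨ sum-cong (λ l → ≈-trans (*-congˡ {c l} (≈-sym (norm j k l)))
                                                                    (*-leftSwap (c l) (fromℚ (s j k)) (vec j l · vec j k))) ⟩
        sum (λ l → fromℚ (s j k) * (c l * (vec j l · vec j k)))  ≈⟨ sum-*ˡ (fromℚ (s j k)) (λ l → c l * (vec j l · vec j k)) ⟩
        fromℚ (s j k) * sum (λ l → c l * (vec j l · vec j k))  ≈⟨ *-congˡ (≈-sym (combination-· c (vec j) (vec j k))) ⟩
        fromℚ (s j k) * (combination c (vec j) · vec j k)      ≈⟨ null-* (fromℚ (s j k)) (sum-zero λ i → ≈-trans (*-congʳ (rel i)) (zeroˡ (vec j k i))) ⟩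
        0ℝ                                                     ∎
    -- In the expansion of v the blocks of all other eigenvalues vanish by orthogonality.
    ; spanning    = λ v v∈E → coordinate v j , λ i → ≈-trans (expansion v i)
        (sum-single j (λ l → combination (coordinate v l) (vec l) i) λ l l≢j → sum-zero λ k →
          ≈-trans (*-congʳ (null-* (fromℚ (s l k))
            (eigenvectors-orthogonal (real A) A-adj {x = vec l k} {v} (eig-apart l≢j) (vec∈E l k) v∈E))) (zeroˡ (vec l k i))) }
    where
    open import Relation.Binary.Reasoning.Setoid setoid

  -- The index is constructed: a coordinate of v apart from 0 has a term apart from 0 in its
  -- expansion, so some basis vector is not orthogonal to v, and its eigenvalue must be ν.
  eigenvalue-listed : ∀ ν → IsEigenvalue (real A) ν → ∃[ j ] ν ≈ eig j
  eigenvalue-listed ν (v , (i , vi#0) , v∈E) =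
    let (j , row#0)  = sum-# (λ j → combination (coordinate v j) (vec j) i) (#-cong (expansion v i) vi#0)
        (k , term#0) = sum-# (λ k → coordinate v j k * vec j k i) row#0
        vv#0 : (vec j k · v) # 0ℝ
        vv#0 = fromℚ-#-cancelˡ (s j k) (fromℚ-#-cancelˡ (p j k i) (#-cong (*-comm (coordinate v j k) (vec j k i)) term#0))
    in j , ≈-sym (-≈0⇒≈ (*≈0⇒≈0 vv#0 (≈-trans (*-comm (eig j - ν) (vec j k · v))
             (eigenvectors-· (real A) A-adj {x = vec j k} {v} (vec∈E j k) v∈E))))

  listed-eigenvalue : ∀ ν → (∃[ j ] ν ≈ eig j) → IsEigenvalue (real A) ν
  listed-eigenvalue ν (j , ν≈) = let (k , i , p≢0) = proj₁ (proj₂ valid) j in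
    vec j k , (i , fromℚ-# p≢0) , Eigenspace-cong (real A) {v = vec j k} (≈-sym ν≈) (vec∈E j k)

  diagonalisation⇒list : IsOrderedMultiplicityList (real A) ms
  diagonalisation⇒list = record
    { eigenvalue   = eig
    ; increasing   = eig-increasing
    ; spectrum     = λ ν → mk⇔ (eigenvalue-listed ν) (listed-eigenvalue ν)
    ; multiplicity = λ j → vec j , eigenbasis j }

-- Rational Laplacian matrices and transport to the deleted edge

IsLaplacian : Graph n → ℚMatrix n → Set
IsLaplacian G A =
  (∀ i j → A i j ≡ A j i) ×
  (∀ i j → Adj G i j → A i j ℚ.< 0ℚ) ×
  (∀ i j → i ≢ j → ¬ Adj G i j → A i j ≡ 0ℚ) ×
  (∀ i → A i i ≡ ℚ.- ∑ℚ (λ k → if does (k Fin.≟ i) then 0ℚ else A i k))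

isLaplacian? : (G : Graph n) (A : ℚMatrix n) → Dec (IsLaplacian G A)
isLaplacian? G A =
  (Fin.all? λ i → Fin.all? λ j → A i j ℚ.≟ A j i) ×-dec
  (Fin.all? λ i → Fin.all? λ j → adj? G i j →-dec (A i j ℚ.<? 0ℚ)) ×-dec
  (Fin.all? λ i → Fin.all? λ j → ¬? (i Fin.≟ j) →-dec ¬? (adj? G i j) →-dec (A i j ℚ.≟ 0ℚ)) ×-dec
  (Fin.all? λ i → A i i ℚ.≟ ℚ.- ∑ℚ (λ k → if does (k Fin.≟ i) then 0ℚ else A i k))

real∈S-L : {G : Graph n} {A : ℚMatrix n} → IsLaplacian G A → real A ∈S-L G
real∈S-L {A = A} (symmetric , edge , nonEdge , diagonal) = record
  { symmetric = λ i j → ≡⇒≈ (cong fromℚ (symmetric i j))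
  ; edge      = λ i j adj → fromℚ-< (edge i j adj)
  ; nonEdge   = λ i j i≢j ¬adj → ≡⇒≈ (cong fromℚ (nonEdge i j i≢j ¬adj))
  ; diagonal  = λ i → ≈-trans (pointwise λ _ → diagonal i) (-‿cong (≈-sym
      (sum-fromℚ-≡ (λ k → if does (k Fin.≟ i) then 0ℚ else A i k)
        (λ k → ≡⇒≈ (sym (Bool.if-float fromℚ (does (k Fin.≟ i))))) refl))) }

-- Only the data are transported; validity is decided afresh for each relabelling.
relabel : ∀ {A : ℚMatrix n} {ms} (σ : Fin n → Fin n) → Diagonalisation A ms → Diagonalisation (λ i j → A (σ i) (σ j)) ms
relabel σ d = record { μ = μ ; s = s ; p = λ j k → p j k ∘ σ }
  where open Diagonalisation d

-- Swapping 0 with u and then 1 with the image of v carries u to 0 and, for u ≠ v, v to 1.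
to01 : Fin 4 → Fin 4 → Fin 4 → Fin 4
to01 u v = transpose (suc zero) (transpose zero u v) ∘ transpose zero u

-- A is given for K₄ with the edge 01 deleted and transported to the deleted edge uv.
module Example (A : ℚMatrix 4) {ms : List ℕ} (d : Diagonalisation A ms) where

  A[_,_] : Fin 4 → Fin 4 → ℚMatrix 4
  A[ u , v ] i j = A (to01 u v i) (to01 u v j)

  Correct : Set
  Correct = ∀ u v → u ≢ v → IsLaplacian (deleteEdge (complete 4) u v) A[ u , v ] ×
                            Diagonalisation.Valid (relabel (to01 u v) d)

  correct? : Dec Correct
  correct? = Fin.all? λ u → Fin.all? λ v → ¬? (u Fin.≟ v) →-dec
    isLaplacian? (deleteEdge (complete 4) u v) A[ u , v ] ×-dec Diagonalisation.valid? (relabel (to01 u v) d)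

  attains : Correct → ∀ u v → u ≢ v → Attains (deleteEdge (complete 4) u v) ms
  attains correct u v u≢v = let (laplacian , valid) = correct u v u≢v ; A∈ = real∈S-L laplacian in
    real A[ u , v ] , A∈ ,
    diagonalisation⇒list (symmetric⇒selfAdjoint (real A[ u , v ]) (_∈S-L_.symmetric A∈)) (relabel (to01 u v) d) valid

-- The three examples

fromRows : Vec.Vec (Vec.Vec ℚ 4) 4 → ℚMatrix 4
fromRows rows i j = Vec.lookup (Vec.lookup rows i) j

-- The Laplacian with weights a, b on 02, 03, weights c, d on 12, 13 and e on 23.
weighted : ℚ → ℚ → ℚ → ℚ → ℚ → ℚMatrix 4
weighted a b c d e = fromRows
  ( (a ℚ.+ b ∷ 0ℚ      ∷ ℚ.- a           ∷ ℚ.- b           ∷ [])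
  ∷ (0ℚ      ∷ c ℚ.+ d ∷ ℚ.- c           ∷ ℚ.- d           ∷ [])
  ∷ (ℚ.- a   ∷ ℚ.- c   ∷ a ℚ.+ c ℚ.+ e   ∷ ℚ.- e           ∷ [])
  ∷ (ℚ.- b   ∷ ℚ.- d   ∷ ℚ.- e           ∷ b ℚ.+ d ℚ.+ e   ∷ []) ∷ [])

-- With weight a on 02, 03, 12, 13 and e on 23, the rows of `symmetricBasis` have eigenvalues 0, 2a,
-- 2a + 2e, 4a. The last two coincide exactly for e = a. Since 2a lies below both, this family never
-- attains (1,2,1), which calls for unequal weights.
A₁₁₁₁ A₁₁₂ A₁₂₁ : ℚMatrix 4
A₁₁₁₁ = weighted (ι 2) (ι 2) (ι 2) (ι 2) (ι 1)
A₁₁₂  = weighted (ι 1) (ι 1) (ι 1) (ι 1) (ι 1)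
-- 16 I - 4 J + q qᵀ with q = (2, 2, -1, -3).
A₁₂₁  = weighted (ι 6) (ι 10) (ι 6) (ι 10) (ι 1)

symmetricBasis : ℚMatrix 4
symmetricBasis = fromRows
  ( (1ℚ ∷ 1ℚ     ∷ 1ℚ     ∷ 1ℚ     ∷ [])
  ∷ (1ℚ ∷ ℚ.- 1ℚ ∷ 0ℚ     ∷ 0ℚ     ∷ [])
  ∷ (0ℚ ∷ 0ℚ     ∷ 1ℚ     ∷ ℚ.- 1ℚ ∷ [])
  ∷ (1ℚ ∷ 1ℚ     ∷ ℚ.- 1ℚ ∷ ℚ.- 1ℚ ∷ []) ∷ [])

d₁₁₁₁ : Diagonalisation A₁₁₁₁ (1 ∷ 1 ∷ 1 ∷ 1 ∷ [])
d₁₁₁₁ = record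
  { μ = Vec.lookup (ι 0 ∷ ι 4 ∷ ι 6 ∷ ι 8 ∷ [])
  ; s = blocks (1 ∷ 1 ∷ 1 ∷ 1 ∷ []) (Vec.lookup (int 1 ℚ./ 4 ∷ ½ ∷ ½ ∷ int 1 ℚ./ 4 ∷ []))
  ; p = blocks (1 ∷ 1 ∷ 1 ∷ 1 ∷ []) symmetricBasis }

d₁₁₂ : Diagonalisation A₁₁₂ (1 ∷ 1 ∷ 2 ∷ [])
d₁₁₂ = record
  { μ = Vec.lookup (ι 0 ∷ ι 2 ∷ ι 4 ∷ [])
  ; s = blocks (1 ∷ 1 ∷ 2 ∷ []) (Vec.lookup (int 1 ℚ./ 4 ∷ ½ ∷ ½ ∷ int 1 ℚ./ 4 ∷ []))
  ; p = blocks (1 ∷ 1 ∷ 2 ∷ []) symmetricBasis }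

-- The vector q is orthogonal to `ones`, with q₀ q₁ = 4 to cancel the entry 01 of - 4 J and all
-- other products of two distinct entries below 4. Its eigenvalue is 16 + ⟨q,q⟩ = 34, while 16 is
-- the eigenvalue on the plane orthogonal to `ones` and q, spanned by the two middle rows.
d₁₂₁ : Diagonalisation A₁₂₁ (1 ∷ 2 ∷ 1 ∷ [])
d₁₂₁ = record
  { μ = Vec.lookup (ι 0 ∷ ι 16 ∷ ι 34 ∷ [])
  ; s = blocks (1 ∷ 2 ∷ 1 ∷ []) (Vec.lookup (int 1 ℚ./ 4 ∷ ½ ∷ int 1 ℚ./ 36 ∷ int 1 ℚ./ 18 ∷ []))
  ; p = blocks (1 ∷ 2 ∷ 1 ∷ []) (fromRows
    ( (1ℚ  ∷ 1ℚ     ∷ 1ℚ       ∷ 1ℚ       ∷ [])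
    ∷ (1ℚ  ∷ ℚ.- 1ℚ ∷ 0ℚ       ∷ 0ℚ       ∷ [])
    ∷ (1ℚ  ∷ 1ℚ     ∷ ℚ.- ι 5  ∷ ι 3      ∷ [])
    ∷ (ι 2 ∷ ι 2    ∷ ℚ.- 1ℚ   ∷ ℚ.- ι 3  ∷ []) ∷ [])) }

abstract
  correct₁₁₁₁ : Example.Correct A₁₁₁₁ d₁₁₁₁
  correct₁₁₁₁ = toWitness {a? = Example.correct? A₁₁₁₁ d₁₁₁₁} _

  correct₁₁₂ : Example.Correct A₁₁₂ d₁₁₂
  correct₁₁₂ = toWitness {a? = Example.correct? A₁₁₂ d₁₁₂} _

  correct₁₂₁ : Example.Correct A₁₂₁ d₁₂₁
  correct₁₂₁ = toWitness {a? = Example.correct? A₁₂₁ d₁₂₁} _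

attainable⇒attained : ∀ u v → u ≢ v → ∀ {ms} → ms ∈ attainable → Attains (deleteEdge (complete 4) u v) ms
attainable⇒attained u v u≢v (here refl)                 = Example.attains A₁₁₁₁ d₁₁₁₁ correct₁₁₁₁ u v u≢v
attainable⇒attained u v u≢v (there (here refl))         = Example.attains A₁₁₂ d₁₁₂ correct₁₁₂ u v u≢v
attainable⇒attained u v u≢v (there (there (here refl))) = Example.attains A₁₂₁ d₁₂₁ correct₁₂₁ u v u≢v

theorem3p8 : (u v : Fin 4) → Adj (complete 4) u v → (ms : List ℕ) →
    Attains (deleteEdge (complete 4) u v) ms ⇔
    (ms ∈ (1 ∷ 1 ∷ 1 ∷ 1 ∷ []) ∷ (1 ∷ 1 ∷ 2 ∷ []) ∷ (1 ∷ 2 ∷ 1 ∷ []) ∷ [])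
theorem3p8 u v u≢v ms = mk⇔ (attained⇒attainable u v u≢v ms) (attainable⇒attained u v u≢v)
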